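{- Let $k,\ell\ge1$, $\lambda\in\mathrm{Par}^k_\ell$, $z\in[\ell]$, $\mu=\lambda-\epsilon_z$, and $\Psi=\Delta^k(\mu)$. Let $c=|\mathrm{uppath}_\Psi(z)|$. If $z=\ell$, or $\lambda_z>\lambda_{z+1}$, or $\mathrm{up}_\Psi^c(z+1)$ is undefined, set $h=0$. Otherwise set $y+1=\mathrm{up}^c_\Psi(z+1)$ and let $h\in[\ell-z]$ be as large as possible such that $\mu$ is constant on each of the intervals $[z+1,z+h]$, $[x,x+h]$ for every $x\in\mathrm{uppath}_\Psi(z)\setminus\{z\}$, and $[y+1,y+h]$. Define $\mathrm{cvr}_z(\lambda)=\lambda+\epsilon_{[y+1,y+h]}-\epsilon_{[z,z+h]}$ (interpreting $[y+1,y+h]=\varnothing$ when $h=0$, so that $\mathrm{cvr}_z(\lambda)=\mu$ then). Then $$\mathfrak s^{(k)}_\mu=t^{hc}\,\mathfrak s^{(k)}_{\mathrm{cvr}_z(\lambda)},$$ and this is equal to $0$ if $\mathrm{cvr}_z(\lambda)\notin\mathrm{Par}^k_\ell$.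
   Context: $[a,b]=\{i\in\mathbb Z:a\le i\le b\}$, $[n]=[1,n]$; $\epsilon_i\in\mathbb Z^\ell$ standard basis vectors, $\epsilon_S=\sum_{i\in S}\epsilon_i$. For $\gamma\in\mathbb Z^\ell$, $s_\gamma=\det(h_{\gamma_i+j-i})_{1\le i,j\le\ell}$ ($h_0=1$, $h_d=0$ for $d<0$). $\Delta^+_\ell=\{(i,j):1\le i<j\le\ell\}$ with partial order $(a,b)\le(c,d)$ iff $a\ge c$ and $b\le d$; a root ideal is an upper order ideal. For $\Psi\subset\Delta^+_\ell$ and $\gamma\in\mathbb Z^\ell$, $H(\Psi;\gamma)$ is obtained by expanding $\prod_{(i,j)\in\Psi}(1-tz_i/z_j)^{ -1}z^\gamma$ as a power series in $t$ and applying coefficientwise the linear map $z^\beta\mapsto s_\beta$. $\mathrm{Par}^k_\ell=\{\nu\in\mathbb Z^\ell:k\ge\nu_1\ge\dots\ge\nu_\ell\ge0\}$. For $\nu\in\mathbb Z^\ell$ with entries $\le k$, $\Delta^k(\nu)=\{(i,j)\in\Delta^+_\ell:k-\nu_i+i<j\}$ and $\mathfrak s^{(k)}_\nu=H(\Delta^k(\nu);\nu)$. A root $\alpha\in\Psi$ is removable if $\Psi\setminus\{\alpha\}$ is a root ideal. $\mathrm{up}_\Psi(x)=i$ if $(i,x)$ is a removable root of $\Psi$ (undefined otherwise); $\mathrm{up}^j_\Psi$ is its $j$-fold iterate. $\mathrm{uppath}_\Psi(x)=(x,\mathrm{up}_\Psi(x),\mathrm{up}^2_\Psi(x),\dots)$,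 continued as long as defined. -}

module Defs where

open import Level using (Level)
open import Data.Bool using (Bool; true; false; _∧_; _∨_; not; if_then_else_; T)
open import Data.Nat as ℕ using (ℕ; zero; suc; _∸_; _≤ᵇ_; _≡ᵇ_)
open import Data.Nat.Properties using ()
open import Data.Integer as ℤ using (ℤ; +_; -[1+_])
open import Data.Fin using (Fin; toℕ; punchIn)
import Data.Fin as Fin
open import Data.List using (List; []; _∷_; map; concatMap; upTo; length; filterᵇ)
open import Data.Bool.ListAction using (all; any)
open import Data.Maybe using (Maybe; just; nothing)
open import Data.Product using (_×_; _,_)
open import Algebra.Bundles using (CommutativeRing)

-- Vectors in ℤ^ℓ are functions ℕ → ℤ, read at the 1-based indices 1..ℓ.
-- Roots (i , j) are pairs of natural numbers with 1 ≤ i < j ≤ ℓ.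

Root : Set
Root = ℕ × ℕ

range : ℕ → ℕ → List ℕ
range a b = map (a ℕ.+_) (upTo (suc b ∸ a))

_==_ : ℕ → ℕ → Bool
m == n = m ≡ᵇ n

_<ᵇ_ : ℕ → ℕ → Bool
m <ᵇ n = suc m ≤ᵇ n

_==ℤ_ : ℤ → ℤ → Bool
a ==ℤ b = (a ℤ.≤ᵇ b) ∧ (b ℤ.≤ᵇ a)

_<ℤᵇ_ : ℤ → ℤ → Bool
a <ℤᵇ b = not (b ℤ.≤ᵇ a)

eqRoot : Root → Root → Bool
eqRoot (a , b) (c , d) = (a == c) ∧ (b == d)

memRoot : Root → List Root → Bool
memRoot α S = any (eqRoot α) S

posRoots : ℕ → List Root
posRoots ℓ = concatMap (λ i → map (λ j → (i , j)) (range (suc i) ℓ)) (range 1 ℓ)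

rootLeq : Root → Root → Bool
rootLeq (a , b) (c , d) = (c ≤ᵇ a) ∧ (b ≤ᵇ d)

isRootIdeal : ℕ → List Root → Bool
isRootIdeal ℓ S = all (λ α → all (λ β → not (rootLeq α β) ∨ memRoot β S) (posRoots ℓ)) S

removable : ℕ → List Root → Root → Bool
removable ℓ Ψ α = memRoot α Ψ ∧ isRootIdeal ℓ (filterᵇ (λ β → not (eqRoot β α)) Ψ)

findFirst : (ℕ → Bool) → List ℕ → Maybe ℕ
findFirst p [] = nothing
findFirst p (x ∷ xs) = if p x then just x else findFirst p xs

up : ℕ → List Root → ℕ → Maybe ℕ
up ℓ Ψ x = findFirst (λ i → removable ℓ Ψ (i , x)) (range 1 (x ∸ 1))

upIter : ℕ → List Root → ℕ → ℕ → Maybe ℕ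
upIter ℓ Ψ zero x = just x
upIter ℓ Ψ (suc j) x with up ℓ Ψ x
... | nothing = nothing
... | just i  = upIter ℓ Ψ j i

-- uppath with fuel (up strictly decreases indices, so fuel x suffices for x)
uppathF : ℕ → List Root → ℕ → ℕ → List ℕ
uppathF ℓ Ψ zero x = []
uppathF ℓ Ψ (suc f) x with up ℓ Ψ x
... | nothing = x ∷ []
... | just i  = x ∷ uppathF ℓ Ψ f i

uppath : ℕ → List Root → ℕ → List ℕ
uppath ℓ Ψ x = uppathF ℓ Ψ x x

Δk : ℕ → ℕ → (ℕ → ℤ) → List Root
Δk k ℓ ν = filterᵇ (λ { (i , j) → ((+ k) ℤ.- ν i ℤ.+ (+ i)) <ℤᵇ (+ j) }) (posRoots ℓ)

record InPar (k ℓ : ℕ) (ν : ℕ → ℤ) : Set where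
  field
    bounded    : ∀ i → 1 ℕ.≤ i → i ℕ.≤ ℓ → ν i ℤ.≤ + k
    nonneg     : ∀ i → 1 ℕ.≤ i → i ℕ.≤ ℓ → + 0 ℤ.≤ ν i
    decreasing : ∀ i → 1 ℕ.≤ i → i ℕ.< ℓ → ν (suc i) ℤ.≤ ν i

ind : ℕ → ℕ → ℕ → ℤ
ind a b i = if (a ≤ᵇ i) ∧ (i ≤ᵇ b) then + 1 else + 0

addRoot : (ℕ → ℤ) → ℕ → ℕ → ℕ → (ℕ → ℤ)
addRoot γ i j a n = γ n ℤ.+ (if n == i then + a else + 0) ℤ.- (if n == j then + a else + 0)

constOn : (ℕ → ℤ) → ℕ → ℕ → Bool
constOn ν a b = all (λ i → ν i ==ℤ ν a) (range a b)

maxSat : ℕ → (ℕ → Bool) → ℕ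
maxSat zero p = 0
maxSat (suc n) p = if p (suc n) then suc n else maxSat n p

module Cover (k ℓ : ℕ) (lam : ℕ → ℤ) (z : ℕ) where
  μ : ℕ → ℤ
  μ i = lam i ℤ.- ind z z i

  Ψ : List Root
  Ψ = Δk k ℓ μ

  path : List ℕ
  path = uppath ℓ Ψ z

  c : ℕ
  c = length path

  condH : ℕ → ℕ → Bool
  condH y h = constOn μ (suc z) (z ℕ.+ h)
            ∧ all (λ x → constOn μ x (x ℕ.+ h)) (filterᵇ (λ x → not (x == z)) path)
            ∧ constOn μ (suc y) (y ℕ.+ h)

  -- (h , y) ; y is irrelevant when h = 0
  hy : ℕ × ℕ
  hy with z == ℓ | (lam (suc z)) <ℤᵇ (lam z) | upIter ℓ Ψ c (suc z)
  ... | true  | _     | _        = (0 , 0)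
  ... | false | true  | _        = (0 , 0)
  ... | false | false | nothing  = (0 , 0)
  ... | false | false | just y+1 = (maxSat (ℓ ∸ z) (condH (y+1 ∸ 1)) , y+1 ∸ 1)

  h : ℕ
  h with hy
  ... | (h' , _) = h'

  y : ℕ
  y with hy
  ... | (_ , y') = y'

  cvr : ℕ → ℤ
  cvr i = lam i ℤ.+ ind (suc y) (y ℕ.+ h) i ℤ.- ind z (z ℕ.+ h) i

-- Symmetric-function part, over an arbitrary commutative ring R with an
-- arbitrary sequence hs (hs (suc n) plays the role of h_{n+1}; hs 0 unused).

module SymFun {c r : Level} (R : CommutativeRing c r) (hs : ℕ → CommutativeRing.Carrier R) where
  open CommutativeRing R

  hh : ℤ → Carrier
  hh -[1+ n ] = 0#
  hh (+ zero) = 1#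
  hh (+ suc n) = hs (suc n)

  sumFin : ∀ {n} → (Fin n → Carrier) → Carrier
  sumFin {zero} f = 0#
  sumFin {suc n} f = f Fin.zero + sumFin (λ i → f (Fin.suc i))

  sign : ℕ → Carrier
  sign zero = 1#
  sign (suc zero) = - 1#
  sign (suc (suc n)) = sign n

  det : ∀ {n} → (Fin n → Fin n → Carrier) → Carrier
  det {zero} M = 1#
  det {suc n} M = sumFin (λ j → sign (toℕ j) * (M Fin.zero j * det (λ a b → M (Fin.suc a) (punchIn j b))))

  s : ℕ → (ℕ → ℤ) → Carrier
  s ℓ γ = det {ℓ} (λ i j → hh (γ (suc (toℕ i)) ℤ.+ (+ toℕ j) ℤ.- (+ toℕ i)))

  sumTo : ℕ → (ℕ → Carrier) → Carrier
  sumTo zero f = f 0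
  sumTo (suc m) f = sumTo m f + f (suc m)

  -- coefficient of t^m in H(Ψ;γ): expand Π_{(i,j)∈Ψ} Σ_a t^a (z_i/z_j)^a z^γ
  Hcoef : ℕ → List Root → (ℕ → ℤ) → ℕ → Carrier
  Hcoef ℓ [] γ zero = s ℓ γ
  Hcoef ℓ [] γ (suc m) = 0#
  Hcoef ℓ ((i , j) ∷ Ψ) γ m = sumTo m (λ a → Hcoef ℓ Ψ (addRoot γ i j a) (m ∸ a))

  -- 𝔰^{(k)}_ν = H(Δ^k(ν);ν), as its sequence of t-coefficients
  kschur : ℕ → ℕ → (ℕ → ℤ) → ℕ → Carrier
  kschur k ℓ ν = Hcoef ℓ (Δk k ℓ ν) ν

  tshift : ℕ → (ℕ → Carrier) → ℕ → Carrier
  tshift n f m = if n ≤ᵇ m then f (m ∸ n) else 0#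

{-# OPTIONS --safe #-}
module Submission where

-- Rows x, x+1 of a root ideal form a wall if they start in the same column, and columns x, x+1 have a
-- ceiling if no row starts in column x+1. With both, the ideal is invariant under the transposition
-- (x, x+1), so H(Ψ;γ) = 0 when γ_{x+1} = γ_x + 1, because s_γ is antisymmetric under the dot action.
-- All other identities come from H(Ψ;γ) = H(Ψ ∪ α;γ) - t H(Ψ ∪ α;γ+α), choosing the root α so that one
-- of the two terms on the right is known to vanish. A ceiling in columns x, x+1 is pushed down the path
-- from x to z until it meets the wall in rows z, z+1, which makes H vanish (H-mirror). If instead some
-- row Q starts in column x+1, removing the root (Q, x+1) and then the roots along the path trades γ for
-- γ + ε_Q - ε_{z+1}, at the price of one factor t for each entry of the path (H-bounce). Repeating this
-- with all positions shifted by one gives the h steps from μ to cvr(λ); when they stop too early for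
-- cvr(λ) to be a partition, a ceiling above a wall (or a negative last part) forces H to be 0.

-- Row i of Δᵏ(λ) starts in column r_i = k - λ_i + i + 1, so a weight and its ideal are the same
-- data: weak decrease of λ is strict increase of r, equal neighbours are rows starting in
-- consecutive columns, and a tie r_z = r_{z+1} is at once a wall and the relation γ_{z+1} = γ_z +
-- 1. During a bounce ideal and weight do not match; this is why `H` takes both, and why a bounce
-- includes two further root moves that cost nothing and restore the match.
--
-- The intervals in the definition of h come from the bounces number 0, ..., h-1. Bounce i needs the
-- wall in rows z+i, z+i+1, a row y+1+i starting in column t+1+i (t being the last entry of the
-- path), and for each path entry x other than z two rows x+i, x+i+1 starting in consecutive
-- columns. With λ_z = λ_{z+1} this is constancy on [z+1,z+h], [y+1,y+h] and [x,x+h].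
--
-- The ring may have 2-torsion, where f = -f does not give f = 0. Vanishing on fixed weights is
-- therefore proved side by side with antisymmetry, starting from a determinant with two equal rows.

open import Defs
open import Level using (Level; Lift)
open import Algebra.Bundles using (CommutativeRing)
import Algebra.Properties.CommutativeSemigroup
import Algebra.Properties.Ring
open import Data.Bool using (Bool; true; false; T; T?; _∧_; _∨_; not; if_then_else_)
open import Data.Bool.ListAction using (all)
open import Data.Bool.Properties using (T-∧; T-∨; T-≡; ¬-not)
open import Data.Fin as Fin using (Fin; toℕ; punchIn; inject₁; fromℕ<)
open import Data.Fin.Properties using (suc-injective; toℕ-fromℕ; toℕ-fromℕ<; toℕ-inject₁; toℕ-injective; toℕ<n)
open import Data.Integer as ℤ using (ℤ; +_; -[1+_])
import Data.Integer.Properties as ℤₚ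
import Data.Integer.Tactic.RingSolver as ℤ-Solver
open import Data.List using (List; []; _∷_; _++_; filterᵇ; length; map)
open import Data.List.Membership.Propositional using (_∈_; find; lose)
open import Data.List.Membership.Propositional.Properties
  using (∈-∃++; ∈-map⁺; ∈-map⁻; ∈-upTo⁺; ∈-upTo⁻; ∈-concatMap⁺; ∈-concatMap⁻; ∈-filter⁺; ∈-filter⁻)
open import Data.List.Membership.Propositional.Properties.WithK using (unique∧set⇒bag)
open import Data.List.Relation.Binary.BagAndSetEquality using (∼bag⇒↭)
open import Data.List.Relation.Binary.Permutation.Propositional as ↭ using (_↭_; ↭-refl; ↭-sym; ↭-trans)
open import Data.List.Relation.Binary.Permutation.Propositional.Properties
  using (shift; drop-∷; ∈-resp-↭; ↭-length) renaming (map⁺ to ↭-map⁺)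
open import Data.List.Relation.Unary.All as All using (All; []; _∷_)
import Data.List.Relation.Unary.All.Properties as Allₚ
import Data.List.Relation.Unary.AllPairs as AllPairs
import Data.List.Relation.Unary.AllPairs.Properties as AllPairsₚ
open import Data.List.Relation.Unary.Any as Any using (here; there)
import Data.List.Relation.Unary.Any.Properties as Anyₚ
open import Data.List.Relation.Unary.Unique.Propositional using (Unique)
import Data.List.Relation.Unary.Unique.Propositional.Properties as Uniqueₚ
open import Data.Maybe using (just; nothing)
open import Data.Nat as ℕ using (ℕ; zero; suc; _∸_; z≤n; s≤s; _≤_; _≤ᵇ_)
open import Data.Nat.Properties as ℕₚ using (≤ᵇ⇒≤; ≤⇒≤ᵇ; ≡ᵇ⇒≡; ≡⇒≡ᵇ)
open import Data.Product using (_×_; _,_; proj₁; proj₂; ∃-syntax)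
open import Data.Product.Properties using () renaming (≡-dec to ×-≡-dec)
open import Data.Sum using (_⊎_; inj₁; inj₂; [_,_]′)
open import Data.Unit using (⊤)
open import Function using (_∘_)
open import Function.Bundles using (Equivalence; mk⇔)
open import Relation.Binary.Definitions using (tri<; tri≈; tri>)
open import Relation.Binary.PropositionalEquality as ≡ using (_≡_; _≢_; _≗_; cong; cong₂; subst)
import Relation.Binary.Reasoning.Setoid
open import Relation.Nullary using (¬_; yes; no; contradiction)

-- The dot action on weights

==-true : ∀ {m n} → m ≡ n → (m == n) ≡ true
==-true {m} {n} e = Equivalence.to T-≡ (≡⇒≡ᵇ m n e)

==-false : ∀ {m n} → m ≢ n → (m == n) ≡ false
==-false {m} {n} ne = ¬-not (λ e → ne (≡ᵇ⇒≡ m n (Equivalence.from T-≡ e)))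

==-cong : ∀ {m n m′ n′} → (m ≡ n → m′ ≡ n′) → (m′ ≡ n′ → m ≡ n) → (m == n) ≡ (m′ == n′)
==-cong {m} {n} f g with m ℕ.≟ n
... | yes e = ≡.trans (==-true e) (≡.sym (==-true (f e)))
... | no ne = ≡.trans (==-false ne) (≡.sym (==-false (λ e → ne (g e))))

-- This is the `if` inside `addRoot`, so `addRoot γ i j a n` is `γ n + bump i a n - bump j a n` by
-- definition, and weight identities become ring identities in the bumps.
bump : ℕ → ℕ → ℕ → ℤ
bump i a n = if n == i then + a else + 0

bump-at : ∀ i a → bump i a i ≡ + a
bump-at i a rewrite ==-true {i} ≡.refl = ≡.refl

bump-off : ∀ {i} a {n} → n ≢ i → bump i a n ≡ + 0
bump-off {i} a ne rewrite ==-false ne = ≡.refl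

bump-+ : ∀ i a b n → bump i (a ℕ.+ b) n ≡ bump i a n ℤ.+ bump i b n
bump-+ i a b n with n == i
... | true  = ℤₚ.pos-+ a b
... | false = ≡.refl

bump-zero : ∀ i n → bump i 0 n ≡ + 0
bump-zero i n with n == i
... | true  = ≡.refl
... | false = ≡.refl

infixl 6 _⊕_
_⊕_ : (ℕ → ℤ) → Root → ℕ → ℤ
γ ⊕ (i , j) = addRoot γ i j 1

⊕-lower : ∀ γ {i j} → i ≢ j → (γ ⊕ (i , j)) i ≡ γ i ℤ.+ + 1
⊕-lower γ {i} {j} i≢j rewrite bump-at i 1 | bump-off 1 i≢j = ℤₚ.+-identityʳ _

⊕-upper : ∀ γ {i j} → i ≢ j → (γ ⊕ (i , j)) j ≡ γ j ℤ.- + 1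
⊕-upper γ {i} {j} i≢j rewrite bump-at j 1 | bump-off 1 (i≢j ∘ ≡.sym) | ℤₚ.+-identityʳ (γ j) = ≡.refl

⊕-other : ∀ γ {i j n} → n ≢ i → n ≢ j → (γ ⊕ (i , j)) n ≡ γ n
⊕-other γ {i} {j} {n} n≢i n≢j rewrite bump-off 1 n≢i | bump-off 1 n≢j =
  ≡.trans (ℤₚ.+-identityʳ _) (ℤₚ.+-identityʳ _)

⊕-congAt : ∀ {γ γ′} α {n} → γ n ≡ γ′ n → (γ ⊕ α) n ≡ (γ′ ⊕ α) n
⊕-congAt (i , j) {n} e = cong (λ x → x ℤ.+ bump i 1 n ℤ.- bump j 1 n) e

⊕-comm : ∀ γ α β → γ ⊕ α ⊕ β ≗ γ ⊕ β ⊕ α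
⊕-comm γ (i , j) (i′ , j′) n = lemma (γ n) (bump i 1 n) (bump j 1 n) (bump i′ 1 n) (bump j′ 1 n)
  where
  lemma : ∀ g x y u v → g ℤ.+ x ℤ.- y ℤ.+ u ℤ.- v ≡ g ℤ.+ u ℤ.- v ℤ.+ x ℤ.- y
  lemma = ℤ-Solver.solve-∀

addRoot-zero : ∀ γ i j → addRoot γ i j 0 ≗ γ
addRoot-zero γ i j n rewrite bump-zero i n | bump-zero j n = ≡.trans (ℤₚ.+-identityʳ _) (ℤₚ.+-identityʳ _)

addRoot-suc : ∀ γ i j a → addRoot γ i j (suc a) ≗ addRoot (γ ⊕ (i , j)) i j a
addRoot-suc γ i j a n rewrite bump-+ i 1 a n | bump-+ j 1 a n =
  lemma (γ n) (bump i 1 n) (bump i a n) (bump j 1 n) (bump j a n)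
  where
  lemma : ∀ g x x′ y y′ → g ℤ.+ (x ℤ.+ x′) ℤ.- (y ℤ.+ y′) ≡ g ℤ.+ x ℤ.- y ℤ.+ x′ ℤ.- y′
  lemma = ℤ-Solver.solve-∀

opaque
  swapIx : ℕ → ℕ → ℕ
  swapIx p n with n ℕ.≟ p | n ℕ.≟ suc p
  ... | yes _ | _     = suc p
  ... | no _  | yes _ = p
  ... | no _  | no _  = n

  swapIx-lower : ∀ p → swapIx p p ≡ suc p
  swapIx-lower p with p ℕ.≟ p
  ... | yes _ = ≡.refl
  ... | no ne = contradiction ≡.refl ne

  swapIx-upper : ∀ p → swapIx p (suc p) ≡ p
  swapIx-upper p with suc p ℕ.≟ p | suc p ℕ.≟ suc p
  ... | yes e | _     = contradiction e (ℕₚ.1+n≢n)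
  ... | no _  | yes _ = ≡.refl
  ... | no _  | no ne = contradiction ≡.refl ne

  swapIx-other : ∀ {p n} → n ≢ p → n ≢ suc p → swapIx p n ≡ n
  swapIx-other {p} {n} n≢p n≢p+1 with n ℕ.≟ p | n ℕ.≟ suc p
  ... | yes e | _     = contradiction e n≢p
  ... | no _  | yes e = contradiction e n≢p+1
  ... | no _  | no _  = ≡.refl

swapIx-involutive : ∀ p n → swapIx p (swapIx p n) ≡ n
swapIx-involutive p n = go (n ℕ.≟ p) (n ℕ.≟ suc p)
  where
  go : _ → _ → swapIx p (swapIx p n) ≡ n
  go (yes ≡.refl) _ = ≡.trans (cong (swapIx p) (swapIx-lower p)) (swapIx-upper p)
  go (no _) (yes ≡.refl) = ≡.trans (cong (swapIx p) (swapIx-upper p)) (swapIx-lower p)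
  go (no a) (no b) = ≡.trans (cong (swapIx p) (swapIx-other a b)) (swapIx-other a b)

swapRoot : ℕ → Root → Root
swapRoot p (i , j) = swapIx p i , swapIx p j

swapRoot-involutive : ∀ p α → swapRoot p (swapRoot p α) ≡ α
swapRoot-involutive p (i , j) = cong₂ _,_ (swapIx-involutive p i) (swapIx-involutive p j)

-- The dot action of the simple reflection (p, p+1), the one under which s_γ is antisymmetric.
dot : ℕ → (ℕ → ℤ) → ℕ → ℤ
dot p γ = (γ ∘ swapIx p) ⊕ (suc p , p)

dot-lower : ∀ p γ → dot p γ p ≡ γ (suc p) ℤ.- + 1
dot-lower p γ = ≡.trans (⊕-upper (γ ∘ swapIx p) {suc p} {p} ℕₚ.1+n≢n) (cong (λ n → γ n ℤ.- + 1) (swapIx-lower p))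

dot-upper : ∀ p γ → dot p γ (suc p) ≡ γ p ℤ.+ + 1
dot-upper p γ = ≡.trans (⊕-lower (γ ∘ swapIx p) {suc p} {p} ℕₚ.1+n≢n) (cong (λ n → γ n ℤ.+ + 1) (swapIx-upper p))

dot-other : ∀ {p} γ {n} → n ≢ p → n ≢ suc p → dot p γ n ≡ γ n
dot-other {p} γ {n} a b = ≡.trans (⊕-other (γ ∘ swapIx p) {suc p} {p} b a) (cong γ (swapIx-other a b))

bump-swap : ∀ p i n → bump i 1 (swapIx p n) ≡ bump (swapIx p i) 1 n
bump-swap p i n = cong (λ b → if b then + 1 else + 0) (==-cong
    (λ e → ≡.trans (≡.sym (swapIx-involutive p n)) (cong (swapIx p) e))
    (λ e → ≡.trans (cong (swapIx p) e) (swapIx-involutive p i)))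

-- The dot action is a linear reflection followed by a fixed translation, so only the linear part
-- reaches the added root.
dot-⊕ : ∀ p γ α → dot p (γ ⊕ α) ≗ dot p γ ⊕ swapRoot p α
dot-⊕ p γ (i , j) n rewrite bump-swap p i n | bump-swap p j n =
  lemma (γ (swapIx p n)) (bump (swapIx p i) 1 n) (bump (swapIx p j) 1 n) (bump (suc p) 1 n) (bump p 1 n)
  where
  lemma : ∀ g x y u v → g ℤ.+ x ℤ.- y ℤ.+ u ℤ.- v ≡ g ℤ.+ u ℤ.- v ℤ.+ x ℤ.- y
  lemma = ℤ-Solver.solve-∀

dot-fixed : ∀ {p γ} → γ (suc p) ≡ γ p ℤ.+ + 1 → dot p γ ≗ γ
dot-fixed {p} {γ} e n = go (n ℕ.≟ p) (n ℕ.≟ suc p)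
  where
  go : _ → _ → dot p γ n ≡ γ n
  go (yes ≡.refl) _ = ≡.trans (dot-lower p γ) (≡.trans (cong (ℤ._- + 1) e) (lemma (γ p)))
    where
    lemma : ∀ x → x ℤ.+ + 1 ℤ.- + 1 ≡ x
    lemma = ℤ-Solver.solve-∀
  go (no _) (yes ≡.refl) = ≡.trans (dot-upper p γ) (≡.sym e)
  go (no a) (no b) = dot-other γ a b

AgreeUpTo : ℕ → (ℕ → ℤ) → (ℕ → ℤ) → Set
AgreeUpTo ℓ γ γ′ = ∀ n → 1 ≤ n → n ≤ ℓ → γ n ≡ γ′ n

-- Root ideals

-- Catalan functions see a root list only up to order, and a list without repetitions is determined
-- up to order by its members. Root ideals are compared in this way throughout.
↭-unique : ∀ {A : Set} {xs ys : List A} → Unique xs → Unique ys →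
  (∀ {x} → x ∈ xs → x ∈ ys) → (∀ {x} → x ∈ ys → x ∈ xs) → xs ↭ ys
↭-unique u v f g = ∼bag⇒↭ (unique∧set⇒bag u v (mk⇔ f g))

∈-range⁺ : ∀ {a b n} → a ≤ n → n ≤ b → n ∈ range a b
∈-range⁺ {a} {b} {n} a≤n n≤b = subst (_∈ range a b) (ℕₚ.m+[n∸m]≡n a≤n)
  (∈-map⁺ (a ℕ.+_) (∈-upTo⁺ (ℕₚ.∸-monoˡ-< (s≤s n≤b) a≤n)))

∈-range⁻ : ∀ {a b n} → n ∈ range a b → a ≤ n × n ≤ b
∈-range⁻ {a} {b} n∈ with ∈-map⁻ (a ℕ.+_) n∈
... | d , d∈ , ≡.refl = ℕₚ.m≤m+n a d , ℕₚ.≤-pred (subst (suc (a ℕ.+ d) ℕ.≤_) (ℕₚ.m+[n∸m]≡n a≤1+b)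
    (subst (ℕ._≤ a ℕ.+ (suc b ∸ a)) (ℕₚ.+-suc a d) (ℕₚ.+-monoʳ-≤ a d<)))
  where
  d< : d ℕ.< suc b ∸ a
  d< = ∈-upTo⁻ d∈
  a≤1+b : a ≤ suc b
  a≤1+b = ℕₚ.<⇒≤ (ℕₚ.m∸n≢0⇒n<m (ℕₚ.m<n⇒n≢0 d<))

range-unique : ∀ a b → Unique (range a b)
range-unique a b = Uniqueₚ.map⁺ (ℕₚ.+-cancelˡ-≡ a _ _) (Uniqueₚ.upTo⁺ _)

IsPosRoot : ℕ → Root → Set
IsPosRoot ℓ (i , j) = 1 ≤ i × i ℕ.< j × j ≤ ℓ

∈-posRoots⁺ : ∀ {ℓ α} → IsPosRoot ℓ α → α ∈ posRoots ℓ
∈-posRoots⁺ {ℓ} {i , j} (1≤i , i<j , j≤ℓ) = ∈-concatMap⁺ (λ i → map (i ,_) (range (suc i) ℓ))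
  (lose (∈-range⁺ 1≤i (ℕₚ.≤-trans (ℕₚ.<⇒≤ i<j) j≤ℓ)) (∈-map⁺ (i ,_) (∈-range⁺ i<j j≤ℓ)))

∈-posRoots⁻ : ∀ {ℓ α} → α ∈ posRoots ℓ → IsPosRoot ℓ α
∈-posRoots⁻ {ℓ} α∈ with find (∈-concatMap⁻ (λ i → map (i ,_) (range (suc i) ℓ)) {xs = range 1 ℓ} α∈)
... | i , i∈ , α∈′ with ∈-map⁻ (i ,_) α∈′
... | j , j∈ , ≡.refl = proj₁ (∈-range⁻ i∈) , ∈-range⁻ j∈

posRoots-unique : ∀ ℓ → Unique (posRoots ℓ)
posRoots-unique ℓ = Uniqueₚ.concat⁺
  (Allₚ.map⁺ (All.universal (λ i → Uniqueₚ.map⁺ (cong proj₂) (range-unique (suc i) ℓ)) _))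
  (AllPairsₚ.map⁺ (AllPairs.map disjoint (range-unique 1 ℓ)))
  where
  disjoint : ∀ {i i′} → i ≢ i′ → ∀ {α} → ¬ (α ∈ map (i ,_) (range (suc i) ℓ) × α ∈ map (i′ ,_) (range (suc i′) ℓ))
  disjoint i≢i′ (α∈ , α∈′) with ∈-map⁻ _ α∈ | ∈-map⁻ _ α∈′
  ... | _ , _ , ≡.refl | _ , _ , e = i≢i′ (cong proj₁ e)

-- The root ideal is recorded by the first column r i of each row i.
ideal : ℕ → (ℕ → ℕ) → List Root
ideal ℓ r = filterᵇ (λ α → r (proj₁ α) ≤ᵇ proj₂ α) (posRoots ℓ)

∈-ideal⁺ : ∀ {ℓ r i j} → IsPosRoot ℓ (i , j) → r i ≤ j → (i , j) ∈ ideal ℓ r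
∈-ideal⁺ {ℓ} {r} pos r≤ = ∈-filter⁺ (T? ∘ λ α → r (proj₁ α) ≤ᵇ proj₂ α) (∈-posRoots⁺ pos) (≤⇒≤ᵇ r≤)

∈-ideal⁻ : ∀ {ℓ r i j} → (i , j) ∈ ideal ℓ r → IsPosRoot ℓ (i , j) × r i ≤ j
∈-ideal⁻ {ℓ} {r} {i} {j} ∈I with ∈-filter⁻ (T? ∘ λ α → r (proj₁ α) ≤ᵇ proj₂ α) {xs = posRoots ℓ} ∈I
... | ∈pos , r≤ = ∈-posRoots⁻ ∈pos , ≤ᵇ⇒≤ (r i) j r≤

ideal-unique : ∀ ℓ r → Unique (ideal ℓ r)
ideal-unique ℓ r = Uniqueₚ.filter⁺ (T? ∘ λ α → r (proj₁ α) ≤ᵇ proj₂ α) (posRoots-unique ℓ)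

ideal-↭ : ∀ {ℓ r r′} →
  (∀ {i j} → IsPosRoot ℓ (i , j) → r i ≤ j → r′ i ≤ j) →
  (∀ {i j} → IsPosRoot ℓ (i , j) → r′ i ≤ j → r i ≤ j) → ideal ℓ r ↭ ideal ℓ r′
ideal-↭ {ℓ} {r} {r′} f g = ↭-unique (ideal-unique ℓ r) (ideal-unique ℓ r′)
  (λ ∈I → let pos , r≤ = ∈-ideal⁻ {ℓ} {r} ∈I in ∈-ideal⁺ {ℓ} {r′} pos (f pos r≤))
  (λ ∈I → let pos , r≤ = ∈-ideal⁻ {ℓ} {r′} ∈I in ∈-ideal⁺ {ℓ} {r} pos (g pos r≤))

-- A relation between `r` and `r′` rather than an operation, so that it serves both for adding a
-- root to a given ideal (`upd-lowersRow`) and for removing one from it (`upd-raisesRow`).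
record LowersRow (i j : ℕ) (r r′ : ℕ → ℕ) : Set where
  constructor lowersRow
  field
    before    : r i ≡ suc j
    after     : r′ i ≡ j
    elsewhere : ∀ n → n ≢ i → r n ≡ r′ n

ideal-lowersRow : ∀ {ℓ i j r r′} → IsPosRoot ℓ (i , j) → LowersRow i j r r′ → (i , j) ∷ ideal ℓ r ↭ ideal ℓ r′
ideal-lowersRow {ℓ} {i} {j} {r} {r′} pos (lowersRow before after elsewhere) =
  ↭-unique (All.tabulate fresh AllPairs.∷ ideal-unique ℓ r) (ideal-unique ℓ r′) to from
  where
  fresh : ∀ {α} → α ∈ ideal ℓ r → (i , j) ≢ α
  fresh ∈I ≡.refl = ℕₚ.1+n≰n (subst (ℕ._≤ j) before (proj₂ (∈-ideal⁻ {ℓ} {r} ∈I)))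
  to : ∀ {α} → α ∈ (i , j) ∷ ideal ℓ r → α ∈ ideal ℓ r′
  to (here ≡.refl) = ∈-ideal⁺ {ℓ} {r′} pos (ℕₚ.≤-reflexive after)
  to {a , b} (there ∈I) with ∈-ideal⁻ {ℓ} {r} ∈I | a ℕ.≟ i
  ... | pos′ , r≤ | yes ≡.refl = ∈-ideal⁺ {ℓ} {r′} pos′
          (ℕₚ.≤-trans (ℕₚ.≤-reflexive after) (ℕₚ.≤-trans (ℕₚ.n≤1+n j) (subst (ℕ._≤ b) before r≤)))
  ... | pos′ , r≤ | no a≢i = ∈-ideal⁺ {ℓ} {r′} pos′ (subst (ℕ._≤ b) (elsewhere a a≢i) r≤)
  from : ∀ {α} → α ∈ ideal ℓ r′ → α ∈ (i , j) ∷ ideal ℓ r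
  from {a , b} ∈I with ∈-ideal⁻ {ℓ} {r′} ∈I | a ℕ.≟ i
  ... | pos′ , r≤ | no a≢i = there (∈-ideal⁺ {ℓ} {r} pos′ (subst (ℕ._≤ b) (≡.sym (elsewhere a a≢i)) r≤))
  ... | pos′ , r≤ | yes ≡.refl with b ℕ.≟ j
  ...   | yes ≡.refl = here ≡.refl
  ...   | no b≢j = there (∈-ideal⁺ {ℓ} {r} pos′ (subst (ℕ._≤ b) (≡.sym before)
                     (ℕₚ.≤∧≢⇒< (subst (ℕ._≤ b) after r≤) (b≢j ∘ ≡.sym))))

-- Rows p and p+1 can be exchanged because they start together; columns p and p+1 because no row
-- above starts in column p+1, which would give it (i, p+1) without (i, p). The bound `2 + p ≤ r p`
-- keeps out (p, p+1), whose image is not a positive root.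
ideal-swapRoot : ∀ {ℓ p r} → 1 ≤ p → p ℕ.< ℓ → r p ≡ r (suc p) → 2 ℕ.+ p ≤ r p →
  (∀ i → 1 ≤ i → i ℕ.< p → r i ≢ suc p) → map (swapRoot p) (ideal ℓ r) ↭ ideal ℓ r
ideal-swapRoot {ℓ} {p} {r} 1≤p p<ℓ wall far ceil = ↭-unique
  (Uniqueₚ.map⁺ (λ {α} {β} e → ≡.trans (≡.sym (swapRoot-involutive p α)) (≡.trans (cong (swapRoot p) e)
      (swapRoot-involutive p β)))
    (ideal-unique ℓ r)) (ideal-unique ℓ r)
  (λ α∈ → let β , β∈ , e = ∈-map⁻ (swapRoot p) α∈ in subst (_∈ ideal ℓ r) (≡.sym e) (closed β∈))
  (λ {α} α∈ → subst (_∈ map (swapRoot p) (ideal ℓ r)) (swapRoot-involutive p α) (∈-map⁺ (swapRoot p) (closed α∈)))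
  where
  σ-is : ∀ i j {i′ j′} → swapIx p i ≡ i′ → swapIx p j ≡ j′ → (i′ , j′) ∈ ideal ℓ r → swapRoot p (i , j) ∈ ideal ℓ r
  σ-is i j e e′ = subst (_∈ ideal ℓ r) (≡.sym (cong₂ _,_ e e′))

  closed : ∀ {α} → α ∈ ideal ℓ r → swapRoot p α ∈ ideal ℓ r
  closed {i , j} α∈ with ∈-ideal⁻ {ℓ} {r} α∈ | i ℕ.≟ p | i ℕ.≟ suc p
  ... | (_ , _ , j≤ℓ) , r≤ | yes ≡.refl | _ =
    σ-is p j (swapIx-lower p) (swapIx-other (ℕₚ.>⇒≢ (ℕₚ.<-trans (ℕₚ.n<1+n p) p+1<j)) (ℕₚ.>⇒≢ p+1<j))
      (∈-ideal⁺ {ℓ} {r} (s≤s z≤n , p+1<j , j≤ℓ) (subst (ℕ._≤ j) wall r≤))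
    where
    p+1<j : suc p ℕ.< j
    p+1<j = ℕₚ.≤-trans far r≤
  ... | (_ , p+1<j , j≤ℓ) , r≤ | no _ | yes ≡.refl =
    σ-is (suc p) j (swapIx-upper p) (swapIx-other (ℕₚ.>⇒≢ (ℕₚ.<-trans (ℕₚ.n<1+n p) p+1<j)) (ℕₚ.>⇒≢ p+1<j))
      (∈-ideal⁺ {ℓ} {r} (1≤p , ℕₚ.<-trans (ℕₚ.n<1+n p) p+1<j , j≤ℓ) (subst (ℕ._≤ j) (≡.sym wall) r≤))
  ... | (1≤i , i<j , j≤ℓ) , r≤ | no i≢p | no i≢p+1 with j ℕ.≟ p | j ℕ.≟ suc p
  ...   | yes ≡.refl | _ = σ-is i p (swapIx-other i≢p i≢p+1) (swapIx-lower p)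
            (∈-ideal⁺ {ℓ} {r} (1≤i , ℕₚ.<-trans i<j (ℕₚ.n<1+n p) , p<ℓ) (ℕₚ.≤-trans r≤ (ℕₚ.n≤1+n p)))
  ...   | no _ | yes ≡.refl = σ-is i (suc p) (swapIx-other i≢p i≢p+1) (swapIx-upper p)
            (∈-ideal⁺ {ℓ} {r} (1≤i , i<p , ℕₚ.<⇒≤ p<ℓ) (ℕₚ.≤-pred (ℕₚ.≤∧≢⇒< r≤ (ceil i 1≤i i<p))))
    where
    i<p : i ℕ.< p
    i<p = ℕₚ.≤∧≢⇒< (ℕₚ.≤-pred i<j) i≢p
  ...   | no j≢p | no j≢p+1 = σ-is i j (swapIx-other i≢p i≢p+1) (swapIx-other j≢p j≢p+1) α∈

opaque
  upd : (ℕ → ℕ) → ℕ → ℕ → ℕ → ℕ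
  upd r i v n with n ℕ.≟ i
  ... | yes _ = v
  ... | no _  = r n

  upd-at : ∀ r i v → upd r i v i ≡ v
  upd-at r i v with i ℕ.≟ i
  ... | yes _ = ≡.refl
  ... | no ne = contradiction ≡.refl ne

  upd-off : ∀ r {i} v {n} → n ≢ i → upd r i v n ≡ r n
  upd-off r {i} v {n} ne with n ℕ.≟ i
  ... | yes e = contradiction e ne
  ... | no _  = ≡.refl

upd-lowersRow : ∀ {r i j} → r i ≡ suc j → LowersRow i j r (upd r i j)
upd-lowersRow {r} {i} {j} e = lowersRow e (upd-at r i j) (λ n ne → ≡.sym (upd-off r j ne))

upd-raisesRow : ∀ {r i j} → r i ≡ j → LowersRow i j (upd r i (suc j)) r
upd-raisesRow {r} {i} {j} e = lowersRow (upd-at r i (suc j)) e (λ n ne → upd-off r (suc j) ne)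

⊕-trans : ∀ γ i j k → γ ⊕ (i , j) ⊕ (j , k) ≗ γ ⊕ (i , k)
⊕-trans γ i j k n = lemma (γ n) (bump i 1 n) (bump j 1 n) (bump k 1 n)
  where
  lemma : ∀ g x y u → g ℤ.+ x ℤ.- y ℤ.+ y ℤ.- u ≡ g ℤ.+ x ℤ.- u
  lemma = ℤ-Solver.solve-∀

-- A bounce path from the wall in rows Z, Z+1 up to row x, with n mirrors on the way. As r holds the
-- first columns, q = r x says that x = up(q).
data BouncePath (r : ℕ → ℕ) (γ : ℕ → ℤ) (Z : ℕ) : ℕ → ℕ → Set where
  wall   : r Z ≡ r (suc Z) → 2 ℕ.+ Z ≤ r Z → γ (suc Z) ≡ γ Z ℤ.+ + 1 → BouncePath r γ Z 0 Z
  mirror : ∀ {n x q} → r x ≡ q → r (suc x) ≡ suc q → 2 ℕ.+ x ≤ q → γ (suc x) ≡ γ x →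
    (∀ i → 1 ≤ i → i ℕ.< x → r i ≢ suc q) → (∀ i → suc x ℕ.< i → i ℕ.< q → r i ≢ suc q) →
    BouncePath r γ Z n q → BouncePath r γ Z (suc n) x

path-≤ : ∀ {r γ Z n x} → BouncePath r γ Z n x → x ≤ Z
path-≤ (wall _ _ _) = ℕₚ.≤-refl
path-≤ (mirror _ _ 2+x≤q _ _ _ ch) = ℕₚ.≤-trans (ℕₚ.≤-trans (ℕₚ.m≤n+m _ 2) 2+x≤q) (path-≤ ch)

path-far : ∀ {r γ Z n x} → BouncePath r γ Z n x → 2 ℕ.+ Z ≤ r (suc Z)
path-far (wall e far _) = subst (_ ℕ.≤_) e far
path-far (mirror _ _ _ _ _ _ ch) = path-far ch

-- Rows above x may be modified as long as they stay clear of the columns of the path, and γ may be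
-- translated by d in positions x, x+1.
path-cong : ∀ {r r′ γ γ′ Z n x} (d : ℤ) →
  (∀ i → x ≤ i → r′ i ≡ r i) → (∀ i → 1 ≤ i → i ℕ.< x → r′ i ≤ 2 ℕ.+ x ⊎ r′ i ≡ r i) →
  γ′ x ≡ γ x ℤ.+ d → γ′ (suc x) ≡ γ (suc x) ℤ.+ d → (∀ i → suc x ℕ.< i → i ≤ suc Z → γ′ i ≡ γ i) →
  BouncePath r γ Z n x → BouncePath r′ γ′ Z n x
path-cong {r} {r′} {γ} {γ′} {Z} d same above γx γx+1 γ> (wall e far step) =
  wall (≡.trans (same Z ℕₚ.≤-refl) (≡.trans e (≡.sym (same (suc Z) (ℕₚ.n≤1+n Z)))))
    (subst (2 ℕ.+ Z ℕ.≤_) (≡.sym (same Z ℕₚ.≤-refl)) far)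
    (≡.trans γx+1 (≡.trans (cong (ℤ._+ d) step) (≡.trans (lemma (γ Z) d) (cong (ℤ._+ + 1) (≡.sym γx)))))
  where
  lemma : ∀ g d → g ℤ.+ + 1 ℤ.+ d ≡ g ℤ.+ d ℤ.+ + 1
  lemma = ℤ-Solver.solve-∀
path-cong {r} {r′} {γ} {γ′} {Z} {x = x} d same above γx γx+1 γ> (mirror {q = q} rx rx+1 2+x≤q level below gap ch) =
  mirror (≡.trans (same x ℕₚ.≤-refl) rx) (≡.trans (same (suc x) (ℕₚ.n≤1+n x)) rx+1) 2+x≤q
    (≡.trans γx+1 (≡.trans (cong (ℤ._+ d) level) (≡.sym γx)))
    -- A modified row starts in column x+2 at the latest, whereas q+1 ≥ x+3.
    (λ i 1≤i i<x e → [ (λ r′≤ → ℕₚ.1+n≰n (ℕₚ.≤-trans (subst (ℕ._≤ 2 ℕ.+ x) e r′≤) 2+x≤q))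
                     , (λ r′≡ → below i 1≤i i<x (≡.trans (≡.sym r′≡) e)) ]′ (above i 1≤i i<x))
    (λ i x+1<i i<q e → gap i x+1<i i<q (≡.trans (≡.sym (same i (x≤ x+1<i))) e))
    (path-cong (+ 0) (λ i q≤i → same i (ℕₚ.≤-trans (ℕₚ.<⇒≤ x<q) q≤i)) above′
      (γ-zero q ℕₚ.≤-refl (ℕₚ.≤-trans (path-≤ ch) (ℕₚ.n≤1+n Z))) (γ-zero (suc q) (ℕₚ.n≤1+n q) (s≤s (path-≤ ch)))
      (λ i q<i → γ> i (ℕₚ.≤-trans 2+x≤q (ℕₚ.≤-trans (ℕₚ.n≤1+n q) (ℕₚ.<⇒≤ q<i)))) ch)
  where
  x<q : x ℕ.< q
  x<q = ℕₚ.<-trans (ℕₚ.n<1+n x) 2+x≤q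
  x≤ : ∀ {i} → suc x ℕ.< i → x ≤ i
  x≤ x+1<i = ℕₚ.<⇒≤ (ℕₚ.<-trans (ℕₚ.n<1+n x) x+1<i)
  γ-zero : ∀ i → q ≤ i → i ≤ suc Z → γ′ i ≡ γ i ℤ.+ + 0
  γ-zero i q≤i i≤ = ≡.trans (γ> i (ℕₚ.≤-trans 2+x≤q q≤i) i≤) (≡.sym (ℤₚ.+-identityʳ _))
  above′ : ∀ i → 1 ≤ i → i ℕ.< q → r′ i ≤ 2 ℕ.+ q ⊎ r′ i ≡ r i
  above′ i 1≤i i<q with i ℕ.<? x
  ... | no i≮x = inj₂ (same i (ℕₚ.≮⇒≥ i≮x))
  ... | yes i<x with above i 1≤i i<x
  ...   | inj₁ r′≤ = inj₁ (ℕₚ.≤-trans r′≤ (s≤s (s≤s (ℕₚ.<⇒≤ x<q))))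
  ...   | inj₂ r′≡ = inj₂ r′≡

-- Boolean specifications

not-T : ∀ {b} → ¬ T b → T (not b)
not-T {true}  f = f _
not-T {false} f = _

T-not : ∀ {b} → T (not b) → ¬ T b
T-not {false} _ ()

<ℤᵇ⇒< : ∀ {a b} → T (a <ℤᵇ b) → a ℤ.< b
<ℤᵇ⇒< lt = ℤₚ.≰⇒> (λ b≤a → T-not lt (ℤₚ.≤⇒≤ᵇ b≤a))

<⇒<ℤᵇ : ∀ {a b} → a ℤ.< b → T (a <ℤᵇ b)
<⇒<ℤᵇ a<b = not-T (λ b≤a → ℤₚ.<⇒≱ a<b (ℤₚ.≤ᵇ⇒≤ b≤a))

==ℤ⇒≡ : ∀ {a b} → T (a ==ℤ b) → a ≡ b
==ℤ⇒≡ e with Equivalence.to T-∧ e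
... | a≤b , b≤a = ℤₚ.≤-antisym (ℤₚ.≤ᵇ⇒≤ a≤b) (ℤₚ.≤ᵇ⇒≤ b≤a)

≡⇒==ℤ : ∀ {a b} → a ≡ b → T (a ==ℤ b)
≡⇒==ℤ e = Equivalence.from T-∧ (ℤₚ.≤⇒≤ᵇ (ℤₚ.≤-reflexive e) , ℤₚ.≤⇒≤ᵇ (ℤₚ.≤-reflexive (≡.sym e)))

eqRoot⇒≡ : ∀ {α β} → T (eqRoot α β) → α ≡ β
eqRoot⇒≡ e with Equivalence.to T-∧ e
... | a , b = cong₂ _,_ (≡ᵇ⇒≡ _ _ a) (≡ᵇ⇒≡ _ _ b)

eqRoot-refl : ∀ α → T (eqRoot α α)
eqRoot-refl (i , j) = Equivalence.from T-∧ (≡⇒≡ᵇ i i ≡.refl , ≡⇒≡ᵇ j j ≡.refl)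

memRoot⇒∈ : ∀ {α S} → T (memRoot α S) → α ∈ S
memRoot⇒∈ {α} {S} e = Any.map eqRoot⇒≡ (Anyₚ.any⁻ (eqRoot α) S e)

∈⇒memRoot : ∀ {α S} → α ∈ S → T (memRoot α S)
∈⇒memRoot {α} α∈ = Anyₚ.any⁺ (eqRoot α) (Any.map (λ { ≡.refl → eqRoot-refl α }) α∈)

isRootIdeal⇒closed : ∀ {ℓ S} → T (isRootIdeal ℓ S) → ∀ {a b c d} → (a , b) ∈ S → IsPosRoot ℓ (c , d) →
  c ≤ a → b ≤ d → (c , d) ∈ S
isRootIdeal⇒closed {ℓ} {S} ideal {a} {b} {c} {d} α∈ pos c≤a b≤d
  with Equivalence.to T-∨ (All.lookup (Allₚ.all⁺ _ (posRoots ℓ) (All.lookup (Allₚ.all⁺ _ S ideal) α∈))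
      (∈-posRoots⁺ pos))
... | inj₁ ≰ = contradiction (Equivalence.from T-∧ (≤⇒≤ᵇ c≤a , ≤⇒≤ᵇ b≤d)) (T-not ≰)
... | inj₂ mem = memRoot⇒∈ mem

closed⇒isRootIdeal : ∀ {ℓ S} → (∀ {a b c d} → (a , b) ∈ S → IsPosRoot ℓ (c , d) → c ≤ a → b ≤ d → (c , d) ∈ S) →
  T (isRootIdeal ℓ S)
closed⇒isRootIdeal {ℓ} {S} closed = Allₚ.all⁻ _ (All.tabulate λ {α} α∈ → Allₚ.all⁻ _ (All.tabulate λ {β} β∈ →
  clause α β α∈ (∈-posRoots⁻ β∈)))
  where
  clause : ∀ α β → α ∈ S → IsPosRoot ℓ β → T (not (rootLeq α β) ∨ memRoot β S)
  clause (a , b) (c , d) α∈ pos with T? (rootLeq (a , b) (c , d))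
  ... | no ≰ = Equivalence.from T-∨ (inj₁ (not-T ≰))
  ... | yes leq with Equivalence.to T-∧ leq
  ...   | c≤a , b≤d = Equivalence.from (T-∨ {not (rootLeq (a , b) (c , d))})
                        (inj₂ (∈⇒memRoot (closed α∈ pos (≤ᵇ⇒≤ c a c≤a) (≤ᵇ⇒≤ b d b≤d))))

∈-remove⁺ : ∀ {α β S} → β ∈ S → β ≢ α → β ∈ filterᵇ (λ β → not (eqRoot β α)) S
∈-remove⁺ β∈ β≢α = ∈-filter⁺ (T? ∘ λ β → not (eqRoot β _)) β∈ (not-T (β≢α ∘ eqRoot⇒≡))

∈-remove⁻ : ∀ {α β S} → β ∈ filterᵇ (λ β → not (eqRoot β α)) S → β ∈ S × β ≢ α
∈-remove⁻ {α} {β} {S} β∈ with ∈-filter⁻ (T? ∘ λ β → not (eqRoot β α)) {xs = S} β∈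
... | β∈S , ne = β∈S , λ { ≡.refl → T-not ne (eqRoot-refl α) }

findFirst-just : ∀ p xs {i} → findFirst p xs ≡ just i → T (p i)
findFirst-just p (x ∷ xs) e with p x in px
findFirst-just p (x ∷ xs) ≡.refl | true  = Equivalence.from T-≡ px
findFirst-just p (x ∷ xs) e      | false = findFirst-just p xs e

findFirst-nothing : ∀ p xs {i} → findFirst p xs ≡ nothing → i ∈ xs → ¬ T (p i)
findFirst-nothing p (x ∷ xs) e i∈ pi with p x in px
findFirst-nothing p (x ∷ xs) e (here ≡.refl) pi | false = subst T px pi
findFirst-nothing p (x ∷ xs) e (there i∈)    pi | false = findFirst-nothing p xs e i∈ pi

maxSat-≤ : ∀ n p → maxSat n p ≤ n
maxSat-≤ zero    p = z≤n
maxSat-≤ (suc n) p with p (suc n)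
... | true  = ℕₚ.≤-refl
... | false = ℕₚ.m≤n⇒m≤1+n (maxSat-≤ n p)

maxSat-holds : ∀ n p {h} → maxSat n p ≡ suc h → T (p (suc h))
maxSat-holds (suc n) p e with p (suc n) in pn
maxSat-holds (suc n) p ≡.refl | true  = Equivalence.from T-≡ pn
maxSat-holds (suc n) p e      | false = maxSat-holds n p e

maxSat-maximal : ∀ n p {h} → maxSat n p ℕ.< h → h ≤ n → ¬ T (p h)
maxSat-maximal zero    p max<h z≤n ph = contradiction max<h λ ()
maxSat-maximal (suc n) p {h} max<h h≤ ph with p (suc n) in pn
... | true  = ℕₚ.<⇒≱ max<h h≤
... | false with h ℕ.≟ suc n
...   | yes ≡.refl = subst T pn ph
...   | no h≢ = maxSat-maximal n p max<h (ℕₚ.≤-pred (ℕₚ.≤∧≢⇒< h≤ h≢)) ph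

constOn⇒≡ : ∀ {ν a b} → T (constOn ν a b) → ∀ i → a ≤ i → i ≤ b → ν i ≡ ν a
constOn⇒≡ {ν} {a} {b} c i a≤i i≤b = ==ℤ⇒≡ (All.lookup (Allₚ.all⁺ _ (range a b) c) (∈-range⁺ a≤i i≤b))

≡⇒constOn : ∀ {ν a b} → (∀ i → a ≤ i → i ≤ b → ν i ≡ ν a) → T (constOn ν a b)
≡⇒constOn e = Allₚ.all⁻ _ (All.tabulate λ i∈ → let a≤i , i≤b = ∈-range⁻ i∈ in ≡⇒==ℤ (e _ a≤i i≤b))

ind-empty : ∀ {a b i} → b ℕ.< a → ind a b i ≡ + 0
ind-empty {a} {b} {i} b<a with a ≤ᵇ i in ai | i ≤ᵇ b in ib
... | false | _     = ≡.refl
... | true  | false = ≡.refl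
... | true  | true  = contradiction (ℕₚ.≤-trans (≤ᵇ⇒≤ a i (Equivalence.from T-≡ ai))
    (≤ᵇ⇒≤ i b (Equivalence.from T-≡ ib))) (ℕₚ.<⇒≱ b<a)

ind-suc : ∀ {a b} i → a ≤ suc b → ind a (suc b) i ≡ ind a b i ℤ.+ bump (suc b) 1 i
ind-suc {a} {b} i a≤ with i ℕ.≟ suc b
... | yes ≡.refl rewrite bump-at (suc b) 1 | Equivalence.to T-≡ (≤⇒≤ᵇ a≤) | Equivalence.to T-≡
    (≤⇒≤ᵇ (ℕₚ.≤-refl {suc b}))
      | ¬-not (λ e → ℕₚ.1+n≰n (≤ᵇ⇒≤ (suc b) b (Equivalence.from T-≡ e))) = ≡.refl
... | no ne rewrite bump-off {suc b} 1 ne = ≡.trans (cong (λ x → if (a ≤ᵇ i) ∧ x then + 1 else + 0) same)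
    (≡.sym (ℤₚ.+-identityʳ _))
  where
  same : (i ≤ᵇ suc b) ≡ (i ≤ᵇ b)
  same with i ℕ.≤? b
  ... | yes i≤b = ≡.trans (Equivalence.to T-≡ (≤⇒≤ᵇ (ℕₚ.m≤n⇒m≤1+n i≤b))) (≡.sym (Equivalence.to T-≡ (≤⇒≤ᵇ i≤b)))
  ... | no i≰b = ≡.trans
    (¬-not (λ e → i≰b (ℕₚ.≤-pred (ℕₚ.≤∧≢⇒< (≤ᵇ⇒≤ i (suc b) (Equivalence.from T-≡ e)) ne))))
    (≡.sym (¬-not (λ e → i≰b (≤ᵇ⇒≤ i b (Equivalence.from T-≡ e)))))

-- The weight whose root ideal Δᵏ has first columns r.
wt : ℕ → (ℕ → ℕ) → ℕ → ℤ
wt k r i = + (k ℕ.+ suc i) ℤ.- + r i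

-- The first column k - ν_i + i + 1 as a natural number; the absolute value is exact as soon as ν_i
-- ≤ k.
rows : ℕ → (ℕ → ℤ) → ℕ → ℕ
rows k ν i = suc ℤ.∣ + k ℤ.- ν i ℤ.+ + i ∣

wt-rows : ∀ {k ν i} → ν i ℤ.≤ + k → wt k (rows k ν) i ≡ ν i
wt-rows {k} {ν} {i} ν≤k rewrite ℤₚ.pos-+ k (suc i) = ≡.trans
  (cong (λ x → + k ℤ.+ + suc i ℤ.- (+ 1 ℤ.+ x)) (ℤₚ.0≤i⇒+∣i∣≡i (ℤₚ.+-mono-≤ (ℤₚ.i≤j⇒0≤j-i ν≤k)
      (ℤ.+≤+ {0} {i} z≤n))))
  (lemma (+ k) (ν i) (+ i))
  where
  lemma : ∀ k v i → k ℤ.+ (+ 1 ℤ.+ i) ℤ.- (+ 1 ℤ.+ (k ℤ.- v ℤ.+ i)) ≡ v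
  lemma = ℤ-Solver.solve-∀

wt-column : ∀ k r i → + k ℤ.- wt k r i ℤ.+ + i ≡ + r i ℤ.- + 1
wt-column k r i rewrite ℤₚ.pos-+ k (suc i) = lemma (+ k) (+ i) (+ r i)
  where
  lemma : ∀ k i x → k ℤ.- (k ℤ.+ (+ 1 ℤ.+ i) ℤ.- x) ℤ.+ i ≡ x ℤ.- + 1
  lemma = ℤ-Solver.solve-∀

suc-pred : ∀ x → + 1 ℤ.+ (x ℤ.- + 1) ≡ x
suc-pred = ℤ-Solver.solve-∀

pred<⇒≤ : ∀ {m n} → + m ℤ.- + 1 ℤ.< + n → m ≤ n
pred<⇒≤ {m} {n} lt = ℤ.drop‿+≤+ (subst (ℤ._≤ + n) (suc-pred (+ m)) (ℤₚ.i<j⇒suc[i]≤j lt))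

≤⇒pred< : ∀ {m n} → m ≤ n → + m ℤ.- + 1 ℤ.< + n
≤⇒pred< {m} {n} le = ℤₚ.suc[i]≤j⇒i<j (subst (ℤ._≤ + n) (≡.sym (suc-pred (+ m))) (ℤ.+≤+ le))

∈-Δk⁻ : ∀ {k ℓ ν i j} → (i , j) ∈ Δk k ℓ ν → IsPosRoot ℓ (i , j) × + k ℤ.- ν i ℤ.+ + i ℤ.< + j
∈-Δk⁻ {k} {ℓ} ∈Δ with ∈-filter⁻ _ {xs = posRoots ℓ} ∈Δ
... | ∈pos , lt = ∈-posRoots⁻ ∈pos , <ℤᵇ⇒< lt

∈-Δk⁺ : ∀ {k ℓ ν i j} → IsPosRoot ℓ (i , j) → + k ℤ.- ν i ℤ.+ + i ℤ.< + j → (i , j) ∈ Δk k ℓ ν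
∈-Δk⁺ pos lt = ∈-filter⁺ _ (∈-posRoots⁺ pos) (<⇒<ℤᵇ lt)

module _ {k ℓ r ν} (ν≡ : AgreeUpTo ℓ ν (wt k r)) where
  private
    column : ∀ {i j} → IsPosRoot ℓ (i , j) → + k ℤ.- ν i ℤ.+ + i ≡ + r i ℤ.- + 1
    column {i} (1≤i , i<j , j≤ℓ) = ≡.trans (cong (λ x → + k ℤ.- x ℤ.+ + i)
        (ν≡ i 1≤i (ℕₚ.<⇒≤ (ℕₚ.<-≤-trans i<j j≤ℓ)))) (wt-column k r i)

  Δk⇒row : ∀ {i j} → (i , j) ∈ Δk k ℓ ν → IsPosRoot ℓ (i , j) × r i ≤ j
  Δk⇒row ∈Δ with ∈-Δk⁻ {k} {ℓ} {ν} ∈Δ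
  ... | pos , lt = pos , pred<⇒≤ (subst (ℤ._< _) (column pos) lt)

  row⇒Δk : ∀ {i j} → IsPosRoot ℓ (i , j) → r i ≤ j → (i , j) ∈ Δk k ℓ ν
  row⇒Δk pos le = ∈-Δk⁺ {k} {ℓ} {ν} pos (subst (ℤ._< _) (≡.sym (column pos)) (≤⇒pred< le))

  Δk-ideal : Δk k ℓ ν ↭ ideal ℓ r
  Δk-ideal = ↭-unique (Uniqueₚ.filter⁺ _ (posRoots-unique ℓ)) (ideal-unique ℓ r)
    (λ ∈Δ → let pos , le = Δk⇒row ∈Δ in ∈-ideal⁺ {ℓ} {r} pos le)
    (λ ∈I → let pos , le = ∈-ideal⁻ {ℓ} {r} ∈I in row⇒Δk pos le)

wt-run⇒ : ∀ {k r} d a → wt k r (d ℕ.+ a) ≡ wt k r a → r (d ℕ.+ a) ≡ d ℕ.+ r a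
wt-run⇒ {k} {r} d a e = ℤₚ.+-injective (≡.trans (≡.sym (lemma₁ (+ (k ℕ.+ suc (d ℕ.+ a))) (+ r (d ℕ.+ a))))
  (≡.trans (cong (λ x → + (k ℕ.+ suc (d ℕ.+ a)) ℤ.- x) e) shifted))
  where
  lemma₁ : ∀ x y → x ℤ.- (x ℤ.- y) ≡ y
  lemma₁ = ℤ-Solver.solve-∀
  lemma₂ : ∀ k d a y → k ℤ.+ (+ 1 ℤ.+ (d ℤ.+ a)) ℤ.- (k ℤ.+ (+ 1 ℤ.+ a) ℤ.- y) ≡ d ℤ.+ y
  lemma₂ = ℤ-Solver.solve-∀
  shifted : + (k ℕ.+ suc (d ℕ.+ a)) ℤ.- wt k r a ≡ + (d ℕ.+ r a)
  shifted rewrite ℤₚ.pos-+ k (suc (d ℕ.+ a)) | ℤₚ.pos-+ d a | ℤₚ.pos-+ k (suc a) | ℤₚ.pos-+ d (r a) =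
      lemma₂ (+ k) (+ d) (+ a) (+ r a)

wt-run⇐ : ∀ {k r} d a → r (d ℕ.+ a) ≡ d ℕ.+ r a → wt k r (d ℕ.+ a) ≡ wt k r a
wt-run⇐ {k} {r} d a e rewrite e | ℤₚ.pos-+ k (suc (d ℕ.+ a)) | ℤₚ.pos-+ d a | ℤₚ.pos-+ k (suc a) | ℤₚ.pos-+ d
    (r a) =
  lemma (+ k) (+ d) (+ a) (+ r a)
  where
  lemma : ∀ k d a y → k ℤ.+ (+ 1 ℤ.+ (d ℤ.+ a)) ℤ.- (d ℤ.+ y) ≡ k ℤ.+ (+ 1 ℤ.+ a) ℤ.- y
  lemma = ℤ-Solver.solve-∀

wt-level : ∀ k r i → r (suc i) ≡ suc (r i) → wt k r (suc i) ≡ wt k r i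
wt-level k r i e = wt-run⇐ {k} {r} 1 i e

wt-step : ∀ k r i → r i ≡ r (suc i) → wt k r (suc i) ≡ wt k r i ℤ.+ + 1
wt-step k r i e rewrite e | ℤₚ.pos-+ k (suc (suc i)) | ℤₚ.pos-+ k (suc i) = lemma (+ k) (+ i) (+ r (suc i))
  where
  lemma : ∀ k i x → k ℤ.+ (+ 1 ℤ.+ (+ 1 ℤ.+ i)) ℤ.- x ≡ k ℤ.+ (+ 1 ℤ.+ i) ℤ.- x ℤ.+ + 1
  lemma = ℤ-Solver.solve-∀

wt-lower : ∀ k r r′ i j → r i ≡ suc j → r′ i ≡ j → wt k r′ i ≡ wt k r i ℤ.+ + 1
wt-lower k r r′ i j e e′ rewrite e | e′ = lemma (+ (k ℕ.+ suc i)) (+ j)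
  where
  lemma : ∀ a x → a ℤ.- x ≡ a ℤ.- (+ 1 ℤ.+ x) ℤ.+ + 1
  lemma = ℤ-Solver.solve-∀

wt-raise : ∀ k r r′ i → r′ i ≡ suc (r i) → wt k r′ i ≡ wt k r i ℤ.- + 1
wt-raise k r r′ i e rewrite e = lemma (+ (k ℕ.+ suc i)) (+ r i)
  where
  lemma : ∀ a x → a ℤ.- (+ 1 ℤ.+ x) ≡ a ℤ.- x ℤ.- + 1
  lemma = ℤ-Solver.solve-∀

-- The source of the dictionary between parts and columns: k cancels, and the drop of the weight is
-- the distance between the two starts minus one.
wt-drop : ∀ k r i → wt k r i ℤ.- wt k r (suc i) ≡ + r (suc i) ℤ.- + suc (r i)
wt-drop k r i rewrite ℤₚ.pos-+ k (suc i) | ℤₚ.pos-+ k (suc (suc i)) = lemma (+ k) (+ i) (+ r i) (+ r (suc i))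
  where
  lemma : ∀ a i x y → a ℤ.+ (+ 1 ℤ.+ i) ℤ.- x ℤ.- (a ℤ.+ (+ 1 ℤ.+ (+ 1 ℤ.+ i)) ℤ.- y) ≡ y ℤ.- (+ 1 ℤ.+ x)
  lemma = ℤ-Solver.solve-∀

wt-≤⇒< : ∀ k r i → wt k r (suc i) ℤ.≤ wt k r i → r i ℕ.< r (suc i)
wt-≤⇒< k r i le = ℤ.drop‿+≤+ (ℤₚ.0≤i-j⇒j≤i (subst (+ 0 ℤ.≤_) (wt-drop k r i) (ℤₚ.i≤j⇒0≤j-i le)))

<⇒wt-≤ : ∀ k r i → r i ℕ.< r (suc i) → wt k r (suc i) ℤ.≤ wt k r i
<⇒wt-≤ k r i lt = ℤₚ.0≤i-j⇒j≤i (subst (+ 0 ℤ.≤_) (≡.sym (wt-drop k r i)) (ℤₚ.i≤j⇒0≤j-i (ℤ.+≤+ lt)))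

k-wt : ∀ k r i → + k ℤ.- wt k r i ≡ + r i ℤ.- + suc i
k-wt k r i rewrite ℤₚ.pos-+ k (suc i) = lemma (+ k) (+ i) (+ r i)
  where
  lemma : ∀ a i x → a ℤ.- (a ℤ.+ (+ 1 ℤ.+ i) ℤ.- x) ≡ x ℤ.- (+ 1 ℤ.+ i)
  lemma = ℤ-Solver.solve-∀

wt-≤k⇒< : ∀ k r i → wt k r i ℤ.≤ + k → i ℕ.< r i
wt-≤k⇒< k r i le = ℤ.drop‿+≤+ (ℤₚ.0≤i-j⇒j≤i (subst (+ 0 ℤ.≤_) (k-wt k r i) (ℤₚ.i≤j⇒0≤j-i le)))

<⇒wt-≤k : ∀ k r i → i ℕ.< r i → wt k r i ℤ.≤ + k
<⇒wt-≤k k r i lt = ℤₚ.0≤i-j⇒j≤i (subst (+ 0 ℤ.≤_) (≡.sym (k-wt k r i)) (ℤₚ.i≤j⇒0≤j-i (ℤ.+≤+ lt)))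

wt-≥0⇒≤ : ∀ k r i → + 0 ℤ.≤ wt k r i → r i ≤ k ℕ.+ suc i
wt-≥0⇒≤ k r i le = ℤ.drop‿+≤+ (ℤₚ.0≤i-j⇒j≤i le)

≤⇒wt-≥0 : ∀ k r i → r i ≤ k ℕ.+ suc i → + 0 ℤ.≤ wt k r i
≤⇒wt-≥0 k r i le = ℤₚ.i≤j⇒0≤j-i (ℤ.+≤+ le)

wt-<0 : ∀ k r i → k ℕ.+ suc i ℕ.< r i → wt k r i ℤ.< + 0
wt-<0 k r i lt = ℤₚ.≰⇒> (λ le → ℕₚ.<⇒≱ lt (wt-≥0⇒≤ k r i le))

increasing : ∀ {ℓ} {r : ℕ → ℕ} → (∀ i → 1 ≤ i → i ℕ.< ℓ → r i ℕ.< r (suc i)) →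
  ∀ {i j} → 1 ≤ i → i ℕ.< j → j ≤ ℓ → r i ℕ.< r j
increasing adj {i} {suc j} 1≤i i<1+j 1+j≤ℓ with ℕₚ.m≤n⇒m<n∨m≡n (ℕₚ.≤-pred i<1+j)
... | inj₂ ≡.refl = adj i 1≤i 1+j≤ℓ
... | inj₁ i<j = ℕₚ.<-trans (increasing adj 1≤i i<j (ℕₚ.<⇒≤ 1+j≤ℓ)) (adj j (ℕₚ.≤-trans 1≤i (ℕₚ.<⇒≤ i<j)) 1+j≤ℓ)

inPar-wt : ∀ {k ℓ r ν} → AgreeUpTo ℓ ν (wt k r) → (∀ i → 1 ≤ i → i ℕ.< ℓ → r i ℕ.< r (suc i)) →
  (∀ {i} → 1 ≤ i → i ≤ ℓ → i ℕ.< r i) → r ℓ ≤ k ℕ.+ suc ℓ → InPar k ℓ ν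
inPar-wt {k} {ℓ} {r} {ν} agree adj big last = record
  { bounded    = λ i 1≤i i≤ℓ → subst (ℤ._≤ + k) (≡.sym (agree i 1≤i i≤ℓ)) (<⇒wt-≤k k r i (big 1≤i i≤ℓ))
  ; nonneg     = λ i 1≤i i≤ℓ → subst (+ 0 ℤ.≤_) (≡.sym (agree i 1≤i i≤ℓ)) (nonneg (ℓ ∸ i) i 1≤i (ℕₚ.m∸n+n≡m i≤ℓ))
  ; decreasing = λ i 1≤i i<ℓ → ≡.subst₂ ℤ._≤_ (≡.sym (agree (suc i) (s≤s z≤n) i<ℓ))
      (≡.sym (agree i 1≤i (ℕₚ.<⇒≤ i<ℓ)))
                   (<⇒wt-≤ k r i (adj i 1≤i i<ℓ))
  }
  where
  nonneg : ∀ d i → 1 ≤ i → d ℕ.+ i ≡ ℓ → + 0 ℤ.≤ wt k r i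
  nonneg zero    i 1≤i ≡.refl = ≤⇒wt-≥0 k r i last
  nonneg (suc d) i 1≤i ≡.refl = ℤₚ.≤-trans (nonneg d (suc i) (s≤s z≤n) (ℕₚ.+-suc d i))
    (<⇒wt-≤ k r i (adj i 1≤i (s≤s (ℕₚ.m≤n+m i d))))

-- The cover as h successive moves, and the rows of λ - ε_z

cover : (ℕ → ℤ) → ℕ → ℕ → ℕ → ℕ → ℤ
cover lam z y h i = lam i ℤ.+ ind (suc y) (y ℕ.+ h) i ℤ.- ind z (z ℕ.+ h) i

cover-zero : ∀ lam z y → cover lam z y 0 ≗ λ i → lam i ℤ.- ind z z i
cover-zero lam z y i rewrite ℕₚ.+-identityʳ y | ℕₚ.+-identityʳ z | ind-empty {suc y} {y} {i} ℕₚ.≤-refl =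
  cong (ℤ._- ind z z i) (ℤₚ.+-identityʳ (lam i))

-- The increment is what one bounce produces, ε_Q - ε_{Z+1} with Q = h+y+1 and Z = h+z; this allows
-- induction on h.
cover-suc : ∀ lam z y h → cover lam z y (suc h) ≗ cover lam z y h ⊕ (h ℕ.+ suc y , suc (h ℕ.+ z))
cover-suc lam z y h i rewrite ℕₚ.+-suc y h | ℕₚ.+-suc z h | ℕₚ.+-suc h y | ℕₚ.+-comm h y | ℕₚ.+-comm h z
  | ind-suc {suc y} {y ℕ.+ h} i (s≤s (ℕₚ.m≤m+n y h))
  | ind-suc {z} {z ℕ.+ h} i (ℕₚ.≤-trans (ℕₚ.m≤m+n z h) (ℕₚ.n≤1+n _)) =
  lemma (lam i) (ind (suc y) (y ℕ.+ h) i) (ind z (z ℕ.+ h) i) (bump (suc (y ℕ.+ h)) 1 i) (bump (suc (z ℕ.+ h)) 1 i)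
  where
  lemma : ∀ l a b x y → l ℤ.+ (a ℤ.+ x) ℤ.- (b ℤ.+ y) ≡ l ℤ.+ a ℤ.- b ℤ.+ x ℤ.- y
  lemma = ℤ-Solver.solve-∀

-- r lists the first columns of Δᵏ(λ) and m those of Δᵏ(λ - ε_z).
module Lowered (k ℓ : ℕ) (r : ℕ → ℕ) (z : ℕ)
  (r-mono : ∀ {i j} → 1 ≤ i → i ℕ.< j → j ≤ ℓ → r i ℕ.< r j)
  (r-big : ∀ {i} → 1 ≤ i → i ≤ ℓ → i ℕ.< r i)
  (1≤z : 1 ≤ z) (z≤ℓ : z ≤ ℓ) where

  m : ℕ → ℕ
  m = upd r z (suc (r z))

  m-at : m z ≡ suc (r z)
  m-at = upd-at r z _

  m-off : ∀ {i} → i ≢ z → m i ≡ r i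
  m-off = upd-off r _

  m-≥ : ∀ i → r i ≤ m i
  m-≥ i with i ℕ.≟ z
  ... | yes ≡.refl = ℕₚ.≤-trans (ℕₚ.n≤1+n _) (ℕₚ.≤-reflexive (≡.sym m-at))
  ... | no i≢z = ℕₚ.≤-reflexive (≡.sym (m-off i≢z))

  m-big : ∀ {i} → 1 ≤ i → i ≤ ℓ → i ℕ.< m i
  m-big 1≤i i≤ℓ = ℕₚ.<-≤-trans (r-big 1≤i i≤ℓ) (m-≥ _)

  m-far : 2 ℕ.+ z ≤ m z
  m-far = ℕₚ.≤-trans (s≤s (r-big 1≤z z≤ℓ)) (ℕₚ.≤-reflexive (≡.sym m-at))

  m-mono-left : ∀ {i j} → 1 ≤ i → i ℕ.< z → i ℕ.< j → j ≤ ℓ → m i ℕ.< m j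
  m-mono-left 1≤i i<z i<j j≤ℓ =
    ℕₚ.<-≤-trans (subst (ℕ._< r _) (≡.sym (m-off (ℕₚ.<⇒≢ i<z))) (r-mono 1≤i i<j j≤ℓ)) (m-≥ _)

  m-mono : ∀ {i j} → 1 ≤ i → i ℕ.< j → j ≤ z → m i ℕ.< m j
  m-mono 1≤i i<j j≤z = m-mono-left 1≤i (ℕₚ.<-≤-trans i<j j≤z) i<j (ℕₚ.≤-trans j≤z z≤ℓ)

  m-weak : ∀ {i j} → 1 ≤ i → i ≤ j → j ≤ ℓ → m i ≤ m j
  m-weak {i} {j} 1≤i i≤j j≤ℓ with i ℕ.≟ j | i ℕ.≟ z
  ... | yes ≡.refl | _ = ℕₚ.≤-refl
  ... | no i≢j | yes ≡.refl = subst (ℕ._≤ m j) (≡.sym m-at) (ℕₚ.≤-trans (r-mono 1≤z (ℕₚ.≤∧≢⇒< i≤j i≢j) j≤ℓ) (m-≥ j))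
  ... | no i≢j | no i≢z = subst (ℕ._≤ m j) (≡.sym (m-off i≢z))
                            (ℕₚ.≤-trans (ℕₚ.<⇒≤ (r-mono 1≤i (ℕₚ.≤∧≢⇒< i≤j i≢j) j≤ℓ)) (m-≥ j))

  -- In terms of μ = λ - ε_z: μ is constant on [x, x+n].
  Run : ℕ → ℕ → Set
  Run x n = ∀ d → d ≤ n → m (d ℕ.+ x) ≡ d ℕ.+ m x

  Run-zero : ∀ x → Run x 0
  Run-zero x zero z≤n = ≡.refl

  Run-suc : ∀ {x n} → Run x n → m (suc n ℕ.+ x) ≡ suc n ℕ.+ m x → Run x (suc n)
  Run-suc {x} {n} run e d d≤ with d ℕ.≟ suc n
  ... | yes ≡.refl = e
  ... | no d≢ = run d (ℕₚ.≤-pred (ℕₚ.≤∧≢⇒< d≤ d≢))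

  Run-pred : ∀ {x n} → Run x (suc n) → Run x n
  Run-pred run d d≤ = run d (ℕₚ.m≤n⇒m≤1+n d≤)

  -- Subtracting ε_z makes μ drop strictly on entering position z, so a constant stretch that begins
  -- to the left of z ends there. The rows of the shifted path therefore never collide with those
  -- being raised from z on.
  Run-below : ∀ {x} n → 1 ≤ x → x ℕ.< z → Run x n → n ℕ.+ x ℕ.< z
  Run-below zero    1≤x x<z run = x<z
  Run-below {x} (suc n) 1≤x x<z run = ℕₚ.≤∧≢⇒< below ne
    where
    below : suc n ℕ.+ x ≤ z
    below = Run-below n 1≤x x<z (Run-pred run)
    ne : suc n ℕ.+ x ≢ z
    ne e = ℕₚ.<-irrefl (≡.sym (ℕₚ.suc-injective (≡.trans (≡.sym m-at) (≡.trans (cong m (≡.sym e))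
      (≡.trans (run (suc n) ℕₚ.≤-refl) (cong suc (≡.trans (≡.sym (run n (ℕₚ.n≤1+n n))) (m-off (ℕₚ.<⇒≢ below)))))))))
      (r-mono (ℕₚ.≤-trans 1≤x (ℕₚ.m≤n+m x n)) below z≤ℓ)

  -- UpPath t xs q: the path from q continues with xs and stops at t.
  data UpPath (t : ℕ) : List ℕ → ℕ → Set where
    top  : (∀ i → 1 ≤ i → i ℕ.< z → m i ≢ t) → UpPath t [] t
    step : ∀ {x q xs} → 1 ≤ x → x ℕ.< q → m x ≡ q → UpPath t xs x → UpPath t (x ∷ xs) q

  top-≤ : ∀ {t xs q} → UpPath t xs q → t ≤ q
  top-≤ (top _)          = ℕₚ.≤-refl
  top-≤ (step _ x<q _ p) = ℕₚ.≤-trans (top-≤ p) (ℕₚ.<⇒≤ x<q)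

  top-≥1 : ∀ {t xs q} → 1 ≤ q → UpPath t xs q → 1 ≤ t
  top-≥1 1≤q (top _)          = 1≤q
  top-≥1 1≤q (step 1≤x _ _ p) = top-≥1 1≤x p

  top-maximal : ∀ {t xs q} → UpPath t xs q → ∀ i → 1 ≤ i → i ℕ.< z → m i ≢ t
  top-maximal (top e)        = e
  top-maximal (step _ _ _ p) = top-maximal p

  UpPath-below : ∀ {t xs q} → q ≤ z → UpPath t xs q → All (ℕ._< z) xs
  UpPath-below q≤z (top _) = []
  UpPath-below q≤z (step _ x<q _ p) = x<z ∷ UpPath-below (ℕₚ.<⇒≤ x<z) p
    where x<z = ℕₚ.<-≤-trans x<q q≤z

  -- The partial map `up`, read off from the first columns

  module Bounce (Ψ : List Root) (Ψ⇒ : ∀ {i j} → (i , j) ∈ Ψ → IsPosRoot ℓ (i , j) × m i ≤ j)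
                (⇒Ψ : ∀ {i j} → IsPosRoot ℓ (i , j) → m i ≤ j → (i , j) ∈ Ψ) where

    -- If (i, x) is not the first root of its row, then (i, x-1) survives the removal and upward
    -- closure forces (i, x) back in.
    removable⇒ : ∀ {i x} → T (removable ℓ Ψ (i , x)) → 1 ≤ i × i ℕ.< x × m i ≡ x
    removable⇒ {i} {x} rem with Equivalence.to T-∧ rem
    ... | mem , closed with Ψ⇒ (memRoot⇒∈ mem)
    ...   | (1≤i , i<x , x≤ℓ) , m≤x with m i ℕ.≟ x
    ...     | yes e = 1≤i , i<x , e
    removable⇒ {i} {suc x} rem | mem , closed | (1≤i , i<x , x≤ℓ) , m≤x | no ne =
      contradiction ≡.refl (proj₂ (∈-remove⁻ {α = i , suc x} {S = Ψ} bad))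
      where
      m≤x′ : m i ≤ x
      m≤x′ = ℕₚ.≤-pred (ℕₚ.≤∧≢⇒< m≤x ne)
      i<x′ : i ℕ.< x
      i<x′ = ℕₚ.<-≤-trans (m-big 1≤i (ℕₚ.<⇒≤ (ℕₚ.<-≤-trans i<x x≤ℓ))) m≤x′
      left : (i , x) ∈ filterᵇ _ Ψ
      left = ∈-remove⁺ {α = i , suc x} (⇒Ψ (1≤i , i<x′ , ℕₚ.<⇒≤ x≤ℓ) m≤x′) (λ e → ℕₚ.1+n≢n (≡.sym (cong proj₂ e)))
      bad : (i , suc x) ∈ filterᵇ _ Ψ
      bad = isRootIdeal⇒closed {ℓ} closed left (1≤i , i<x , x≤ℓ) ℕₚ.≤-refl (ℕₚ.n≤1+n x)

    -- For i < z every later row starts strictly later, so no other root of the ideal lies below (i,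
    -- m i). At i = z this can fail, because row z+1 may start in the same column.
    ⇒removable : ∀ {i} → 1 ≤ i → i ℕ.< z → m i ≤ ℓ → T (removable ℓ Ψ (i , m i))
    ⇒removable {i} 1≤i i<z m≤ℓ = Equivalence.from T-∧ (∈⇒memRoot (⇒Ψ pos ℕₚ.≤-refl) , closed⇒isRootIdeal {ℓ} closed)
      where
      pos : IsPosRoot ℓ (i , m i)
      pos = 1≤i , m-big 1≤i (ℕₚ.≤-trans (ℕₚ.<⇒≤ i<z) z≤ℓ) , m≤ℓ
      closed : ∀ {a b c d} → (a , b) ∈ filterᵇ (λ β → not (eqRoot β (i , m i))) Ψ → IsPosRoot ℓ (c , d) →
        c ≤ a → b ≤ d → (c , d) ∈ filterᵇ (λ β → not (eqRoot β (i , m i))) Ψ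
      closed {a} {b} {c} {d} ab∈ posβ@(1≤c , _) c≤a b≤d with ∈-remove⁻ {α = i , m i} {S = Ψ} ab∈
      ... | ab∈Ψ , ab≢ with Ψ⇒ ab∈Ψ
      ...   | (1≤a , a<b , b≤ℓ) , ma≤b = ∈-remove⁺ {α = i , m i}
                (⇒Ψ posβ (ℕₚ.≤-trans (m-weak 1≤c c≤a a≤ℓ) (ℕₚ.≤-trans ma≤b b≤d))) ne
        where
        a≤ℓ : a ≤ ℓ
        a≤ℓ = ℕₚ.≤-trans (ℕₚ.<⇒≤ a<b) b≤ℓ
        ne : (c , d) ≢ (i , m i)
        ne ≡.refl with ℕₚ.m≤n⇒m<n∨m≡n c≤a
        ... | inj₁ i<a = ℕₚ.<⇒≱ (m-mono-left 1≤i i<z i<a a≤ℓ) (ℕₚ.≤-trans ma≤b b≤d)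
        ... | inj₂ ≡.refl = ab≢ (cong (i ,_) (ℕₚ.≤-antisym b≤d ma≤b))

    up-just : ∀ {x i} → up ℓ Ψ x ≡ just i → 1 ≤ i × i ℕ.< x × m i ≡ x
    up-just {x} {i} e = removable⇒ (findFirst-just (λ i → removable ℓ Ψ (i , x)) (range 1 (x ∸ 1)) e)

    up-nothing : ∀ {x} → x ≤ ℓ → up ℓ Ψ x ≡ nothing → ∀ i → 1 ≤ i → i ℕ.< z → m i ≢ x
    up-nothing {x} x≤ℓ e i 1≤i i<z ≡.refl =
      findFirst-nothing (λ i → removable ℓ Ψ (i , x)) (range 1 (x ∸ 1)) e
        (∈-range⁺ 1≤i (ℕₚ.∸-monoˡ-≤ 1 (m-big 1≤i (ℕₚ.≤-trans (ℕₚ.<⇒≤ i<z) z≤ℓ)))) (⇒removable 1≤i i<z x≤ℓ)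

    uppathF-spec : ∀ f x → 1 ≤ x → x ≤ z → x ≤ f → ∃[ t ] ∃[ xs ] uppathF ℓ Ψ f x ≡ x ∷ xs × UpPath t xs x
    uppathF-spec zero    x 1≤x x≤z x≤f = contradiction (ℕₚ.≤-trans 1≤x x≤f) λ ()
    uppathF-spec (suc f) x 1≤x x≤z x≤f with up ℓ Ψ x in e
    ... | nothing = x , [] , ≡.refl , top (up-nothing (ℕₚ.≤-trans x≤z z≤ℓ) e)
    ... | just i with up-just e
    ...   | 1≤i , i<x , mi with uppathF-spec f i 1≤i (ℕₚ.<⇒≤ (ℕₚ.<-≤-trans i<x x≤z))
        (ℕₚ.≤-pred (ℕₚ.<-≤-trans i<x x≤f))
    ...     | t , xs , eq , p = t , i ∷ xs , cong (x ∷_) eq , step 1≤i i<x mi p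

    -- Row z is excluded because it starts in column z+2 at the earliest.
    up-suc-below : ∀ {q i} → q ≤ z → 1 ≤ i → i ℕ.< suc q → m i ≡ suc q → i ℕ.< z
    up-suc-below q≤z 1≤i i<1+q mi = ℕₚ.≤∧≢⇒< (ℕₚ.≤-trans (ℕₚ.≤-pred i<1+q) q≤z)
      (λ { ≡.refl → ℕₚ.<⇒≱ m-far (ℕₚ.≤-trans (ℕₚ.≤-reflexive mi) (s≤s q≤z)) })

    -- Strict increase leaves no row between two that start in adjacent columns. Hence the iterates
    -- of `up` from z+1 run parallel to the path from z, one position to its right.
    up-suc-mirror : ∀ {q x i} → x ℕ.< q → 1 ≤ x → m x ≡ q → i ℕ.< z → 1 ≤ i → m i ≡ suc q → x ℕ.< z → i ≡ suc x
    up-suc-mirror {q} {x} {i} x<q 1≤x mx i<z 1≤i mi x<z with ℕₚ.<-cmp i (suc x)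
    ... | tri≈ _ e _ = e
    ... | tri> _ _ 1+x<i = contradiction
      (ℕₚ.≤-<-trans (subst (ℕ._< m (suc x)) mx (m-mono 1≤x (ℕₚ.n<1+n x) x<z)) (m-mono (s≤s z≤n) 1+x<i (ℕₚ.<⇒≤ i<z)))
      (ℕₚ.<-irrefl (≡.sym mi))
    ... | tri< i<1+x _ _ with ℕₚ.m≤n⇒m<n∨m≡n (ℕₚ.≤-pred i<1+x)
    ...   | inj₂ ≡.refl = contradiction (≡.trans (≡.sym mi) mx) ℕₚ.1+n≢n
    ...   | inj₁ i<x = contradiction (subst (m i ℕ.<_) mx (m-mono 1≤i i<x (ℕₚ.<⇒≤ x<z)))
                         (ℕₚ.<⇒≯ (subst (q ℕ.<_) (≡.sym mi) (ℕₚ.n<1+n q)))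

    -- The parallel climb takes `length xs` steps and arrives at t+1; the one step that remains is
    -- up(t+1) = w, so this w is y+1.
    upIter-just : ∀ {t xs q w} → q ≤ z → UpPath t xs q → upIter ℓ Ψ (suc (length xs)) (suc q) ≡ just w →
      1 ≤ w × w ℕ.< z × m w ≡ suc t
    upIter-just {xs = xs} {q} q≤z p e with up ℓ Ψ (suc q) in eq
    ... | just i with up-just eq
    ...   | 1≤i , i<1+q , mi = go p e
      where
      i<z : i ℕ.< z
      i<z = up-suc-below q≤z 1≤i i<1+q mi
      go : ∀ {t xs w} → UpPath t xs q → upIter ℓ Ψ (length xs) i ≡ just w → 1 ≤ w × w ℕ.< z × m w ≡ suc t
      go (top _) ≡.refl = 1≤i , i<z , mi
      go (step {xs = xs} 1≤x x<q mx p) e = upIter-just (ℕₚ.<⇒≤ x<z) p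
        (subst (λ i → upIter ℓ Ψ (suc (length xs)) i ≡ just _) (up-suc-mirror x<q 1≤x mx i<z 1≤i mi x<z) e)
        where
        x<z = ℕₚ.<-≤-trans x<q q≤z

    -- The runs of length 1 keep the parallel climb from stalling before t+1. Only the last step can
    -- then be undefined, and that means a ceiling in columns t, t+1.
    upIter-nothing : ∀ {t xs q} → 1 ≤ q → q ≤ z → suc q ≤ ℓ → UpPath t xs q → All (λ x → Run x 1) xs →
      upIter ℓ Ψ (suc (length xs)) (suc q) ≡ nothing → ∀ i → 1 ≤ i → i ℕ.< z → m i ≢ suc t
    upIter-nothing {q = q} 1≤q q≤z q<ℓ (top _) [] e with up ℓ Ψ (suc q) in eq
    ... | nothing = up-nothing q<ℓ eq
    upIter-nothing {q = q} 1≤q q≤z q<ℓ (step {x} {xs = xs} 1≤x x<q mx p) (run ∷ runs) e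
      with up ℓ Ψ (suc q) in eq
    ... | nothing = contradiction (≡.trans (run 1 ℕₚ.≤-refl) (cong suc mx))
                      (up-nothing q<ℓ eq (suc x) (s≤s z≤n) (Run-below 1 1≤x (ℕₚ.<-≤-trans x<q q≤z) run))
    ... | just i with up-just eq
    ...   | 1≤i , i<1+q , mi = upIter-nothing 1≤x (ℕₚ.<⇒≤ x<z) (ℕₚ.≤-trans x<z z≤ℓ) p runs
            (subst (λ i → upIter ℓ Ψ (suc (length xs)) i ≡ nothing)
              (up-suc-mirror x<q 1≤x mx (up-suc-below q≤z 1≤i i<1+q mi) 1≤i mi x<z) e)
      where
      x<z = ℕₚ.<-≤-trans x<q q≤z

  -- The rows after h moves and the path shifted by h

  path-far-at : ∀ {ρ γ Z n x} → BouncePath ρ γ Z n x → 2 ℕ.+ x ≤ ρ x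
  path-far-at (wall _ far _)              = far
  path-far-at (mirror ρx _ 2+x≤q _ _ _ _) = subst (_ ℕ.≤_) (≡.sym ρx) 2+x≤q

  -- The first columns of Δᵏ(λ + ε_[y+1,y+h] - ε_[z,z+h]), where m (y+1) = t + 1.
  stageRows : ℕ → ℕ → ℕ → ℕ → ℕ
  stageRows y t zero    = m
  stageRows y t (suc h) = upd (upd (stageRows y t h) (h ℕ.+ suc y) (h ℕ.+ t)) (suc (h ℕ.+ z))
      (suc (stageRows y t h (suc (h ℕ.+ z))))

  -- The invariant of the induction on h. `low` lets row h+y+1 descend to column h+t without meeting
  -- the row above it, `tail` and `end` supply the next wall, and `mid` says that the rows used by
  -- the shifted path left of z are still those of `m`. `mono` stops at row h+z because row h+z+1
  -- may start in the same column.
  record Stage (y t h : ℕ) : Set where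
    field
      mono : ∀ {i j} → 1 ≤ i → i ℕ.< j → j ≤ h ℕ.+ z → stageRows y t h i ℕ.< stageRows y t h j
      big  : ∀ {i} → 1 ≤ i → i ≤ ℓ → i ℕ.< stageRows y t h i
      tail : ∀ {i} → h ℕ.+ z ℕ.< i → stageRows y t h i ≡ r i
      end  : stageRows y t h (h ℕ.+ z) ≡ suc (r (h ℕ.+ z))
      mid  : ∀ {i} → h ℕ.+ y ℕ.< i → i ≤ z → stageRows y t h i ≡ m i
      low  : ∀ {i} → 1 ≤ i → i ≤ h ℕ.+ y → stageRows y t h i ℕ.< h ℕ.+ t

  stage-zero : ∀ {y t} → (∀ {i} → 1 ≤ i → i ≤ y → m i ℕ.< t) → Stage y t 0
  stage-zero low = record
    { mono = m-mono ; big = m-big ; tail = λ z<i → m-off (ℕₚ.>⇒≢ z<i) ; end = m-at ; mid = λ _ _ →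
        ≡.refl ; low = low }

  module _ {y t h : ℕ} (y<t : y ℕ.< t) (S : Stage y t h) (h+z<ℓ : h ℕ.+ z ℕ.< ℓ)
           (flat : r (suc (h ℕ.+ z)) ≡ suc (r (h ℕ.+ z))) where
    open Stage S
    private
      ρ : ℕ → ℕ
      ρ = stageRows y t h

    -- A partial path whose upper end has a ceiling: the input that `H-mirror` needs to make `H`
    -- vanish.
    Blocked : Set
    Blocked = ∃[ n ] ∃[ x ] 1 ≤ x × BouncePath ρ (wt k ρ) (h ℕ.+ z) n x × (∀ i → 1 ≤ i → i ℕ.< x → ρ i ≢ suc x)

    -- Row h+z starts one column later than in λ, and by `flat` row h+z+1 starts in that same
    -- column.
    wall-at-end : BouncePath ρ (wt k ρ) (h ℕ.+ z) 0 (h ℕ.+ z)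
    wall-at-end = wall e (subst (2 ℕ.+ (h ℕ.+ z) ℕ.≤_) (≡.sym end) (s≤s (r-big (ℕₚ.≤-trans 1≤z (ℕₚ.m≤n+m z h))
        (ℕₚ.<⇒≤ h+z<ℓ))))
      (wt-step k ρ (h ℕ.+ z) e)
      where
      e : ρ (h ℕ.+ z) ≡ ρ (suc (h ℕ.+ z))
      e = ≡.trans end (≡.sym (≡.trans (tail (ℕₚ.n<1+n _)) flat))

    module _ {x q} (1≤x : 1 ≤ x) (x<z : x ℕ.< z) (t≤x : t ≤ x) (mx : m x ≡ q) (run : Run x h) where
      private
        y<x : y ℕ.< x
        y<x = ℕₚ.<-≤-trans y<t t≤x

      run-below : h ℕ.+ x ℕ.< z
      run-below = Run-below h 1≤x x<z run

      run-row : ρ (h ℕ.+ x) ≡ h ℕ.+ q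
      run-row = ≡.trans (mid (ℕₚ.+-monoʳ-< h y<x) (ℕₚ.<⇒≤ run-below)) (≡.trans (run h ℕₚ.≤-refl) (cong (h ℕ.+_) mx))

      run-next : ρ (suc (h ℕ.+ x)) ≡ m (suc (h ℕ.+ x))
      run-next = mid (ℕₚ.m≤n⇒m≤1+n (ℕₚ.+-monoʳ-< h y<x)) run-below

      run-left : ∀ i → 1 ≤ i → i ≤ h ℕ.+ x → ρ i ≢ suc (h ℕ.+ q)
      run-left i 1≤i i≤h+x e with ℕₚ.m≤n⇒m<n∨m≡n i≤h+x
      ... | inj₂ ≡.refl = ℕₚ.1+n≢n (≡.trans (≡.sym e) run-row)
      ... | inj₁ lt = ℕₚ.<⇒≱ (mono 1≤i lt (ℕₚ.≤-trans (ℕₚ.<⇒≤ run-below) (ℕₚ.m≤n+m z h)))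
                (ℕₚ.≤-trans (ℕₚ.≤-reflexive run-row) (ℕₚ.≤-trans (ℕₚ.n≤1+n _) (ℕₚ.≤-reflexive (≡.sym e))))

      run-right : ∀ i → suc (h ℕ.+ x) ℕ.< i → i ≤ h ℕ.+ z → ρ i ≢ suc (h ℕ.+ q)
      run-right i lt i≤ e = ℕₚ.<⇒≱ (mono (s≤s z≤n) lt i≤)
        (ℕₚ.≤-trans (ℕₚ.≤-reflexive e) (subst (λ v → suc v ≤ ρ (suc (h ℕ.+ x))) run-row
          (mono (ℕₚ.≤-trans 1≤x (ℕₚ.m≤n+m x h)) (ℕₚ.n<1+n _) (ℕₚ.≤-trans run-below (ℕₚ.m≤n+m z h)))))

    -- By `run-left` and `run-right` the only row up to h+z that can start in column h+q+1 is row
    -- h+x+1. If it does, rows h+x, h+x+1 are the next mirror and the run at x grows by one; if not,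
    -- columns h+q, h+q+1 have a ceiling. So one test decides both whether h may grow and whether
    -- the path continues.
    climb : ∀ {xs q n} → 1 ≤ q → q ≤ z → UpPath t xs q → All (λ x → Run x h) xs →
      BouncePath ρ (wt k ρ) (h ℕ.+ z) n (h ℕ.+ q) →
      (¬ All (λ x → Run x (suc h)) xs × Blocked)
      ⊎ (All (λ x → Run x (suc h)) xs × BouncePath ρ (wt k ρ) (h ℕ.+ z) (n ℕ.+ length xs) (h ℕ.+ t))
    climb {n = n} 1≤q q≤z (top _) [] b = inj₂ ([] , subst (λ n → BouncePath ρ (wt k ρ) (h ℕ.+ z) n (h ℕ.+ t))
        (≡.sym (ℕₚ.+-identityʳ n)) b)
    climb {q = q} {n} 1≤q q≤z (step {x} {xs = xs} 1≤x x<q mx p) (run ∷ runs) b with ρ (suc (h ℕ.+ x)) ℕ.≟ suc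
        (h ℕ.+ q)
    ... | no ne = inj₁ (blocked , n , h ℕ.+ q , ℕₚ.≤-trans 1≤q (ℕₚ.m≤n+m q h) , b , ceil)
      where
      x<z : x ℕ.< z
      x<z = ℕₚ.<-≤-trans x<q q≤z
      blocked : ¬ All (λ x → Run x (suc h)) (x ∷ xs)
      blocked (run′ ∷ _) = ne (≡.trans (run-next 1≤x x<z (top-≤ p) mx run)
        (≡.trans (run′ (suc h) ℕₚ.≤-refl) (cong (λ q → suc (h ℕ.+ q)) mx)))
      ceil : ∀ i → 1 ≤ i → i ℕ.< h ℕ.+ q → ρ i ≢ suc (h ℕ.+ q)
      ceil i 1≤i i<h+q e with ℕₚ.<-cmp i (suc (h ℕ.+ x))
      ... | tri≈ _ ≡.refl _ = ne e
      ... | tri> _ _ lt = run-right 1≤x x<z (top-≤ p) mx run i lt (ℕₚ.≤-trans (ℕₚ.<⇒≤ i<h+q) (ℕₚ.+-monoʳ-≤ h q≤z)) e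
      ... | tri< (s≤s i≤h+x) _ _ = run-left 1≤x x<z (top-≤ p) mx run i 1≤i i≤h+x e
    ... | yes e = finish (climb 1≤x (ℕₚ.<⇒≤ x<z) p runs b′)
      where
      x<z : x ℕ.< z
      x<z = ℕₚ.<-≤-trans x<q q≤z
      ρx : ρ (h ℕ.+ x) ≡ h ℕ.+ q
      ρx = run-row 1≤x x<z (top-≤ p) mx run
      run′ : Run x (suc h)
      run′ = Run-suc run (≡.trans (≡.sym (run-next 1≤x x<z (top-≤ p) mx run))
               (≡.trans e (cong (λ q → suc (h ℕ.+ q)) (≡.sym mx))))
      b′ : BouncePath ρ (wt k ρ) (h ℕ.+ z) (suc n) (h ℕ.+ x)
      b′ = mirror ρx e
        -- If h+x+1 were h+q, row h+q would start in column h+q+1, too early for a row of the path.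
        (ℕₚ.≤∧≢⇒< (ℕₚ.+-monoʳ-< h x<q) (λ e′ → ℕₚ.1+n≰n (ℕₚ.≤-trans (path-far-at b)
            (ℕₚ.≤-reflexive (≡.trans (cong ρ (≡.sym e′)) e)))))
        (wt-level k ρ (h ℕ.+ x) (≡.trans e (cong suc (≡.sym ρx))))
        (λ i 1≤i i<h+x → run-left 1≤x x<z (top-≤ p) mx run i 1≤i (ℕₚ.<⇒≤ i<h+x))
        (λ i lt i<h+q → run-right 1≤x x<z (top-≤ p) mx run i lt (ℕₚ.≤-trans (ℕₚ.<⇒≤ i<h+q) (ℕₚ.+-monoʳ-≤ h q≤z)))
        b
      finish : _ → _
      finish (inj₁ (¬all , blocked)) = inj₁ ((λ { (_ ∷ runs′) → ¬all runs′ }) , blocked)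
      finish (inj₂ (runs′ , b″)) = inj₂ (run′ ∷ runs′ ,
        subst (λ n → BouncePath ρ (wt k ρ) (h ℕ.+ z) n (h ℕ.+ t)) (≡.sym (ℕₚ.+-suc n (length xs))) b″)

    module _ (1+y<z : suc y ℕ.< z) (my : m (suc y) ≡ suc t) where
      top-row : Run (suc y) h → ρ (h ℕ.+ suc y) ≡ suc (h ℕ.+ t)
      top-row run = ≡.trans (mid (ℕₚ.+-monoʳ-< h (ℕₚ.n<1+n y)) (ℕₚ.<⇒≤ (Run-below h (s≤s z≤n) 1+y<z run)))
        (≡.trans (run h ℕₚ.≤-refl) (≡.trans (cong (h ℕ.+_) my) (ℕₚ.+-suc h t)))

      -- Lowering row Q keeps the starts strictly increasing thanks to `low`. Raising row Z+1
      -- dissolves the tie with row Z and moves the possible tie to rows Z+1, Z+2.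
      stage-suc : ∀ {n} → BouncePath ρ (wt k ρ) (h ℕ.+ z) n (h ℕ.+ t) → Run (suc y) h →
        h ℕ.+ suc y ℕ.< h ℕ.+ t × Stage y t (suc h)
      stage-suc b run = Q<p , record
        { mono = mono′ ; big = big′ ; tail = tail′ ; end = end′ ; mid = mid′ ; low = low′ }
        where
        Q p Z : ℕ
        Q = h ℕ.+ suc y
        p = h ℕ.+ t
        Z = h ℕ.+ z
        ρ′ : ℕ → ℕ
        ρ′ = stageRows y t (suc h)
        ρQ : ρ Q ≡ suc p
        ρQ = top-row run
        Q<z : Q ℕ.< z
        Q<z = Run-below h (s≤s z≤n) 1+y<z run
        1≤Q : 1 ≤ Q
        1≤Q = ℕₚ.≤-trans (s≤s z≤n) (ℕₚ.m≤n+m (suc y) h)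
        Q<Z+1 : Q ℕ.< suc Z
        Q<Z+1 = ℕₚ.≤-trans Q<z (ℕₚ.≤-trans (ℕₚ.m≤n+m z h) (ℕₚ.n≤1+n Z))
        Q<p : Q ℕ.< p
        Q<p = ℕₚ.≤∧≢⇒< (ℕₚ.+-monoʳ-≤ h y<t)
          (λ e → ℕₚ.1+n≰n (ℕₚ.≤-trans (path-far-at b) (ℕₚ.≤-reflexive (≡.trans (cong ρ (≡.sym e)) ρQ))))
        at-Q : ρ′ Q ≡ p
        at-Q = ≡.trans (upd-off _ _ (ℕₚ.<⇒≢ Q<Z+1)) (upd-at ρ Q p)
        at-Z+1 : ρ′ (suc Z) ≡ suc (ρ (suc Z))
        at-Z+1 = upd-at _ (suc Z) _
        off : ∀ {i} → i ≢ Q → i ≢ suc Z → ρ′ i ≡ ρ i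
        off i≢Q i≢Z+1 = ≡.trans (upd-off _ _ i≢Z+1) (upd-off ρ p i≢Q)
        shrinks : ∀ {i} → i ≤ Z → ρ′ i ≤ ρ i
        shrinks {i} i≤Z with i ℕ.≟ Q
        ... | yes ≡.refl = ℕₚ.≤-trans (ℕₚ.≤-reflexive at-Q) (ℕₚ.≤-trans (ℕₚ.n≤1+n p) (ℕₚ.≤-reflexive (≡.sym ρQ)))
        ... | no i≢Q = ℕₚ.≤-reflexive (off i≢Q (ℕₚ.<⇒≢ (s≤s i≤Z)))
        wall-row : ρ Z ≡ ρ (suc Z)
        wall-row = ≡.trans end (≡.sym (≡.trans (tail (ℕₚ.n<1+n Z)) flat))
        mono′ : ∀ {i j} → 1 ≤ i → i ℕ.< j → j ≤ suc Z → ρ′ i ℕ.< ρ′ j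
        mono′ {i} {j} 1≤i i<j j≤ with j ℕ.≟ suc Z
        ... | yes ≡.refl = subst (ρ′ i ℕ.<_) (≡.sym at-Z+1) (s≤s (ℕₚ.≤-trans (shrinks (ℕₚ.≤-pred i<j)) ρi≤))
          where
          ρi≤ : ρ i ≤ ρ (suc Z)
          ρi≤ with ℕₚ.m≤n⇒m<n∨m≡n (ℕₚ.≤-pred i<j)
          ... | inj₁ i<Z = ℕₚ.≤-trans (ℕₚ.<⇒≤ (mono 1≤i i<Z ℕₚ.≤-refl)) (ℕₚ.≤-reflexive wall-row)
          ... | inj₂ ≡.refl = ℕₚ.≤-reflexive wall-row
        ... | no j≢ with j ℕ.≟ Q
        ...   | yes ≡.refl = subst (ρ′ i ℕ.<_) (≡.sym at-Q)
            (ℕₚ.≤-<-trans (shrinks (ℕₚ.<⇒≤ (ℕₚ.<-≤-trans i<j (ℕₚ.≤-pred Q<Z+1))))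
                  (low 1≤i (ℕₚ.≤-pred (ℕₚ.≤-trans i<j (ℕₚ.≤-reflexive (ℕₚ.+-suc h y))))))
        ...   | no j≢Q = subst (ρ′ i ℕ.<_) (≡.sym (off j≢Q j≢))
            (ℕₚ.≤-<-trans (shrinks (ℕₚ.<⇒≤ (ℕₚ.<-≤-trans i<j j≤Z))) (mono 1≤i i<j j≤Z))
          where
          j≤Z : j ≤ Z
          j≤Z = ℕₚ.≤-pred (ℕₚ.≤∧≢⇒< j≤ j≢)
        big′ : ∀ {i} → 1 ≤ i → i ≤ ℓ → i ℕ.< ρ′ i
        big′ {i} 1≤i i≤ℓ with i ℕ.≟ Q | i ℕ.≟ suc Z
        ... | yes ≡.refl | _ = subst (Q ℕ.<_) (≡.sym at-Q) Q<p
        ... | no _ | yes ≡.refl = subst (suc Z ℕ.<_) (≡.sym at-Z+1) (ℕₚ.m≤n⇒m≤1+n (big 1≤i i≤ℓ))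
        ... | no i≢Q | no i≢ = subst (i ℕ.<_) (≡.sym (off i≢Q i≢)) (big 1≤i i≤ℓ)
        tail′ : ∀ {i} → suc Z ℕ.< i → ρ′ i ≡ r i
        tail′ lt = ≡.trans (off (ℕₚ.>⇒≢ (ℕₚ.<-trans Q<Z+1 lt)) (ℕₚ.>⇒≢ lt)) (tail (ℕₚ.<-trans (ℕₚ.n<1+n Z) lt))
        end′ : ρ′ (suc Z) ≡ suc (r (suc Z))
        end′ = ≡.trans at-Z+1 (cong suc (tail (ℕₚ.n<1+n Z)))
        mid′ : ∀ {i} → suc h ℕ.+ y ℕ.< i → i ≤ z → ρ′ i ≡ m i
        mid′ {i} lt i≤z = ≡.trans (off (ℕₚ.>⇒≢ (subst (ℕ._< i) (≡.sym (ℕₚ.+-suc h y)) lt))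
          (ℕₚ.<⇒≢ (s≤s (ℕₚ.≤-trans i≤z (ℕₚ.m≤n+m z h))))) (mid (ℕₚ.<-trans (ℕₚ.n<1+n _) lt) i≤z)
        low′ : ∀ {i} → 1 ≤ i → i ≤ suc h ℕ.+ y → ρ′ i ℕ.< suc p
        low′ {i} 1≤i i≤ with i ℕ.≟ Q
        ... | yes ≡.refl = s≤s (ℕₚ.≤-reflexive at-Q)
        ... | no i≢Q = ℕₚ.m≤n⇒m≤1+n (ℕₚ.≤-<-trans (shrinks (ℕₚ.≤-trans i≤Q (ℕₚ.≤-pred Q<Z+1)))
                (low 1≤i (ℕₚ.≤-pred (ℕₚ.≤∧≢⇒< i≤ (λ e → i≢Q (≡.trans e (≡.sym (ℕₚ.+-suc h y))))))))
          where
          i≤Q : i ≤ Q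
          i≤Q = ℕₚ.≤-trans i≤ (ℕₚ.≤-reflexive (≡.sym (ℕₚ.+-suc h y)))

  -- Rows up to h+y start before column h+t by `low`. The run from y+1 reaches h+y but not h+y+1, so
  -- by strict increase row h+y+1 starts beyond column h+t+1, and so do the rows after it.
  top-blocked : ∀ {y t} h → Stage y t h → t ≤ z → suc y ℕ.< z → m (suc y) ≡ suc t →
    (∀ h′ → h ≡ suc h′ → Run (suc y) h′) → ¬ Run (suc y) h → ∀ i → 1 ≤ i → i ℕ.< h ℕ.+ t →
        stageRows y t h i ≢ suc (h ℕ.+ t)
  top-blocked {y} {t} zero    S t≤z 1+y<z my runs ¬run = contradiction (Run-zero (suc y)) ¬run
  top-blocked {y} {t} (suc h) S t≤z 1+y<z my runs ¬run i 1≤i i<h+t e = excluded (ℕₚ.<-cmp i Q)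
    where
    open Stage S
    Q : ℕ
    Q = suc h ℕ.+ suc y
    run : Run (suc y) h
    run = runs h ≡.refl
    Q≤z : Q ≤ z
    Q≤z = Run-below h (s≤s z≤n) 1+y<z run
    run-end : m (h ℕ.+ suc y) ≡ suc (h ℕ.+ t)
    run-end = ≡.trans (run h ℕₚ.≤-refl) (≡.trans (cong (h ℕ.+_) my) (ℕₚ.+-suc h t))
    mQ> : suc (suc h ℕ.+ t) ℕ.< m Q
    mQ> = ℕₚ.≤∧≢⇒< (subst (ℕ._< m Q) run-end (m-mono (ℕₚ.≤-trans (s≤s z≤n) (ℕₚ.m≤n+m (suc y) h)) (ℕₚ.n<1+n _) Q≤z))
      (λ eq → ¬run (Run-suc run (≡.trans (≡.sym eq) (≡.trans (≡.sym (ℕₚ.+-suc (suc h) t))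
          (cong (suc h ℕ.+_) (≡.sym my))))))
    ρQ> : suc (suc h ℕ.+ t) ℕ.< stageRows y t (suc h) Q
    ρQ> = subst (suc (suc h ℕ.+ t) ℕ.<_) (≡.sym (mid (ℕₚ.+-monoʳ-< (suc h) (ℕₚ.n<1+n y)) Q≤z)) mQ>
    excluded : _ → _
    excluded (tri≈ _ ≡.refl _) = ℕₚ.<-irrefl (≡.sym e) ρQ>
    excluded (tri> _ _ Q<i) = ℕₚ.<-irrefl (≡.sym e) (ℕₚ.<-trans ρQ>
      (mono (s≤s z≤n) Q<i (ℕₚ.≤-trans (ℕₚ.<⇒≤ i<h+t) (ℕₚ.+-monoʳ-≤ (suc h) t≤z))))
    excluded (tri< i<Q _ _) = ℕₚ.<-irrefl e (ℕₚ.m≤n⇒m≤1+n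
        (low 1≤i (ℕₚ.≤-pred (ℕₚ.≤-trans i<Q (ℕₚ.≤-reflexive (ℕₚ.+-suc (suc h) y))))))

  stageRows-wt : ∀ {y t h} → stageRows y t h (h ℕ.+ suc y) ≡ suc (h ℕ.+ t) → h ℕ.+ suc y ≢ suc (h ℕ.+ z) →
    wt k (stageRows y t (suc h)) ≗ wt k (stageRows y t h) ⊕ (h ℕ.+ suc y , suc (h ℕ.+ z))
  stageRows-wt {y} {t} {h} ρQ Q≢ n with n ℕ.≟ h ℕ.+ suc y | n ℕ.≟ suc (h ℕ.+ z)
  ... | yes ≡.refl | _ = ≡.trans
    (wt-lower k (stageRows y t h) (stageRows y t (suc h)) (h ℕ.+ suc y) (h ℕ.+ t) ρQ (≡.trans (upd-off _ _ Q≢)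
        (upd-at (stageRows y t h) _ _)))
    (≡.sym (⊕-lower (wt k (stageRows y t h)) Q≢))
  ... | no n≢Q | yes ≡.refl = ≡.trans
    (wt-raise k (stageRows y t h) (stageRows y t (suc h)) (suc (h ℕ.+ z)) (upd-at _ (suc (h ℕ.+ z)) _))
    (≡.sym (⊕-upper (wt k (stageRows y t h)) Q≢))
  ... | no n≢Q | no n≢ = ≡.trans (cong (λ x → + (k ℕ.+ suc n) ℤ.- + x) (≡.trans (upd-off _ _ n≢)
      (upd-off (stageRows y t h) _ n≢Q)))
    (≡.sym (⊕-other (wt k (stageRows y t h)) n≢Q n≢))

  -- For h ≥ 1, the condition on h in the definition of cvr, xs being the path from z without z itself.
  record Admissible (y : ℕ) (xs : List ℕ) (h : ℕ) : Set where
    field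
      fits  : h ℕ.+ z ≤ ℓ
      ends  : ∀ h′ → h ≡ suc h′ → Run (suc z) h′ × Run (suc y) h′
      inner : All (λ x → Run x h) xs
  open Admissible

  admissible-pred : ∀ {y xs h} → Admissible y xs (suc h) → Admissible y xs h
  admissible-pred G .fits = ℕₚ.≤-trans (ℕₚ.n≤1+n _) (G .fits)
  admissible-pred G .ends h′ ≡.refl = Run-pred (proj₁ (G .ends _ ≡.refl)) , Run-pred (proj₂ (G .ends _ ≡.refl))
  admissible-pred G .inner = All.map Run-pred (G .inner)

  z+1-off : ∀ h → m (h ℕ.+ suc z) ≡ r (suc (h ℕ.+ z))
  z+1-off h = ≡.trans (cong m (ℕₚ.+-suc h z)) (m-off (ℕₚ.>⇒≢ (s≤s (ℕₚ.m≤n+m z h))))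

  -- λ and μ agree to the right of z, so the run from z+1 together with λ_z = λ_{z+1} makes λ
  -- constant from z up to z+h+1.
  admissible-flat : ∀ {y xs h} → r (suc z) ≡ suc (r z) → Admissible y xs (suc h) →
      r (suc (h ℕ.+ z)) ≡ suc (r (h ℕ.+ z))
  admissible-flat {h = zero}  flat G = flat
  admissible-flat {h = suc h} flat G = ≡.trans (≡.sym (z+1-off (suc h))) (≡.trans (run (suc h) ℕₚ.≤-refl)
    (cong suc (≡.trans (≡.sym (run h (ℕₚ.n≤1+n h))) (z+1-off h))))
    where
    run : Run (suc z) (suc h)
    run = proj₁ (G .ends _ ≡.refl)

  admissible-suc : ∀ {y xs h} → Admissible y xs h → suc (h ℕ.+ z) ≤ ℓ → r (suc (h ℕ.+ z)) ≡ suc (r (h ℕ.+ z)) →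
    Run (suc y) h → All (λ x → Run x (suc h)) xs → Admissible y xs (suc h)
  admissible-suc {h = h} G fits′ flat run runs = record
    { fits = fits′ ; ends = λ { h′ ≡.refl → run-z h G flat , run } ; inner = runs }
    where
    run-z : ∀ {y xs} h → Admissible y xs h → r (suc (h ℕ.+ z)) ≡ suc (r (h ℕ.+ z)) → Run (suc z) h
    run-z zero    G flat = Run-zero (suc z)
    run-z (suc h) G flat = Run-suc run′ (≡.trans (z+1-off (suc h)) (≡.trans flat
      (cong suc (≡.trans (≡.sym (z+1-off h)) (run′ h ℕₚ.≤-refl)))))
      where
      run′ : Run (suc z) h
      run′ = proj₁ (G .ends h ≡.refl)

+-suc-comm : ∀ n m → n ℕ.+ suc m ≡ m ℕ.+ suc n
+-suc-comm n m = ≡.trans (ℕₚ.+-suc n m) (≡.trans (cong suc (ℕₚ.+-comm n m)) (≡.sym (ℕₚ.+-suc m n)))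

suc-≤ᵇ : ∀ n m → (suc n ≤ᵇ suc m) ≡ (n ≤ᵇ m)
suc-≤ᵇ zero    m = ≡.refl
suc-≤ᵇ (suc n) m = ≡.refl

-- A view of the case split in `Cover.hy`, indexed by its value, so that matching on it determines h
-- and y at once.
data CoverCase (k ℓ : ℕ) (lam : ℕ → ℤ) (z : ℕ) : ℕ × ℕ → Set where
  lastRow : z ≡ ℓ → CoverCase k ℓ lam z (0 , 0)
  corner : lam (suc z) ℤ.< lam z → CoverCase k ℓ lam z (0 , 0)
  noUp   : z ≢ ℓ → lam z ℤ.≤ lam (suc z) → upIter ℓ (Cover.Ψ k ℓ lam z) (Cover.c k ℓ lam z) (suc z) ≡ nothing →
    CoverCase k ℓ lam z (0 , 0)
  found  : ∀ {w} → z ≢ ℓ → lam z ℤ.≤ lam (suc z) →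
    upIter ℓ (Cover.Ψ k ℓ lam z) (Cover.c k ℓ lam z) (suc z) ≡ just w →
    CoverCase k ℓ lam z (maxSat (ℓ ∸ z) (Cover.condH k ℓ lam z (w ∸ 1)) , w ∸ 1)

coverCase : ∀ k ℓ lam z → CoverCase k ℓ lam z (Cover.hy k ℓ lam z)
coverCase k ℓ lam z
  with z == ℓ in e₁ | lam (suc z) <ℤᵇ lam z in e₂ | upIter ℓ (Cover.Ψ k ℓ lam z) (Cover.c k ℓ lam z) (suc z) in e₃
... | true  | _     | _       = lastRow (ℕₚ.≡ᵇ⇒≡ z ℓ (Equivalence.from T-≡ e₁))
... | false | true  | _       = corner (<ℤᵇ⇒< (Equivalence.from T-≡ e₂))
... | false | false | nothing = noUp (λ z≡ℓ → subst T e₁ (ℕₚ.≡⇒≡ᵇ z ℓ z≡ℓ))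
    (ℤₚ.≮⇒≥ (λ lt → subst T e₂ (<⇒<ℤᵇ lt))) e₃
... | false | false | just w  = found (λ z≡ℓ → subst T e₁ (ℕₚ.≡⇒≡ᵇ z ℓ z≡ℓ))
    (ℤₚ.≮⇒≥ (λ lt → subst T e₂ (<⇒<ℤᵇ lt))) e₃

module CatalanFunctions {a b : Level} (R : CommutativeRing a b) (hs : ℕ → CommutativeRing.Carrier R) where
  open CommutativeRing R
  open SymFun R hs
  open Algebra.Properties.Ring ring using (-‿distribʳ-*; -‿distribˡ-*; -‿+-comm; -0#≈0#; -‿involutive)
  open Algebra.Properties.CommutativeSemigroup +-commutativeSemigroup using (interchange; x∙yz≈y∙xz; xy∙z≈xz∙y)
  open Algebra.Properties.CommutativeSemigroup *-commutativeSemigroup using () renaming (x∙yz≈y∙xz to x*yz≈y*xz)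
  open Relation.Binary.Reasoning.Setoid setoid

  -- Determinants

  sumFin-cong : ∀ {n} {f g : Fin n → Carrier} → (∀ i → f i ≈ g i) → sumFin f ≈ sumFin g
  sumFin-cong {zero}  e = refl
  sumFin-cong {suc n} e = +-cong (e Fin.zero) (sumFin-cong (λ i → e (Fin.suc i)))

  sumFin-zero : ∀ {n} {f : Fin n → Carrier} → (∀ i → f i ≈ 0#) → sumFin f ≈ 0#
  sumFin-zero {zero}  e = refl
  sumFin-zero {suc n} e = trans (+-cong (e Fin.zero) (sumFin-zero (λ i → e (Fin.suc i)))) (+-identityˡ 0#)

  sumFin-+ : ∀ {n} (f g : Fin n → Carrier) → sumFin (λ i → f i + g i) ≈ sumFin f + sumFin g
  sumFin-+ {zero}  f g = sym (+-identityˡ 0#)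
  sumFin-+ {suc n} f g = trans (+-congˡ (sumFin-+ (λ i → f (Fin.suc i)) (λ i → g (Fin.suc i))))
      (interchange _ _ _ _)

  sumFin-neg : ∀ {n} (f : Fin n → Carrier) → sumFin (λ i → - f i) ≈ - sumFin f
  sumFin-neg {zero}  f = sym -0#≈0#
  sumFin-neg {suc n} f = trans (+-congˡ (sumFin-neg (λ i → f (Fin.suc i)))) (-‿+-comm _ _)

  *-distribˡ-sumFin : ∀ {n} x (f : Fin n → Carrier) → x * sumFin f ≈ sumFin (λ i → x * f i)
  *-distribˡ-sumFin {zero}  x f = zeroʳ x
  *-distribˡ-sumFin {suc n} x f = trans (distribˡ x _ _) (+-congˡ (*-distribˡ-sumFin x (λ i → f (Fin.suc i))))

  sign-suc : ∀ n → sign (suc n) ≈ - sign n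
  sign-suc zero          = refl
  sign-suc (suc zero)    = sym (-‿involutive 1#)
  sign-suc (suc (suc n)) = sign-suc n

  opaque
    altSum : ∀ {n} → (Fin n → Carrier) → Carrier
    altSum f = sumFin (λ j → sign (toℕ j) * f j)

    altSum-cong : ∀ {n} {f g : Fin n → Carrier} → (∀ i → f i ≈ g i) → altSum f ≈ altSum g
    altSum-cong e = sumFin-cong (λ i → *-congˡ (e i))

    altSum-zero : ∀ {n} {f : Fin n → Carrier} → (∀ i → f i ≈ 0#) → altSum f ≈ 0#
    altSum-zero e = sumFin-zero (λ i → trans (*-congˡ (e i)) (zeroʳ _))

    altSum-+ : ∀ {n} (f g : Fin n → Carrier) → altSum (λ i → f i + g i) ≈ altSum f + altSum g
    altSum-+ {n} f g = trans (sumFin-cong {n} (λ i → distribˡ _ (f i) (g i))) (sumFin-+ {n} _ _)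

    altSum-neg : ∀ {n} (f : Fin n → Carrier) → altSum (λ i → - f i) ≈ - altSum f
    altSum-neg {n} f = trans (sumFin-cong {n} (λ i → sym (-‿distribʳ-* _ (f i)))) (sumFin-neg {n} _)

    *-distribˡ-altSum : ∀ {n} x (f : Fin n → Carrier) → x * altSum f ≈ altSum (λ i → x * f i)
    *-distribˡ-altSum {n} x f = trans (*-distribˡ-sumFin {n} x _) (sumFin-cong {n} (λ i → x*yz≈y*xz x _ (f i)))

    altSum-suc : ∀ {n} (f : Fin (suc n) → Carrier) → altSum f ≈ f Fin.zero + - altSum (λ i → f (Fin.suc i))
    altSum-suc {n} f = +-cong (*-identityˡ _) (trans
      (sumFin-cong {n} (λ i → trans (*-congʳ (sign-suc (toℕ i))) (sym (-‿distribˡ-* _ (f (Fin.suc i))))))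
      (sumFin-neg {n} _))

    altSum-empty : (f : Fin 0 → Carrier) → altSum f ≈ 0#
    altSum-empty f = refl

    det-expand : ∀ {n} (M : Fin (suc n) → Fin (suc n) → Carrier) →
      det M ≈ altSum (λ j → M Fin.zero j * det (λ a b → M (Fin.suc a) (punchIn j b)))
    det-expand M = refl

  -- f j j' stands for a term obtained by deleting column j and then the j'-th of the
  -- remaining columns; the condition says that it does not depend on the order of deletion.
  OrderFree : ∀ n → (Fin (suc n) → Fin n → Carrier) → Set b
  OrderFree zero    f = Lift b ⊤
  OrderFree (suc n) f = (∀ j → f Fin.zero j ≈ f (Fin.suc j) Fin.zero)
                      × OrderFree n (λ i j → f (Fin.suc i) (Fin.suc j))

  OrderFree-cong : ∀ n {f g : Fin (suc n) → Fin n → Carrier} → (∀ i j → f i j ≈ g i j) → OrderFree n f →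
      OrderFree n g
  OrderFree-cong zero    e _       = _
  OrderFree-cong (suc n) e (p , q) =
    (λ j → trans (sym (e _ _)) (trans (p j) (e _ _))) , OrderFree-cong n (λ i j → e _ _) q

  -- Every pair of deleted columns occurs twice with opposite signs. The terms with j = 0 sum to S;
  -- in the terms with j > 0 the entries at j′ = 0 contribute the same S with a minus sign, and the
  -- rest is a smaller instance.
  altSum²-orderFree : ∀ n {f : Fin (suc n) → Fin n → Carrier} → OrderFree n f → altSum (λ j → altSum (f j)) ≈ 0#
  altSum²-orderFree zero {f} _       = altSum-zero (λ j → altSum-empty (f j))
  altSum²-orderFree (suc n) {f} (p , q) = begin
    altSum (λ j → altSum (f j))                                        ≈⟨ altSum-suc (λ j → altSum (f j)) ⟩
    S + - altSum (λ j → altSum (f (Fin.suc j)))                        ≈⟨ +-congˡ (-‿cong tail) ⟩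
    S + - S                                                            ≈⟨ -‿inverseʳ S ⟩
    0#                                                                 ∎
    where
    S = altSum (f Fin.zero)
    f′ : Fin (suc n) → Fin n → Carrier
    f′ i j = f (Fin.suc i) (Fin.suc j)
    tail : altSum (λ j → altSum (f (Fin.suc j))) ≈ S
    tail = begin
      altSum (λ j → altSum (f (Fin.suc j)))                                     ≈⟨ altSum-cong (λ j →
          altSum-suc (f (Fin.suc j))) ⟩
      altSum (λ j → f (Fin.suc j) Fin.zero + - altSum (f′ j))                   ≈⟨ altSum-+ (λ j →
          f (Fin.suc j) Fin.zero) (λ j → - altSum (f′ j)) ⟩
      altSum (λ j → f (Fin.suc j) Fin.zero) + altSum (λ j → - altSum (f′ j))    ≈⟨ +-cong (altSum-cong (λ j →
          sym (p j))) (altSum-neg (λ j → altSum (f′ j))) ⟩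
      S + - altSum (λ j → altSum (f′ j))                                        ≈⟨ +-congˡ
          (trans (-‿cong (altSum²-orderFree n q)) -0#≈0#) ⟩
      S + 0#                                                                    ≈⟨ +-identityʳ S ⟩
      S                                                                         ∎

  cons : ∀ {n} {A : Set} → A → (Fin n → A) → Fin (suc n) → A
  cons x e Fin.zero    = x
  cons x e (Fin.suc i) = e i

  -- In `Q x y e`, x and y are the deleted columns and e lists the others. Either column 0 is
  -- deleted, which symmetry settles, or it heads the remaining ones, which is `Q′`, one size
  -- smaller. In that second case the lists of remaining columns agree only pointwise, hence the
  -- congruence hypothesis.
  orderFree-punchIn : ∀ n (Q : Fin (2 ℕ.+ n) → Fin (2 ℕ.+ n) → (Fin n → Fin (2 ℕ.+ n)) → Carrier) →
    (∀ x y e → Q x y e ≈ Q y x e) → (∀ x y {e e′} → (∀ i → e i ≡ e′ i) → Q x y e ≈ Q x y e′) →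
    OrderFree (suc n) (λ j j′ → Q j (punchIn j j′) (λ i → punchIn j (punchIn j′ i)))
  orderFree-punchIn zero    Q sy cg = (λ j → sy _ _ _) , _
  orderFree-punchIn (suc n) Q sy cg = (λ j → sy _ _ _) ,
    OrderFree-cong (suc n)
      {f = λ i j → Q′ i (punchIn i j) (λ b → punchIn i (punchIn j b))}
      {g = λ i j → Q (Fin.suc i) (Fin.suc (punchIn i j)) (λ b → punchIn (Fin.suc i) (punchIn (Fin.suc j) b))}
      (λ i j → cg (Fin.suc i) (Fin.suc (punchIn i j)) λ { Fin.zero → ≡.refl ; (Fin.suc _) → ≡.refl })
      (orderFree-punchIn n Q′ (λ x y e → sy _ _ _)
        (λ x y e≗ → cg _ _ λ { Fin.zero → ≡.refl ; (Fin.suc i) → cong Fin.suc (e≗ i) }))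
    where
    Q′ : Fin (2 ℕ.+ n) → Fin (2 ℕ.+ n) → (Fin n → Fin (2 ℕ.+ n)) → Carrier
    Q′ x y e = Q (Fin.suc x) (Fin.suc y) (cons Fin.zero (λ i → Fin.suc (e i)))

  det-cong : ∀ {n} {M N : Fin n → Fin n → Carrier} → (∀ i j → M i j ≈ N i j) → det M ≈ det N
  det-cong {zero}  e = refl
  det-cong {suc n} {M} {N} e = trans (det-expand M) (trans
    (altSum-cong (λ j → *-cong (e Fin.zero j) (det-cong (λ a b → e (Fin.suc a) (punchIn j b)))))
        (sym (det-expand N)))

  det-expand² : ∀ {n} (M : Fin (2 ℕ.+ n) → Fin (2 ℕ.+ n) → Carrier) →
    det M ≈ altSum (λ j → altSum (λ j′ → M Fin.zero j * (M (Fin.suc Fin.zero) (punchIn j j′)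
              * det (λ a b → M (Fin.suc (Fin.suc a)) (punchIn j (punchIn j′ b))))))
  det-expand² M = trans (det-expand M) (altSum-cong (λ j →
    trans (*-congˡ (det-expand (λ a b → M (Fin.suc a) (punchIn j b)))) (*-distribˡ-altSum (M Fin.zero j) _)))

  det-equalTop : ∀ {n} (M : Fin (2 ℕ.+ n) → Fin (2 ℕ.+ n) → Carrier) →
    (∀ j → M Fin.zero j ≈ M (Fin.suc Fin.zero) j) → det M ≈ 0#
  det-equalTop {n} M e = trans (det-expand² M) (altSum²-orderFree (suc n)
    (orderFree-punchIn n (λ x y c → M Fin.zero x * (M (Fin.suc Fin.zero) y * det (λ a b →
        M (Fin.suc (Fin.suc a)) (c b))))
      (λ x y c → trans (x*yz≈y*xz _ _ _) (*-cong (sym (e y)) (*-congʳ (e x))))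
      (λ x y c≗ → *-congˡ (*-congˡ (det-cong (λ a b → reflexive (cong (M (Fin.suc (Fin.suc a))) (c≗ b))))))))

  -- The two double expansions add up to one double expansion whose term is symmetric in the two
  -- deleted columns, so it cancels as for equal rows.
  det-swapTop : ∀ {n} (M N : Fin (2 ℕ.+ n) → Fin (2 ℕ.+ n) → Carrier) →
    (∀ j → N Fin.zero j ≈ M (Fin.suc Fin.zero) j) → (∀ j → N (Fin.suc Fin.zero) j ≈ M Fin.zero j) →
    (∀ i j → N (Fin.suc (Fin.suc i)) j ≈ M (Fin.suc (Fin.suc i)) j) → det M + det N ≈ 0#
  det-swapTop {n} M N e₀ e₁ e₂ = begin
    det M + det N
      ≈⟨ +-cong (det-expand² M) (trans (det-expand² N) (altSum-cong λ j → altSum-cong λ j′ →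
           *-cong (e₀ _) (*-cong (e₁ _) (det-cong λ a b → e₂ a _)))) ⟩
    altSum (λ j → altSum (λ j′ → q j j′)) + altSum (λ j → altSum (λ j′ → q′ j j′))
      ≈⟨ sym (altSum-+ (λ j → altSum (q j)) (λ j → altSum (q′ j))) ⟩
    altSum (λ j → altSum (q j) + altSum (q′ j))
      ≈⟨ altSum-cong (λ j → sym (altSum-+ (q j) (q′ j))) ⟩
    altSum (λ j → altSum (λ j′ → q j j′ + q′ j j′))
      ≈⟨ altSum²-orderFree (suc n) (orderFree-punchIn n (λ x y c → M₀ x * (M₁ y * D c) + M₁ x * (M₀ y * D c))
           (λ x y c → trans (+-comm _ _) (+-cong (x*yz≈y*xz _ _ _) (x*yz≈y*xz _ _ _)))
           (λ x y c≗ → +-cong (*-congˡ (*-congˡ (D-cong c≗))) (*-congˡ (*-congˡ (D-cong c≗))))) ⟩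
    0# ∎
    where
    M₀ M₁ : Fin (2 ℕ.+ n) → Carrier
    M₀ = M Fin.zero
    M₁ = M (Fin.suc Fin.zero)
    D : (Fin n → Fin (2 ℕ.+ n)) → Carrier
    D c = det (λ a b → M (Fin.suc (Fin.suc a)) (c b))
    D-cong : ∀ {c c′} → (∀ i → c i ≡ c′ i) → D c ≈ D c′
    D-cong c≗ = det-cong (λ a b → reflexive (cong (M (Fin.suc (Fin.suc a))) (c≗ b)))
    q q′ : Fin (2 ℕ.+ n) → Fin (suc n) → Carrier
    q  j j′ = M₀ j * (M₁ (punchIn j j′) * D (λ b → punchIn j (punchIn j′ b)))
    q′ j j′ = M₁ j * (M₀ (punchIn j j′) * D (λ b → punchIn j (punchIn j′ b)))

  det-equalRows : ∀ {n} (p : Fin n) (M : Fin (suc n) → Fin (suc n) → Carrier) →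
    (∀ j → M (inject₁ p) j ≈ M (Fin.suc p) j) → det M ≈ 0#
  det-equalRows Fin.zero    M e = det-equalTop M e
  det-equalRows (Fin.suc p) M e = trans (det-expand M) (altSum-zero λ j →
    trans (*-congˡ (det-equalRows p (λ a b → M (Fin.suc a) (punchIn j b)) (λ b → e (punchIn j b)))) (zeroʳ _))

  det-swapRows : ∀ {n} (p : Fin n) (M N : Fin (suc n) → Fin (suc n) → Carrier) →
    (∀ j → N (inject₁ p) j ≈ M (Fin.suc p) j) → (∀ j → N (Fin.suc p) j ≈ M (inject₁ p) j) →
    (∀ i → i ≢ inject₁ p → i ≢ Fin.suc p → ∀ j → N i j ≈ M i j) → det M + det N ≈ 0#
  det-swapRows Fin.zero    M N e₀ e₁ e₂ = det-swapTop M N e₀ e₁ (λ i → e₂ _ (λ ()) (λ ()))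
  det-swapRows {suc n} (Fin.suc p) M N e₀ e₁ e₂ = begin
    det M + det N
      ≈⟨ +-cong (det-expand M) (det-expand N) ⟩
    altSum (λ j → M Fin.zero j * det (minor M j)) + altSum (λ j → N Fin.zero j * det (minor N j))
      ≈⟨ sym (altSum-+ (λ j → M Fin.zero j * det (minor M j)) (λ j → N Fin.zero j * det (minor N j))) ⟩
    altSum (λ j → M Fin.zero j * det (minor M j) + N Fin.zero j * det (minor N j))
      ≈⟨ altSum-zero (λ j → trans (+-congˡ (*-congʳ (e₂ Fin.zero (λ ()) (λ ()) j)))
           (trans (sym (distribˡ _ _ _)) (trans (*-congˡ (det-swapRows p (minor M j) (minor N j)
             (λ b → e₀ (punchIn j b)) (λ b → e₁ (punchIn j b))
             (λ i i≢ i≢′ b → e₂ (Fin.suc i) (λ eq → i≢ (suc-injective eq)) (λ eq → i≢′ (suc-injective eq))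
                 (punchIn j b))))
             (zeroʳ _)))) ⟩
    0# ∎
    where
    minor : (Fin (2 ℕ.+ n) → Fin (2 ℕ.+ n) → Carrier) → Fin (2 ℕ.+ n) → Fin (suc n) → Fin (suc n) → Carrier
    minor K j a b = K (Fin.suc a) (punchIn j b)

  det-zeroRow : ∀ {n} (p : Fin n) (M : Fin n → Fin n → Carrier) → (∀ j → M p j ≈ 0#) → det M ≈ 0#
  det-zeroRow Fin.zero    M e = trans (det-expand M) (altSum-zero (λ j → trans (*-congʳ (e j)) (zeroˡ _)))
  det-zeroRow (Fin.suc p) M e = trans (det-expand M) (altSum-zero (λ j →
    trans (*-congˡ (det-zeroRow p (λ a b → M (Fin.suc a) (punchIn j b)) (λ b → e (punchIn j b)))) (zeroʳ _)))

  -- Catalan functions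

  s-cong : ∀ {ℓ γ γ′} → AgreeUpTo ℓ γ γ′ → s ℓ γ ≈ s ℓ γ′
  s-cong e = det-cong (λ i j → reflexive (cong (λ g → hh (g ℤ.+ + toℕ j ℤ.- + toℕ i))
      (e (suc (toℕ i)) (s≤s z≤n) (toℕ<n i))))

  module _ {n} (P : Fin n) where
    private
      p : ℕ
      p = suc (toℕ P)

    s-dot : ∀ γ → s (suc n) γ + s (suc n) (dot p γ) ≈ 0#
    s-dot γ = det-swapRows P
      (λ i j → hh (γ (suc (toℕ i)) ℤ.+ + toℕ j ℤ.- + toℕ i))
      (λ i j → hh (dot p γ (suc (toℕ i)) ℤ.+ + toℕ j ℤ.- + toℕ i))
      (λ j → reflexive (cong hh (lower (+ toℕ j))))
      (λ j → reflexive (cong hh (upper (+ toℕ j))))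
      (λ i i≢P i≢P+1 j → reflexive (cong (λ g → hh (g ℤ.+ + toℕ j ℤ.- + toℕ i)) (dot-other γ
        (λ e → i≢P (toℕ-injective (≡.trans (ℕₚ.suc-injective e) (≡.sym (toℕ-inject₁ P)))))
        (λ e → i≢P+1 (toℕ-injective (ℕₚ.suc-injective e))))))
      where
      lower : ∀ j → dot p γ (suc (toℕ (inject₁ P))) ℤ.+ j ℤ.- + toℕ (inject₁ P) ≡ γ (suc p) ℤ.+ j ℤ.- + p
      lower j rewrite toℕ-inject₁ P | dot-lower p γ = lemma (γ (suc p)) j (+ toℕ P)
        where
        lemma : ∀ g j q → g ℤ.- + 1 ℤ.+ j ℤ.- q ≡ g ℤ.+ j ℤ.- (+ 1 ℤ.+ q)
        lemma = ℤ-Solver.solve-∀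
      upper : ∀ j → dot p γ (suc p) ℤ.+ j ℤ.- + p ≡ γ (suc (toℕ (inject₁ P))) ℤ.+ j ℤ.- + toℕ (inject₁ P)
      upper j rewrite toℕ-inject₁ P | dot-upper p γ = lemma (γ p) j (+ toℕ P)
        where
        lemma : ∀ g j q → g ℤ.+ + 1 ℤ.+ j ℤ.- (+ 1 ℤ.+ q) ≡ g ℤ.+ j ℤ.- q
        lemma = ℤ-Solver.solve-∀

    s-dotFixed : ∀ γ → dot p γ ≗ γ → s (suc n) γ ≈ 0#
    s-dotFixed γ fix = det-equalRows P (λ i j → hh (γ (suc (toℕ i)) ℤ.+ + toℕ j ℤ.- + toℕ i))
      (λ j → reflexive (cong hh (equal (+ toℕ j))))
      where
      equal : ∀ j → γ (suc (toℕ (inject₁ P))) ℤ.+ j ℤ.- + toℕ (inject₁ P) ≡ γ (suc p) ℤ.+ j ℤ.- + p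
      equal j rewrite toℕ-inject₁ P | ≡.sym (fix p) | dot-lower p γ = lemma (γ (suc p)) j (+ toℕ P)
        where
        lemma : ∀ g j q → g ℤ.- + 1 ℤ.+ j ℤ.- q ≡ g ℤ.+ j ℤ.- (+ 1 ℤ.+ q)
        lemma = ℤ-Solver.solve-∀

  -- The last row consists of h_d with d ≤ γ_ℓ < 0.
  s-negativeLast : ∀ n γ → γ (suc n) ℤ.< + 0 → s (suc n) γ ≈ 0#
  s-negativeLast n γ neg = det-zeroRow (Fin.fromℕ n)
    (λ i j → hh (γ (suc (toℕ i)) ℤ.+ + toℕ j ℤ.- + toℕ i)) (λ j → hh-neg (bound j))
    where
    hh-neg : ∀ {x} → x ℤ.< + 0 → hh x ≈ 0#
    hh-neg { -[1+ _ ]} _ = refl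
    hh-neg {+ _} (ℤ.+<+ ())
    bound : ∀ j → γ (suc (toℕ (Fin.fromℕ n))) ℤ.+ + toℕ j ℤ.- + toℕ (Fin.fromℕ n) ℤ.< + 0
    bound j rewrite toℕ-fromℕ n = subst (ℤ._< + 0) (lemma (γ (suc n)) (+ toℕ j) (+ n))
      (ℤₚ.+-mono-<-≤ neg (ℤₚ.i≤j⇒i-j≤0 (ℤ.+≤+ (ℕₚ.≤-pred (toℕ<n j)))))
      where
      lemma : ∀ g j n → g ℤ.+ (j ℤ.- n) ≡ g ℤ.+ j ℤ.- n
      lemma = ℤ-Solver.solve-∀

  -- Series in `t` and the expansion over roots

  t· : (ℕ → Carrier) → ℕ → Carrier
  t· f zero    = 0#
  t· f (suc m) = f m

  t·-cong : ∀ {f g} → (∀ m → f m ≈ g m) → ∀ m → t· f m ≈ t· g m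
  t·-cong e zero    = refl
  t·-cong e (suc m) = e m

  t·-zero : ∀ {f} → (∀ m → f m ≈ 0#) → ∀ m → t· f m ≈ 0#
  t·-zero e zero    = refl
  t·-zero e (suc m) = e m

  sumTo-cong : ∀ m {f g} → (∀ i → f i ≈ g i) → sumTo m f ≈ sumTo m g
  sumTo-cong zero    e = e 0
  sumTo-cong (suc m) e = +-cong (sumTo-cong m e) (e (suc m))

  sumTo-zero : ∀ m {f} → (∀ i → f i ≈ 0#) → sumTo m f ≈ 0#
  sumTo-zero zero    e = e 0
  sumTo-zero (suc m) e = trans (+-cong (sumTo-zero m e) (e (suc m))) (+-identityˡ 0#)

  sumTo-suc : ∀ m f → sumTo (suc m) f ≈ f 0 + sumTo m (f ∘ suc)
  sumTo-suc zero    f = refl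
  sumTo-suc (suc m) f = trans (+-congʳ (sumTo-suc m f)) (+-assoc _ _ _)

  Hcoef-cong : ∀ {ℓ γ γ′} Ψ → AgreeUpTo ℓ γ γ′ → ∀ m → Hcoef ℓ Ψ γ m ≈ Hcoef ℓ Ψ γ′ m
  Hcoef-cong []            e zero    = s-cong e
  Hcoef-cong []            e (suc m) = refl
  Hcoef-cong ((i , j) ∷ Ψ) e m = sumTo-cong m (λ a → Hcoef-cong Ψ
    (λ n 1≤n n≤ℓ → cong (λ x → x ℤ.+ bump i a n ℤ.- bump j a n) (e n 1≤n n≤ℓ)) (m ∸ a))

  Hcoef-≗ : ∀ {ℓ γ γ′} Ψ → γ ≗ γ′ → ∀ m → Hcoef ℓ Ψ γ m ≈ Hcoef ℓ Ψ γ′ m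
  Hcoef-≗ Ψ e = Hcoef-cong Ψ (λ n _ _ → e n)

  -- The geometric series 1/(1-x) = 1 + x/(1-x) for x = t z_i/z_j; the recursion behind every
  -- exchange of roots.
  Hcoef-∷ : ∀ ℓ α Ψ γ m → Hcoef ℓ (α ∷ Ψ) γ m ≈ Hcoef ℓ Ψ γ m + t· (Hcoef ℓ (α ∷ Ψ) (γ ⊕ α)) m
  Hcoef-∷ ℓ (i , j) Ψ γ zero    = trans (Hcoef-≗ Ψ (addRoot-zero γ i j) 0) (sym (+-identityʳ _))
  Hcoef-∷ ℓ (i , j) Ψ γ (suc m) = trans (sumTo-suc m _) (+-cong
    (Hcoef-≗ Ψ (addRoot-zero γ i j) (suc m))
    (sumTo-cong m (λ a → Hcoef-≗ Ψ (addRoot-suc γ i j a) (m ∸ a))))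

  -- After unfolding both roots, the two orders differ only in terms with a factor t. These are
  -- coefficients of lower degree at other weights, so induction on m over all weights applies.
  Hcoef-swap : ∀ ℓ α β Ψ m γ → Hcoef ℓ (α ∷ β ∷ Ψ) γ m ≈ Hcoef ℓ (β ∷ α ∷ Ψ) γ m
  Hcoef-swap ℓ α β Ψ m γ = begin
    Hcoef ℓ (α ∷ β ∷ Ψ) γ m
      ≈⟨ trans (Hcoef-∷ ℓ α (β ∷ Ψ) γ m) (+-congʳ (Hcoef-∷ ℓ β Ψ γ m)) ⟩
    (Hcoef ℓ Ψ γ m + t· (Hcoef ℓ (β ∷ Ψ) (γ ⊕ β)) m) + t· (Hcoef ℓ (α ∷ β ∷ Ψ) (γ ⊕ α)) m
      ≈⟨ trans (+-assoc _ _ _) (+-congˡ (tails m)) ⟩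
    Hcoef ℓ Ψ γ m + (t· (Hcoef ℓ (α ∷ Ψ) (γ ⊕ α)) m + t· (Hcoef ℓ (β ∷ α ∷ Ψ) (γ ⊕ β)) m)
      ≈⟨ sym (trans (trans (Hcoef-∷ ℓ β (α ∷ Ψ) γ m) (+-congʳ (Hcoef-∷ ℓ α Ψ γ m))) (+-assoc _ _ _)) ⟩
    Hcoef ℓ (β ∷ α ∷ Ψ) γ m ∎
    where
    deep : ∀ m → t· (Hcoef ℓ (α ∷ β ∷ Ψ) (γ ⊕ β ⊕ α)) m ≈ t· (Hcoef ℓ (β ∷ α ∷ Ψ) (γ ⊕ α ⊕ β)) m
    deep zero    = refl
    deep (suc m) = trans (Hcoef-swap ℓ α β Ψ m (γ ⊕ β ⊕ α)) (Hcoef-≗ (β ∷ α ∷ Ψ) (⊕-comm γ β α) m)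

    tails : ∀ m → t· (Hcoef ℓ (β ∷ Ψ) (γ ⊕ β)) m + t· (Hcoef ℓ (α ∷ β ∷ Ψ) (γ ⊕ α)) m
          ≈ t· (Hcoef ℓ (α ∷ Ψ) (γ ⊕ α)) m + t· (Hcoef ℓ (β ∷ α ∷ Ψ) (γ ⊕ β)) m
    tails zero    = refl
    tails (suc m) = begin
      Hcoef ℓ (β ∷ Ψ) (γ ⊕ β) m + Hcoef ℓ (α ∷ β ∷ Ψ) (γ ⊕ α) m
        ≈⟨ +-congˡ (trans (Hcoef-swap ℓ α β Ψ m (γ ⊕ α)) (Hcoef-∷ ℓ β (α ∷ Ψ) (γ ⊕ α) m)) ⟩
      Hcoef ℓ (β ∷ Ψ) (γ ⊕ β) m + (Hcoef ℓ (α ∷ Ψ) (γ ⊕ α) m + t· (Hcoef ℓ (β ∷ α ∷ Ψ) (γ ⊕ α ⊕ β)) m)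
        ≈⟨ x∙yz≈y∙xz _ _ _ ⟩
      Hcoef ℓ (α ∷ Ψ) (γ ⊕ α) m + (Hcoef ℓ (β ∷ Ψ) (γ ⊕ β) m + t· (Hcoef ℓ (β ∷ α ∷ Ψ) (γ ⊕ α ⊕ β)) m)
        ≈⟨ +-congˡ (+-congˡ (sym (deep m))) ⟩
      Hcoef ℓ (α ∷ Ψ) (γ ⊕ α) m + (Hcoef ℓ (β ∷ Ψ) (γ ⊕ β) m + t· (Hcoef ℓ (α ∷ β ∷ Ψ) (γ ⊕ β ⊕ α)) m)
        ≈⟨ +-congˡ (sym (Hcoef-∷ ℓ α (β ∷ Ψ) (γ ⊕ β) m)) ⟩
      Hcoef ℓ (α ∷ Ψ) (γ ⊕ α) m + Hcoef ℓ (α ∷ β ∷ Ψ) (γ ⊕ β) m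
        ≈⟨ +-congˡ (Hcoef-swap ℓ α β Ψ m (γ ⊕ β)) ⟩
      Hcoef ℓ (α ∷ Ψ) (γ ⊕ α) m + Hcoef ℓ (β ∷ α ∷ Ψ) (γ ⊕ β) m ∎

  Hcoef-prep : ∀ ℓ α Ψ Φ → (∀ γ m → Hcoef ℓ Ψ γ m ≈ Hcoef ℓ Φ γ m) →
    ∀ γ m → Hcoef ℓ (α ∷ Ψ) γ m ≈ Hcoef ℓ (α ∷ Φ) γ m
  Hcoef-prep ℓ (i , j) Ψ Φ e γ m = sumTo-cong m (λ a → e (addRoot γ i j a) (m ∸ a))

  Hcoef-↭ : ∀ {ℓ Ψ Φ} → Ψ ↭ Φ → ∀ γ m → Hcoef ℓ Ψ γ m ≈ Hcoef ℓ Φ γ m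
  Hcoef-↭ ↭.refl        γ m = refl
  Hcoef-↭ {ℓ} (↭.prep {xs = Ψ} {ys = Φ} α π) γ m = Hcoef-prep ℓ α Ψ Φ (Hcoef-↭ π) γ m
  Hcoef-↭ {ℓ} (↭.swap {xs = Ψ} {ys = Φ} α β π) γ m = trans (Hcoef-swap ℓ α β Ψ m γ)
    (Hcoef-prep ℓ β (α ∷ Ψ) (α ∷ Φ) (Hcoef-prep ℓ α Ψ Φ (Hcoef-↭ π)) γ m)
  Hcoef-↭ (↭.trans π ρ) γ m = trans (Hcoef-↭ π γ m) (Hcoef-↭ ρ γ m)

  -- `vanishing` follows from `antisymmetric` only if 2 can be cancelled in the ring, so both go
  -- through the induction.
  record Alternating (ℓ p : ℕ) (Ψ : List Root) : Set b where
    field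
      antisymmetric : ∀ γ m → Hcoef ℓ Ψ γ m + Hcoef ℓ Ψ (dot p γ) m ≈ 0#
      vanishing     : ∀ γ → dot p γ ≗ γ → ∀ m → Hcoef ℓ Ψ γ m ≈ 0#
  open Alternating

  Alternating-↭ : ∀ {ℓ p Ψ Φ} → Ψ ↭ Φ → Alternating ℓ p Ψ → Alternating ℓ p Φ
  Alternating-↭ π alt .antisymmetric γ m =
    trans (sym (+-cong (Hcoef-↭ π γ m) (Hcoef-↭ π _ m))) (alt .antisymmetric γ m)
  Alternating-↭ π alt .vanishing γ fix m = trans (sym (Hcoef-↭ π γ m)) (alt .vanishing γ fix m)

  Alternating-[] : ∀ {ℓ p} → 1 ≤ p → p ℕ.< ℓ → Alternating ℓ p []
  Alternating-[] {suc n} {suc p} _ (s≤s p<n) = subst (λ p → Alternating (suc n) (suc p) []) (toℕ-fromℕ< p<n) alt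
    where
    alt : Alternating (suc n) (suc (toℕ (fromℕ< p<n))) []
    alt .antisymmetric γ zero    = s-dot (fromℕ< p<n) γ
    alt .antisymmetric γ (suc m) = +-identityˡ 0#
    alt .vanishing γ fix zero    = s-dotFixed (fromℕ< p<n) γ fix
    alt .vanishing γ fix (suc m) = refl

  Alternating-fixedRoot : ∀ {ℓ p Ψ} α → swapRoot p α ≡ α → Alternating ℓ p Ψ → Alternating ℓ p (α ∷ Ψ)
  Alternating-fixedRoot {ℓ} {p} {Ψ} α σα≡α alt = record { antisymmetric = λ γ m → anti m γ ; vanishing =
      λ γ fix m → van m γ fix }
    where
    dot-⊕α : ∀ γ → dot p (γ ⊕ α) ≗ dot p γ ⊕ α
    dot-⊕α γ = subst (λ β → dot p (γ ⊕ α) ≗ dot p γ ⊕ β) σα≡α (dot-⊕ p γ α)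

    anti : ∀ m γ → Hcoef ℓ (α ∷ Ψ) γ m + Hcoef ℓ (α ∷ Ψ) (dot p γ) m ≈ 0#
    anti m γ = begin
      Hcoef ℓ (α ∷ Ψ) γ m + Hcoef ℓ (α ∷ Ψ) (dot p γ) m
        ≈⟨ +-cong (Hcoef-∷ ℓ α Ψ γ m) (Hcoef-∷ ℓ α Ψ (dot p γ) m) ⟩
      (Hcoef ℓ Ψ γ m + t· (Hcoef ℓ (α ∷ Ψ) (γ ⊕ α)) m) + (Hcoef ℓ Ψ (dot p γ) m + t·
          (Hcoef ℓ (α ∷ Ψ) (dot p γ ⊕ α)) m)
        ≈⟨ interchange _ _ _ _ ⟩
      (Hcoef ℓ Ψ γ m + Hcoef ℓ Ψ (dot p γ) m) + (t· (Hcoef ℓ (α ∷ Ψ) (γ ⊕ α)) m + t·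
          (Hcoef ℓ (α ∷ Ψ) (dot p γ ⊕ α)) m)
        ≈⟨ +-cong (alt .antisymmetric γ m) (tail m) ⟩
      0# + 0#  ≈⟨ +-identityˡ 0# ⟩
      0#       ∎
      where
      tail : ∀ m → t· (Hcoef ℓ (α ∷ Ψ) (γ ⊕ α)) m + t· (Hcoef ℓ (α ∷ Ψ) (dot p γ ⊕ α)) m ≈ 0#
      tail zero    = +-identityˡ 0#
      tail (suc m) = trans (+-congˡ (sym (Hcoef-≗ (α ∷ Ψ) (dot-⊕α γ) m))) (anti m (γ ⊕ α))

    van : ∀ m γ → dot p γ ≗ γ → Hcoef ℓ (α ∷ Ψ) γ m ≈ 0#
    van m γ fix = trans (Hcoef-∷ ℓ α Ψ γ m) (trans (+-cong (alt .vanishing γ fix m) (tail m)) (+-identityˡ 0#))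
      where
      tail : ∀ m → t· (Hcoef ℓ (α ∷ Ψ) (γ ⊕ α)) m ≈ 0#
      tail zero    = refl
      tail (suc m) = van m (γ ⊕ α) (λ n → ≡.trans (dot-⊕α γ n) (⊕-congAt {dot p γ} {γ} α {n} (fix n)))

  -- (1 - tα)(1 - tβ) = 1 - tα - tβ + t²αβ, with the negative terms moved across.
  Hcoef-∷∷ : ∀ ℓ α β Ψ γ m →
    Hcoef ℓ (α ∷ β ∷ Ψ) γ m + t· (t· (Hcoef ℓ (α ∷ β ∷ Ψ) (γ ⊕ α ⊕ β))) m
    ≈ Hcoef ℓ Ψ γ m + (t· (Hcoef ℓ (α ∷ β ∷ Ψ) (γ ⊕ α)) m + t· (Hcoef ℓ (α ∷ β ∷ Ψ) (γ ⊕ β)) m)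
  Hcoef-∷∷ ℓ α β Ψ γ zero = trans (+-congʳ (trans (Hcoef-∷ ℓ α (β ∷ Ψ) γ 0) (+-congʳ (Hcoef-∷ ℓ β Ψ γ 0))))
    (trans (+-identityʳ _) (trans (+-identityʳ _) (+-congˡ (sym (+-identityˡ 0#)))))
  Hcoef-∷∷ ℓ α β Ψ γ (suc m) = begin
    P γ (suc m) + t· (P (γ ⊕ α ⊕ β)) m
      ≈⟨ +-congʳ (trans (Hcoef-∷ ℓ α (β ∷ Ψ) γ (suc m)) (+-congʳ (Hcoef-∷ ℓ β Ψ γ (suc m)))) ⟩
    ((Hcoef ℓ Ψ γ (suc m) + Q m) + P (γ ⊕ α) m) + t· (P (γ ⊕ α ⊕ β)) m
      ≈⟨ +-congʳ (trans (xy∙z≈xz∙y _ _ _) (+-assoc _ _ _)) ⟩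
    (Hcoef ℓ Ψ γ (suc m) + (P (γ ⊕ α) m + Q m)) + t· (P (γ ⊕ α ⊕ β)) m
      ≈⟨ trans (+-assoc _ _ _) (+-congˡ (+-assoc _ _ _)) ⟩
    Hcoef ℓ Ψ γ (suc m) + (P (γ ⊕ α) m + (Q m + t· (P (γ ⊕ α ⊕ β)) m))
      ≈⟨ +-congˡ (+-congˡ (+-congˡ (t·-cong (Hcoef-≗ (α ∷ β ∷ Ψ) (⊕-comm γ α β)) m))) ⟩
    Hcoef ℓ Ψ γ (suc m) + (P (γ ⊕ α) m + (Q m + t· (P (γ ⊕ β ⊕ α)) m))
      ≈⟨ +-congˡ (+-congˡ (sym (Hcoef-∷ ℓ α (β ∷ Ψ) (γ ⊕ β) m))) ⟩
    Hcoef ℓ Ψ γ (suc m) + (P (γ ⊕ α) m + P (γ ⊕ β) m) ∎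
    where
    P : (ℕ → ℤ) → ℕ → Carrier
    P = Hcoef ℓ (α ∷ β ∷ Ψ)
    Q : ℕ → Carrier
    Q = Hcoef ℓ (β ∷ Ψ) (γ ⊕ β)

  -- The reflection exchanges the two factors, so only their product can be handled. At a fixed
  -- weight the terms shifted by α and by its image are reflections of each other and cancel by
  -- antisymmetry in lower degree; the t² term is again at a fixed weight.
  Alternating-rootPair : ∀ {ℓ p Ψ} α → Alternating ℓ p Ψ → Alternating ℓ p (α ∷ swapRoot p α ∷ Ψ)
  Alternating-rootPair {ℓ} {p} {Ψ} α alt = record { antisymmetric = λ γ m → anti m γ ; vanishing = λ γ fix m →
      van m γ fix }
    where
    β : Root
    β = swapRoot p α
    P : (ℕ → ℤ) → ℕ → Carrier
    P = Hcoef ℓ (α ∷ β ∷ Ψ)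

    dot-⊕α : ∀ γ → dot p (γ ⊕ α) ≗ dot p γ ⊕ β
    dot-⊕α γ = dot-⊕ p γ α

    dot-⊕β : ∀ γ → dot p (γ ⊕ β) ≗ dot p γ ⊕ α
    dot-⊕β γ = subst (λ δ → dot p (γ ⊕ β) ≗ dot p γ ⊕ δ) (swapRoot-involutive p α) (dot-⊕ p γ β)

    dot-⊕α⊕β : ∀ γ → dot p (γ ⊕ α ⊕ β) ≗ dot p γ ⊕ α ⊕ β
    dot-⊕α⊕β γ n = ≡.trans (dot-⊕β (γ ⊕ α) n)
      (≡.trans (⊕-congAt {dot p (γ ⊕ α)} {dot p γ ⊕ β} α {n} (dot-⊕α γ n)) (⊕-comm (dot p γ) β α n))

    t·t·P : ∀ {γ m} → (∀ m′ → m ≡ 2 ℕ.+ m′ → P γ m′ ≈ 0#) → t· (t· (P γ)) m ≈ 0#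
    t·t·P {m = zero}        e = refl
    t·t·P {m = suc zero}    e = refl
    t·t·P {m = suc (suc m)} e = e m ≡.refl

    anti : ∀ m γ → P γ m + P (dot p γ) m ≈ 0#
    anti m γ = begin
      P γ m + P γ′ m
        ≈⟨ sym (trans (+-congˡ (deep m)) (+-identityʳ _)) ⟩
      (P γ m + P γ′ m) + (t· (t· (P (γ ⊕ α ⊕ β))) m + t· (t· (P (γ′ ⊕ α ⊕ β))) m)
        ≈⟨ trans (interchange _ _ _ _) (+-cong (Hcoef-∷∷ ℓ α β Ψ γ m) (Hcoef-∷∷ ℓ α β Ψ γ′ m)) ⟩
      (Hcoef ℓ Ψ γ m + (t· (P (γ ⊕ α)) m + t· (P (γ ⊕ β)) m)) +
          (Hcoef ℓ Ψ γ′ m + (t· (P (γ′ ⊕ α)) m + t· (P (γ′ ⊕ β)) m))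
        ≈⟨ trans (interchange _ _ _ _) (+-cong (alt .antisymmetric γ m) (trans (+-congˡ (+-comm _ _))
            (interchange _ _ _ _))) ⟩
      0# + ((t· (P (γ ⊕ α)) m + t· (P (γ′ ⊕ β)) m) + (t· (P (γ ⊕ β)) m + t· (P (γ′ ⊕ α)) m))
        ≈⟨ trans (+-identityˡ _) (trans (+-cong (tail α β dot-⊕α m) (tail β α dot-⊕β m)) (+-identityˡ 0#)) ⟩
      0# ∎
      where
      γ′ : ℕ → ℤ
      γ′ = dot p γ
      tail : ∀ α′ β′ → (∀ γ → dot p (γ ⊕ α′) ≗ dot p γ ⊕ β′) → ∀ m → t· (P (γ ⊕ α′)) m + t· (P (γ′ ⊕ β′)) m ≈ 0#
      tail α′ β′ e zero    = +-identityˡ 0#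
      tail α′ β′ e (suc m) = trans (+-congˡ (sym (Hcoef-≗ (α ∷ β ∷ Ψ) (e γ) m))) (anti m (γ ⊕ α′))
      deep : ∀ m → t· (t· (P (γ ⊕ α ⊕ β))) m + t· (t· (P (γ′ ⊕ α ⊕ β))) m ≈ 0#
      deep zero          = +-identityˡ 0#
      deep (suc zero)    = +-identityˡ 0#
      deep (suc (suc m)) = trans (+-congˡ (sym (Hcoef-≗ (α ∷ β ∷ Ψ) (dot-⊕α⊕β γ) m))) (anti m (γ ⊕ α ⊕ β))

    van : ∀ m γ → dot p γ ≗ γ → P γ m ≈ 0#
    van m γ fix = begin
      P γ m
        ≈⟨ sym (trans (+-congˡ (deep m)) (+-identityʳ _)) ⟩
      P γ m + t· (t· (P (γ ⊕ α ⊕ β))) m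
        ≈⟨ Hcoef-∷∷ ℓ α β Ψ γ m ⟩
      Hcoef ℓ Ψ γ m + (t· (P (γ ⊕ α)) m + t· (P (γ ⊕ β)) m)
        ≈⟨ trans (+-cong (alt .vanishing γ fix m) (tail m)) (+-identityˡ 0#) ⟩
      0# ∎
      where
      tail : ∀ m → t· (P (γ ⊕ α)) m + t· (P (γ ⊕ β)) m ≈ 0#
      tail zero    = +-identityˡ 0#
      tail (suc m) = trans (+-congˡ (Hcoef-≗ (α ∷ β ∷ Ψ)
        (λ n → ≡.trans (≡.sym (⊕-congAt {dot p γ} {γ} β {n} (fix n))) (≡.sym (dot-⊕α γ n))) m)) (anti m (γ ⊕ α))
      deep : ∀ m → t· (t· (P (γ ⊕ α ⊕ β))) m ≈ 0#
      deep zero          = refl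
      deep (suc zero)    = refl
      deep (suc (suc m)) = van m (γ ⊕ α ⊕ β) (λ n → ≡.trans (dot-⊕α⊕β γ n)
        (⊕-congAt {dot p γ ⊕ α} {γ ⊕ α} β {n} (⊕-congAt {dot p γ} {γ} α {n} (fix n))))

  -- An invariant list splits into fixed roots and two-element orbits, which are removed one at a
  -- time. The length bound N drives the recursion, since the partner of the head is taken out of
  -- the middle of the tail.
  alternating : ∀ {ℓ p} → 1 ≤ p → p ℕ.< ℓ → ∀ Ψ → map (swapRoot p) Ψ ↭ Ψ → Alternating ℓ p Ψ
  alternating {ℓ} {p} 1≤p p<ℓ Ψ π = go (length Ψ) Ψ ℕₚ.≤-refl π
    where
    σ : Root → Root
    σ = swapRoot p
    go : ∀ N Ψ → length Ψ ≤ N → map σ Ψ ↭ Ψ → Alternating ℓ p Ψ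
    go N       []       _         π = Alternating-[] 1≤p p<ℓ
    go (suc N) (α ∷ Ψ) (s≤s len) π with ×-≡-dec ℕ._≟_ ℕ._≟_ (σ α) α
    ... | yes σα≡α = Alternating-fixedRoot α σα≡α
      (go N Ψ len (drop-∷ (subst (λ β → β ∷ map σ Ψ ↭ α ∷ Ψ) σα≡α π)))
    ... | no σα≢α with ∈-resp-↭ π (here ≡.refl)
    ...   | here e = contradiction e σα≢α
    ...   | there σα∈Ψ with ∈-∃++ σα∈Ψ
    ...     | xs , ys , ≡.refl = Alternating-↭ (↭-sym rearrange) (Alternating-rootPair α (go N Φ len′ π′))
      where
      Φ : List Root
      Φ = xs ++ ys
      rearrange : α ∷ xs ++ σ α ∷ ys ↭ α ∷ σ α ∷ Φ
      rearrange = ↭.prep α (shift (σ α) xs ys)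
      len′ : length Φ ≤ N
      len′ = ℕₚ.≤-trans (ℕₚ.n≤1+n _) (subst (ℕ._≤ N) (↭-length (shift (σ α) xs ys)) len)
      π′ : map σ Φ ↭ Φ
      π′ = drop-∷ (drop-∷ (↭-trans (↭.swap α (σ α) ↭-refl)
        (subst (λ β → σ α ∷ β ∷ map σ Φ ↭ α ∷ σ α ∷ Φ) (swapRoot-involutive p α)
          (↭-trans (↭-sym (↭-map⁺ σ rearrange)) (↭-trans π rearrange)))))

  Hcoef-toggle : ∀ {ℓ p} → 1 ≤ p → p ℕ.< ℓ → ∀ Ψ → map (swapRoot p) Ψ ↭ Ψ →
    ∀ γ → γ (suc p) ≡ γ p ℤ.+ + 1 → ∀ m → Hcoef ℓ Ψ γ m ≈ 0#
  Hcoef-toggle 1≤p p<ℓ Ψ π γ e = alternating 1≤p p<ℓ Ψ π .vanishing γ (dot-fixed e)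

  -- The factor of (i, j) raises only entry i, and i is never the last row; the last entry can only
  -- go down.
  Hcoef-negativeLast : ∀ n Ψ → All (λ α → proj₁ α ≢ suc n) Ψ → ∀ γ → γ (suc n) ℤ.< + 0 → ∀ m →
      Hcoef (suc n) Ψ γ m ≈ 0#
  Hcoef-negativeLast n []            []         γ neg zero    = s-negativeLast n γ neg
  Hcoef-negativeLast n []            []         γ neg (suc m) = refl
  Hcoef-negativeLast n ((i , j) ∷ Ψ) (i≢ ∷ ne) γ neg m = sumTo-zero m (λ a →
    Hcoef-negativeLast n Ψ ne (addRoot γ i j a) (ℤₚ.≤-<-trans (bound a) neg) (m ∸ a))
    where
    bound : ∀ a → addRoot γ i j a (suc n) ℤ.≤ γ (suc n)
    bound a rewrite bump-off a (λ e → i≢ (≡.sym e)) | ℤₚ.+-identityʳ (γ (suc n)) with suc n == j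
    ... | true  = ℤₚ.i-j≤i (γ (suc n)) (+ a)
    ... | false = ℤₚ.≤-reflexive (ℤₚ.+-identityʳ _)

  t^ : ℕ → (ℕ → Carrier) → ℕ → Carrier
  t^ zero    f = f
  t^ (suc n) f = t· (t^ n f)

  t^-cong : ∀ n {f g} → (∀ m → f m ≈ g m) → ∀ m → t^ n f m ≈ t^ n g m
  t^-cong zero    e = e
  t^-cong (suc n) e = t·-cong (t^-cong n e)

  -- Bouncing

  module _ (ℓ : ℕ) where
    H : (ℕ → ℕ) → (ℕ → ℤ) → ℕ → Carrier
    H r = Hcoef ℓ (ideal ℓ r)

    H-lowersRow : ∀ {i j r r′} → IsPosRoot ℓ (i , j) → LowersRow i j r r′ →
      ∀ γ m → H r′ γ m ≈ H r γ m + t· (H r′ (γ ⊕ (i , j))) m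
    H-lowersRow {i} {j} {r} {r′} pos low γ m = begin
      H r′ γ m
        ≈⟨ sym (Hcoef-↭ π γ m) ⟩
      Hcoef ℓ ((i , j) ∷ ideal ℓ r) γ m
        ≈⟨ Hcoef-∷ ℓ (i , j) (ideal ℓ r) γ m ⟩
      H r γ m + t· (Hcoef ℓ ((i , j) ∷ ideal ℓ r) (γ ⊕ (i , j))) m
        ≈⟨ +-congˡ (t·-cong (Hcoef-↭ π (γ ⊕ (i , j))) m) ⟩
      H r γ m + t· (H r′ (γ ⊕ (i , j))) m ∎
      where
      π : (i , j) ∷ ideal ℓ r ↭ ideal ℓ r′
      π = ideal-lowersRow pos low

    H-lower-first : ∀ {i j r r′} → IsPosRoot ℓ (i , j) → LowersRow i j r r′ → ∀ γ →
      (∀ m → H r γ m ≈ 0#) → ∀ m → H r′ γ m ≈ t· (H r′ (γ ⊕ (i , j))) m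
    H-lower-first pos low γ e m = trans (H-lowersRow pos low γ m) (trans (+-congʳ (e m)) (+-identityˡ _))

    H-lower-second : ∀ {i j r r′} → IsPosRoot ℓ (i , j) → LowersRow i j r r′ → ∀ γ →
      (∀ m → H r′ (γ ⊕ (i , j)) m ≈ 0#) → ∀ m → H r′ γ m ≈ H r γ m
    H-lower-second pos low γ e m =
      trans (H-lowersRow pos low γ m) (trans (+-congˡ (t·-zero e m)) (+-identityʳ _))

    H-toggle : ∀ {p r γ} → 1 ≤ p → p ℕ.< ℓ → r p ≡ r (suc p) → 2 ℕ.+ p ≤ r p →
      (∀ i → 1 ≤ i → i ℕ.< p → r i ≢ suc p) → γ (suc p) ≡ γ p ℤ.+ + 1 → ∀ m → H r γ m ≈ 0#
    H-toggle {p} {r} {γ} 1≤p p<ℓ flat far ceil =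
      Hcoef-toggle 1≤p p<ℓ (ideal ℓ r) (ideal-swapRoot {ℓ} {p} {r} 1≤p p<ℓ flat far ceil) γ

    -- Adding the root (x+1, q) costs nothing, since the correction term is killed by a toggle in rows
    -- x, x+1; it moves the ceiling from columns x, x+1 to columns q, q+1.
    H-mirror : ∀ {r γ Z n x} → 1 ≤ x → Z ℕ.< ℓ → BouncePath r γ Z n x →
      (∀ i → 1 ≤ i → i ℕ.< x → r i ≢ suc x) → ∀ m → H r γ m ≈ 0#
    H-mirror 1≤x Z<ℓ (wall e far step) ceil = H-toggle 1≤x Z<ℓ e far ceil step
    H-mirror {r} {γ} {Z} {x = x} 1≤x Z<ℓ (mirror {n = n} {q = q} rx rx+1 2+x≤q level below gap ch) ceil m = begin
      H r γ m   ≈⟨ sym (H-lower-second pos low γ toggled m) ⟩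
      H ν γ m   ≈⟨ H-mirror (ℕₚ.<⇒≤ (ℕₚ.≤-trans (s≤s 1≤x) x<q)) Z<ℓ ch′ ceil′ m ⟩
      0#        ∎
      where
      ν : ℕ → ℕ
      ν = upd r (suc x) q
      x<q : x ℕ.< q
      x<q = ℕₚ.<-trans (ℕₚ.n<1+n x) 2+x≤q
      q<ℓ : q ℕ.< ℓ
      q<ℓ = ℕₚ.≤-<-trans (path-≤ ch) Z<ℓ
      low : LowersRow (suc x) q r ν
      low = upd-lowersRow rx+1
      pos : IsPosRoot ℓ (suc x , q)
      pos = s≤s z≤n , 2+x≤q , ℕₚ.<⇒≤ q<ℓ
      νx : ν x ≡ q
      νx = ≡.trans (upd-off r q (ℕₚ.<⇒≢ (ℕₚ.n<1+n x))) rx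
      νx+1 : ν (suc x) ≡ q
      νx+1 = upd-at r (suc x) q
      toggled : ∀ m → H ν (γ ⊕ (suc x , q)) m ≈ 0#
      toggled = H-toggle 1≤x (ℕₚ.<-trans x<q q<ℓ) (≡.trans νx (≡.sym νx+1)) (subst (2 ℕ.+ x ℕ.≤_) (≡.sym νx) 2+x≤q)
        (λ i 1≤i i<x e → ceil i 1≤i i<x (≡.trans (≡.sym (upd-off r q (ℕₚ.<⇒≢ (ℕₚ.<-trans i<x (ℕₚ.n<1+n x))))) e))
        (≡.trans (⊕-lower γ (ℕₚ.<⇒≢ 2+x≤q)) (cong (ℤ._+ + 1) (≡.trans level
          (≡.sym (⊕-other γ (ℕₚ.<⇒≢ (ℕₚ.n<1+n x)) (ℕₚ.<⇒≢ x<q))))))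
      ch′ : BouncePath ν γ Z n q
      ch′ = path-cong (+ 0) (λ i q≤i → upd-off r q (ℕₚ.>⇒≢ (ℕₚ.≤-trans 2+x≤q q≤i))) above
        (≡.sym (ℤₚ.+-identityʳ _)) (≡.sym (ℤₚ.+-identityʳ _)) (λ _ _ _ → ≡.refl) ch
        where
        above : ∀ i → 1 ≤ i → i ℕ.< q → ν i ≤ 2 ℕ.+ q ⊎ ν i ≡ r i
        above i _ _ with i ℕ.≟ suc x
        ... | yes ≡.refl = inj₁ (ℕₚ.≤-trans (ℕₚ.≤-reflexive νx+1) (ℕₚ.m≤n+m q 2))
        ... | no i≢ = inj₂ (upd-off r q i≢)
      ceil′ : ∀ i → 1 ≤ i → i ℕ.< q → ν i ≢ suc q
      ceil′ i 1≤i i<q e with i ℕ.≟ suc x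
      ... | yes ≡.refl = ℕₚ.1+n≢n (≡.trans (≡.sym e) νx+1)
      ... | no i≢ with ℕₚ.<-cmp i x
      ...   | tri< i<x _ _ = below i 1≤i i<x (≡.trans (≡.sym (upd-off r q i≢)) e)
      ...   | tri≈ _ ≡.refl _ = ℕₚ.1+n≢n (≡.trans (≡.sym e) νx)
      ...   | tri> _ _ x<i = gap i (ℕₚ.≤∧≢⇒< x<i (i≢ ∘ ≡.sym)) i<q (≡.trans (≡.sym (upd-off r q i≢)) e)

    -- Removing the root (x+1, q+1) moves the ceiling to columns q, q+1.
    H-descend : ∀ {r γ Z n x Q} → 1 ≤ x → Z ℕ.< ℓ → Q ℕ.< x → BouncePath r γ Z n x →
      ∀ m → H r (γ ⊕ (Q , suc x)) m ≈ t^ n (H r (γ ⊕ (Q , suc Z))) m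
    H-descend 1≤x Z<ℓ Q<x (wall _ _ _) m = refl
    H-descend {r} {γ} {Z} {x = x} {Q} 1≤x Z<ℓ Q<x (mirror {n = n} {q = q} rx rx+1 2+x≤q level below gap ch) m
        = begin
      H r δ m
        ≈⟨ H-lower-first pos low δ (H-mirror 1≤q Z<ℓ ch′ ceil′) m ⟩
      t· (H r (δ ⊕ (suc x , suc q))) m
        ≈⟨ t·-cong (λ m → trans (Hcoef-≗ (ideal ℓ r) (⊕-trans γ Q (suc x) (suc q)) m)
             (H-descend 1≤q Z<ℓ (ℕₚ.<-trans Q<x x<q) ch m)) m ⟩
      t^ (suc n) (H r (γ ⊕ (Q , suc Z))) m ∎
      where
      δ : ℕ → ℤ
      δ = γ ⊕ (Q , suc x)
      ν : ℕ → ℕ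
      ν = upd r (suc x) (2 ℕ.+ q)
      x<q : x ℕ.< q
      x<q = ℕₚ.<-trans (ℕₚ.n<1+n x) 2+x≤q
      1≤q : 1 ≤ q
      1≤q = ℕₚ.<⇒≤ (ℕₚ.≤-trans (s≤s 1≤x) x<q)
      low : LowersRow (suc x) (suc q) ν r
      low = upd-raisesRow rx+1
      pos : IsPosRoot ℓ (suc x , suc q)
      pos = s≤s z≤n , s≤s x<q , ℕₚ.≤-<-trans (path-≤ ch) Z<ℓ
      νx+1 : ν (suc x) ≡ 2 ℕ.+ q
      νx+1 = upd-at r (suc x) _
      δ-same : ∀ i → q ≤ i → δ i ≡ γ i
      δ-same i q≤i = ⊕-other γ (ℕₚ.>⇒≢ (ℕₚ.<-trans Q<x (ℕₚ.<-≤-trans x<q q≤i))) (ℕₚ.>⇒≢ (ℕₚ.≤-trans 2+x≤q q≤i))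
      ch′ : BouncePath ν δ Z n q
      ch′ = path-cong (+ 0) (λ i q≤i → upd-off r _ (ℕₚ.>⇒≢ (ℕₚ.≤-trans 2+x≤q q≤i))) above
        (≡.trans (δ-same q ℕₚ.≤-refl) (≡.sym (ℤₚ.+-identityʳ _))) (≡.trans (δ-same (suc q) (ℕₚ.n≤1+n q))
            (≡.sym (ℤₚ.+-identityʳ _)))
        (λ i q<i _ → δ-same i (ℕₚ.≤-trans (ℕₚ.n≤1+n q) (ℕₚ.<⇒≤ q<i))) ch
        where
        above : ∀ i → 1 ≤ i → i ℕ.< q → ν i ≤ 2 ℕ.+ q ⊎ ν i ≡ r i
        above i _ _ with i ℕ.≟ suc x
        ... | yes ≡.refl = inj₁ (ℕₚ.≤-reflexive νx+1)
        ... | no i≢ = inj₂ (upd-off r _ i≢)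
      ceil′ : ∀ i → 1 ≤ i → i ℕ.< q → ν i ≢ suc q
      ceil′ i 1≤i i<q e with i ℕ.≟ suc x
      ... | yes ≡.refl = ℕₚ.1+n≢n (≡.trans (≡.sym νx+1) e)
      ... | no i≢ with ℕₚ.<-cmp i x
      ...   | tri< i<x _ _ = below i 1≤i i<x (≡.trans (≡.sym (upd-off r _ i≢)) e)
      ...   | tri≈ _ ≡.refl _ = ℕₚ.1+n≢n (≡.trans (≡.sym e) (≡.trans (upd-off r _ i≢) rx))
      ...   | tri> _ _ x<i = gap i (ℕₚ.≤∧≢⇒< x<i (i≢ ∘ ≡.sym)) i<q (≡.trans (≡.sym (upd-off r _ i≢)) e)

    -- Four moves. Without (Q, p+1) there is a ceiling at the top of the path, so that term dies and
    -- one factor t with γ + ε_Q - ε_{p+1} remains. Adding (Q, p) is free, as its correction has a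
    -- ceiling too. `H-descend` then yields t^n. Finally, removing the first root of row Z+1 is free
    -- for the same reason. The free moves make row Q start one column earlier and row Z+1 one
    -- later, as the new weight demands.
    H-bounce : ∀ {r γ Z n p Q} → Z ℕ.< ℓ → 1 ≤ Q → Q ℕ.< p → BouncePath r γ Z n p → r Q ≡ suc p →
      (∀ i → 1 ≤ i → i ℕ.< p → i ≢ Q → r i ≢ suc p) →
      ∀ m → H r γ m ≈ t^ (suc n) (H (upd (upd r Q p) (suc Z) (suc (r (suc Z)))) (γ ⊕ (Q , suc Z))) m
    H-bounce {r} {γ} {Z} {n} {p} {Q} Z<ℓ 1≤Q Q<p ch rQ uniq m = begin
      H r γ m
        ≈⟨ H-lower-first posQ low₁ γ (H-mirror 1≤p Z<ℓ ch₁ ceil₁) m ⟩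
      t· (H r γ₁) m
        ≈⟨ t·-cong (λ m → trans (sym (H-lower-second posQ′ low₂ γ₁ (H-mirror 1≤p Z<ℓ ch₂ ceil₂) m))
             (trans (H-descend 1≤p Z<ℓ Q<p ch₂′ m) (t^-cong n last m))) m ⟩
      t^ (suc n) (H r₃ δ) m ∎
      where
      γ₁ δ : ℕ → ℤ
      γ₁ = γ ⊕ (Q , suc p)
      δ  = γ ⊕ (Q , suc Z)
      w : ℕ
      w = r (suc Z)
      r₁ r₂ r₃ : ℕ → ℕ
      r₁ = upd r Q (2 ℕ.+ p)
      r₂ = upd r Q p
      r₃ = upd r₂ (suc Z) (suc w)
      1≤p : 1 ≤ p
      1≤p = ℕₚ.≤-trans 1≤Q (ℕₚ.<⇒≤ Q<p)
      p≤Z : p ≤ Z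
      p≤Z = path-≤ ch
      Q≢ : ∀ {i} → p ≤ i → i ≢ Q
      Q≢ p≤i = ℕₚ.>⇒≢ (ℕₚ.<-≤-trans Q<p p≤i)
      posQ : IsPosRoot ℓ (Q , suc p)
      posQ = 1≤Q , ℕₚ.<-trans Q<p (ℕₚ.n<1+n p) , ℕₚ.≤-<-trans p≤Z Z<ℓ
      posQ′ : IsPosRoot ℓ (Q , p)
      posQ′ = 1≤Q , Q<p , ℕₚ.<⇒≤ (ℕₚ.≤-<-trans p≤Z Z<ℓ)
      low₁ : LowersRow Q (suc p) r₁ r
      low₁ = upd-raisesRow rQ
      low₂ : LowersRow Q p r r₂
      low₂ = upd-lowersRow rQ

      upd-above : ∀ {v} → v ≤ 2 ℕ.+ p → ∀ i → 1 ≤ i → i ℕ.< p → upd r Q v i ≤ 2 ℕ.+ p ⊎ upd r Q v i ≡ r i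
      upd-above {v} v≤ i _ _ with i ℕ.≟ Q
      ... | yes ≡.refl = inj₁ (subst (ℕ._≤ 2 ℕ.+ p) (≡.sym (upd-at r Q v)) v≤)
      ... | no i≢ = inj₂ (upd-off r v i≢)

      upd-ceil : ∀ {v} → v ≢ suc p → ∀ i → 1 ≤ i → i ℕ.< p → upd r Q v i ≢ suc p
      upd-ceil {v} v≢ i 1≤i i<p e with i ℕ.≟ Q
      ... | yes ≡.refl = v≢ (≡.trans (≡.sym (upd-at r Q v)) e)
      ... | no i≢ = uniq i 1≤i i<p i≢ (≡.trans (≡.sym (upd-off r v i≢)) e)

      ceil₁ : ∀ i → 1 ≤ i → i ℕ.< p → r₁ i ≢ suc p
      ceil₁ = upd-ceil ℕₚ.1+n≢n
      ceil₂ : ∀ i → 1 ≤ i → i ℕ.< p → r₂ i ≢ suc p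
      ceil₂ = upd-ceil (ℕₚ.<⇒≢ (ℕₚ.n<1+n p))

      ch₁ : BouncePath r₁ γ Z n p
      ch₁ = path-cong (+ 0) (λ i p≤i → upd-off r _ (Q≢ p≤i)) (upd-above ℕₚ.≤-refl)
        (≡.sym (ℤₚ.+-identityʳ _)) (≡.sym (ℤₚ.+-identityʳ _)) (λ _ _ _ → ≡.refl) ch
      ch₂′ : BouncePath r₂ γ Z n p
      ch₂′ = path-cong (+ 0) (λ i p≤i → upd-off r _ (Q≢ p≤i)) (upd-above (ℕₚ.m≤n+m p 2))
        (≡.sym (ℤₚ.+-identityʳ _)) (≡.sym (ℤₚ.+-identityʳ _)) (λ _ _ _ → ≡.refl) ch
      ch₂ : BouncePath r₂ (γ₁ ⊕ (Q , p)) Z n p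
      -- The translation is by -1: `γ₁` has already lost 1 at p+1, and the root (Q, p) takes 1 away
      -- at p.
      ch₂ = path-cong (ℤ.- + 1) (λ _ _ → ≡.refl) (λ _ _ _ → inj₂ ≡.refl)
        (≡.trans (⊕-upper γ₁ (ℕₚ.<⇒≢ Q<p)) (cong (ℤ._- + 1) (⊕-other γ (Q≢ ℕₚ.≤-refl) (ℕₚ.<⇒≢ (ℕₚ.n<1+n p)))))
        (≡.trans (⊕-other γ₁ (Q≢ (ℕₚ.n≤1+n p)) ℕₚ.1+n≢n) (⊕-upper γ (ℕₚ.<⇒≢ (ℕₚ.<-trans Q<p (ℕₚ.n<1+n p)))))
        (λ i p+1<i _ → ≡.trans (⊕-other γ₁ (Q≢ (ℕₚ.<⇒≤ (ℕₚ.<-trans (ℕₚ.n<1+n p) p+1<i)))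
            (ℕₚ.>⇒≢ (ℕₚ.<-trans (ℕₚ.n<1+n p) p+1<i)))
          (⊕-other γ (Q≢ (ℕₚ.<⇒≤ (ℕₚ.<-trans (ℕₚ.n<1+n p) p+1<i))) (ℕₚ.>⇒≢ p+1<i))) ch₂′

      r₂Z+1 : r₂ (suc Z) ≡ w
      r₂Z+1 = upd-off r p (Q≢ (ℕₚ.≤-trans p≤Z (ℕₚ.n≤1+n Z)))
      Z+1<w : suc Z ℕ.< w
      Z+1<w = path-far ch

      last : ∀ m → H r₂ δ m ≈ H r₃ δ m
      last with w ℕ.≤? ℓ
      -- Row Z+1 has no roots at all here, so moving its start does not change the ideal.
      ... | no w≰ℓ = Hcoef-↭ (ideal-↭ {ℓ} {r₂} {r₃} to from) δ
        where
        to : ∀ {i j} → IsPosRoot ℓ (i , j) → r₂ i ≤ j → r₃ i ≤ j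
        to {i} {j} (_ , _ , j≤ℓ) r≤ with i ℕ.≟ suc Z
        ... | yes ≡.refl = contradiction (ℕₚ.≤-trans (subst (ℕ._≤ j) r₂Z+1 r≤) j≤ℓ) w≰ℓ
        ... | no i≢ = subst (ℕ._≤ j) (≡.sym (upd-off r₂ (suc w) i≢)) r≤
        from : ∀ {i j} → IsPosRoot ℓ (i , j) → r₃ i ≤ j → r₂ i ≤ j
        from {i} {j} (_ , _ , j≤ℓ) r≤ with i ℕ.≟ suc Z
        ... | yes ≡.refl = contradiction
              (ℕₚ.≤-trans (ℕₚ.<⇒≤ (subst (ℕ._≤ j) (upd-at r₂ (suc Z) (suc w)) r≤)) j≤ℓ) w≰ℓ
        ... | no i≢ = subst (ℕ._≤ j) (upd-off r₂ (suc w) i≢) r≤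
      -- The two shifts telescope to ε_Q - ε_w, which leaves the weight on the path alone because Q
      -- < p and w > Z+1.
      ... | yes w≤ℓ = H-lower-second (s≤s z≤n , Z+1<w , w≤ℓ) (upd-raisesRow r₂Z+1) δ
              (λ m → trans (Hcoef-≗ (ideal ℓ r₂) (⊕-trans γ Q (suc Z) w) m) (H-mirror 1≤p Z<ℓ ch₃ ceil₂ m))
        where
        same : ∀ i → p ≤ i → i ≤ suc Z → (γ ⊕ (Q , w)) i ≡ γ i
        same i p≤i i≤ = ⊕-other γ (Q≢ p≤i) (ℕₚ.<⇒≢ (ℕₚ.≤-<-trans i≤ Z+1<w))
        ch₃ : BouncePath r₂ (γ ⊕ (Q , w)) Z n p
        ch₃ = path-cong (+ 0) (λ _ _ → ≡.refl) (λ _ _ _ → inj₂ ≡.refl)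
          (≡.trans (same p ℕₚ.≤-refl (ℕₚ.≤-trans p≤Z (ℕₚ.n≤1+n Z))) (≡.sym (ℤₚ.+-identityʳ _)))
          (≡.trans (same (suc p) (ℕₚ.n≤1+n p) (s≤s p≤Z)) (≡.sym (ℤₚ.+-identityʳ _)))
          (λ i p+1<i i≤ → same i (ℕₚ.<⇒≤ (ℕₚ.<-trans (ℕₚ.n<1+n p) p+1<i)) i≤) ch₂′

  -- From rows and powers of `t` back to `kschur` and `tshift`

  t^-+ : ∀ n n′ f m → t^ n (t^ n′ f) m ≈ t^ (n ℕ.+ n′) f m
  t^-+ zero    n′ f m = refl
  t^-+ (suc n) n′ f m = t·-cong (t^-+ n n′ f) m

  t^-tshift : ∀ n f m → t^ n f m ≈ tshift n f m
  t^-tshift zero    f m       = refl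
  t^-tshift (suc n) f zero    = refl
  t^-tshift (suc n) f (suc m) = trans (t^-tshift n f m)
    (reflexive (cong (λ b → if b then f (m ∸ n) else 0#) (≡.sym (suc-≤ᵇ n m))))

  kschur-wt : ∀ {k ℓ r ν} → AgreeUpTo ℓ ν (wt k r) → ∀ m → kschur k ℓ ν m ≈ H ℓ r (wt k r) m
  kschur-wt {k} {ℓ} {r} {ν} agree m = trans (Hcoef-↭ (Δk-ideal {k} {ℓ} {r} {ν} agree) ν m)
      (Hcoef-cong (ideal ℓ r) agree m)

  kschur-negativeLast : ∀ {k ℓ ν} → 1 ≤ ℓ → ν ℓ ℤ.< + 0 → ∀ m → kschur k ℓ ν m ≈ 0#
  kschur-negativeLast {k} {suc n} {ν} _ neg = Hcoef-negativeLast n (Δk k (suc n) ν)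
    (All.tabulate λ { {i , j} α∈ ≡.refl → ℕₚ.<⇒≱ (proj₁ (proj₂ (proj₁ (∈-Δk⁻ {k} {suc n} {ν} α∈))))
        (proj₂ (proj₂ (proj₁ (∈-Δk⁻ {k} {suc n} {ν} α∈)))) }) ν neg

  -- Repeated bounces, and vanishing where they stop

  module _ (k ℓ : ℕ) (r : ℕ → ℕ) (z : ℕ)
    (r-mono : ∀ {i j} → 1 ≤ i → i ℕ.< j → j ≤ ℓ → r i ℕ.< r j)
    (r-big : ∀ {i} → 1 ≤ i → i ≤ ℓ → i ℕ.< r i)
    (1≤z : 1 ≤ z) (z≤ℓ : z ≤ ℓ) where
    open Lowered k ℓ r z r-mono r-big 1≤z z≤ℓ
    open Admissible

    Vanishes : (ℕ → ℕ) → Set b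
    Vanishes ρ = ∀ m → H ℓ ρ (wt k ρ) m ≈ 0#

    blocked-vanishes : ∀ {y t h} (y<t : y ℕ.< t) (S : Stage y t h) (lt : h ℕ.+ z ℕ.< ℓ) flat →
      Blocked y<t S lt flat → Vanishes (stageRows y t h)
    blocked-vanishes y<t S lt flat (n , x , 1≤x , path , ceil) = H-mirror ℓ 1≤x lt path ceil

    module _ {y t xs} (y<t : y ℕ.< t) (p : UpPath t xs z) (1+y<z : suc y ℕ.< z) (my : m (suc y) ≡ suc t) where

      -- Row y+1 starts in column t+1, so earlier rows start in column t at the latest; t itself is
      -- excluded because the path from z stops there.
      low : ∀ {i} → 1 ≤ i → i ≤ y → m i ℕ.< t
      low {i} 1≤i i≤y = ℕₚ.≤∧≢⇒< (ℕₚ.≤-pred (subst (m i ℕ.<_) my (m-mono 1≤i (s≤s i≤y) (ℕₚ.<⇒≤ 1+y<z))))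
        (top-maximal p i 1≤i (ℕₚ.≤-<-trans i≤y (ℕₚ.<-trans (ℕₚ.n<1+n y) 1+y<z)))

      module _ (lam : ℕ → ℤ) (lam≡ : AgreeUpTo ℓ (λ i → lam i ℤ.- ind z z i) (wt k m))
               (flat : suc z ≤ ℓ → r (suc z) ≡ suc (r z)) where

        -- Each unit of h is one bounce off `length xs` mirrors, and thus costs c =
        -- `suc (length xs)` factors of t.
        advance : ∀ h → Admissible y xs h → Stage y t h × AgreeUpTo ℓ (cover lam z y h) (wt k (stageRows y t h))
          × (∀ j → H ℓ m (wt k m) j ≈ t^ (h ℕ.* suc (length xs)) (H ℓ (stageRows y t h) (wt k (stageRows y t h))) j)
        advance zero    G = stage-zero low , (λ i 1≤i i≤ℓ → ≡.trans (cover-zero lam z y i) (lam≡ i 1≤i i≤ℓ)) ,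
            λ j → refl
        advance (suc h) G with advance h (admissible-pred G)
        ... | S , agree , shifted = result (climb y<t S h+z<ℓ flat′ 1≤z ℕₚ.≤-refl p (G′ .inner)
            (wall-at-end y<t S h+z<ℓ flat′))
          where
          G′ : Admissible y xs h
          G′ = admissible-pred G
          h+z<ℓ : h ℕ.+ z ℕ.< ℓ
          h+z<ℓ = G .fits
          flat′ : r (suc (h ℕ.+ z)) ≡ suc (r (h ℕ.+ z))
          flat′ = admissible-flat (flat (ℕₚ.≤-trans (s≤s (ℕₚ.m≤n+m z h)) h+z<ℓ)) G
          run : Run (suc y) h
          run = proj₂ (G .ends h ≡.refl)
          ρ : ℕ → ℕ
          ρ = stageRows y t h
          Q Z : ℕ
          Q = h ℕ.+ suc y
          Z = h ℕ.+ z
          ρQ : ρ Q ≡ suc (h ℕ.+ t)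
          ρQ = top-row y<t S h+z<ℓ flat′ 1+y<z my run
          Q≢ : Q ≢ suc Z
          Q≢ = ℕₚ.<⇒≢ (s≤s (ℕₚ.<⇒≤ (ℕₚ.+-monoʳ-< h 1+y<z)))
          result : _ → Stage y t (suc h) × AgreeUpTo ℓ (cover lam z y (suc h)) (wt k (stageRows y t (suc h)))
            × (∀ j → H ℓ m (wt k m) j ≈ t^ (suc h ℕ.* suc (length xs)) (H ℓ (stageRows y t (suc h))
                (wt k (stageRows y t (suc h)))) j)
          -- Admissibility of h+1 already contains the runs whose failure would block the climb.
          result (inj₁ (¬all , _)) = contradiction (G .inner) ¬all
          result (inj₂ (_ , path)) with stage-suc y<t S h+z<ℓ flat′ 1+y<z my path run
          ... | Q<p , S′ = S′ , agree′ , shifted′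
            where
            agree′ : AgreeUpTo ℓ (cover lam z y (suc h)) (wt k (stageRows y t (suc h)))
            agree′ i 1≤i i≤ℓ = ≡.trans (cover-suc lam z y h i)
              (≡.trans (⊕-congAt {cover lam z y h} {wt k ρ} (Q , suc Z) {i} (agree i 1≤i i≤ℓ))
                  (≡.sym (stageRows-wt {y} {t} {h} ρQ Q≢ i)))
            unique-row : ∀ i → 1 ≤ i → i ℕ.< h ℕ.+ t → i ≢ Q → ρ i ≢ suc (h ℕ.+ t)
            unique-row i 1≤i i<p i≢Q e with ℕₚ.<-cmp i Q
            ... | tri≈ _ i≡Q _ = i≢Q i≡Q
            ... | tri< i<Q _ _ = ℕₚ.<-irrefl (≡.trans e (≡.sym ρQ)) (Stage.mono S 1≤i i<Q
                (ℕₚ.<⇒≤ (ℕₚ.+-monoʳ-< h 1+y<z)))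
            ... | tri> _ _ Q<i = ℕₚ.<-irrefl (≡.trans ρQ (≡.sym e))
                (Stage.mono S (ℕₚ.≤-trans (s≤s z≤n) (ℕₚ.m≤n+m (suc y) h)) Q<i
                    (ℕₚ.≤-trans (ℕₚ.<⇒≤ i<p) (ℕₚ.+-monoʳ-≤ h (top-≤ p))))
            bounce : ∀ j → H ℓ ρ (wt k ρ) j ≈ t^ (suc (length xs)) (H ℓ (stageRows y t (suc h))
                (wt k (stageRows y t (suc h)))) j
            bounce j = trans
              (H-bounce ℓ h+z<ℓ (ℕₚ.≤-trans (s≤s z≤n) (ℕₚ.m≤n+m (suc y) h)) Q<p path ρQ unique-row j)
              (t^-cong (suc (length xs)) (Hcoef-≗ (ideal ℓ (stageRows y t (suc h))) (λ n →
                  ≡.sym (stageRows-wt {y} {t} {h} ρQ Q≢ n))) j)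
            shifted′ : ∀ j → H ℓ m (wt k m) j ≈ t^ (suc h ℕ.* suc (length xs)) (H ℓ (stageRows y t (suc h))
                (wt k (stageRows y t (suc h)))) j
            shifted′ j = trans (shifted j) (trans (t^-cong (h ℕ.* suc (length xs)) bounce j)
              (trans (t^-+ (h ℕ.* suc (length xs)) (suc (length xs)) _ j)
                (reflexive (cong (λ n → t^ n (H ℓ (stageRows y t (suc h)) (wt k (stageRows y t (suc h)))) j)
                    (ℕₚ.+-comm (h ℕ.* suc (length xs)) _)))))

      -- If λ is flat at h+z, the wall is there and the run from z+1 extends by itself.
      -- Admissibility of h+1 can then fail only along the path, which blocks the climb, or at y+1,
      -- which leaves a ceiling above the completed path.
      stuck-vanishes : ∀ {h} → Stage y t h → Admissible y xs h → ¬ Admissible y xs (suc h) →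
        suc (h ℕ.+ z) ≤ ℓ → r (suc (h ℕ.+ z)) ≡ suc (r (h ℕ.+ z)) → Vanishes (stageRows y t h)
      stuck-vanishes {h} S G ¬G h+z<ℓ flat
        with climb y<t S h+z<ℓ flat 1≤z ℕₚ.≤-refl p (G .inner) (wall-at-end y<t S h+z<ℓ flat)
      ... | inj₁ (_ , blocked) = blocked-vanishes y<t S h+z<ℓ flat blocked
      ... | inj₂ (runs , path) = H-mirror ℓ (ℕₚ.≤-trans (ℕₚ.≤-trans (s≤s z≤n) y<t) (ℕₚ.m≤n+m t h)) h+z<ℓ path
              (top-blocked h S (top-≤ p) 1+y<z my (λ h′ e → proj₂ (G .ends h′ e)) (λ run →
                  ¬G (admissible-suc G h+z<ℓ flat run runs)))

    noUp-vanishes : ∀ Ψ (Ψ⇒ : ∀ {i j} → (i , j) ∈ Ψ → IsPosRoot ℓ (i , j) × m i ≤ j)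
      (⇒Ψ : ∀ {i j} → IsPosRoot ℓ (i , j) → m i ≤ j → (i , j) ∈ Ψ) → ∀ {t xs} → UpPath t xs z →
      upIter ℓ Ψ (suc (length xs)) (suc z) ≡ nothing → suc z ≤ ℓ → r (suc z) ≡ suc (r z) → Vanishes m
    noUp-vanishes Ψ Ψ⇒ ⇒Ψ {t} {xs} p e z<ℓ flat
      with climb (top-≥1 1≤z p) S z<ℓ flat 1≤z ℕₚ.≤-refl p (All.universal Run-zero xs)
          (wall-at-end (top-≥1 1≤z p) S z<ℓ flat)
      where
      -- No y exists in this case; with y = 0 the condition on the rows up to y is empty.
      S : Stage 0 t 0
      S = stage-zero (λ 1≤i i≤0 → contradiction (ℕₚ.≤-trans 1≤i i≤0) λ ())
    ... | inj₁ (_ , n , x , 1≤x , path , ceil) = H-mirror ℓ 1≤x z<ℓ path ceil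
    ... | inj₂ (runs , path) = H-mirror ℓ (top-≥1 1≤z p) z<ℓ path (λ i 1≤i i<t →
            Bounce.upIter-nothing Ψ Ψ⇒ ⇒Ψ 1≤z ℕₚ.≤-refl z<ℓ p runs e i 1≤i (ℕₚ.<-≤-trans i<t (top-≤ p)))

    -- The starts increase strictly on either side of row h+z, so ν can fail to be a partition in
    -- two ways only: a tie between rows h+z and h+z+1, which is left to the hypothesis on flat λ,
    -- or, if h+z = ℓ, a negative last part.
    notPar-vanishes : ∀ {ρ h ν} → (∀ {i j} → 1 ≤ i → i ℕ.< j → j ≤ h ℕ.+ z → ρ i ℕ.< ρ j) →
      (∀ {i} → 1 ≤ i → i ≤ ℓ → i ℕ.< ρ i) → (∀ {i} → h ℕ.+ z ℕ.< i → ρ i ≡ r i) → ρ (h ℕ.+ z) ≡ suc (r (h ℕ.+ z)) →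
      h ℕ.+ z ≤ ℓ → r ℓ ≤ k ℕ.+ suc ℓ → AgreeUpTo ℓ ν (wt k ρ) →
      (suc (h ℕ.+ z) ≤ ℓ → r (suc (h ℕ.+ z)) ≡ suc (r (h ℕ.+ z)) → Vanishes ρ) →
      ¬ InPar k ℓ ν → ∀ j → kschur k ℓ ν j ≈ 0#
    notPar-vanishes {ρ} {h} {ν} mono big tail end fits last agree stuck ¬par j with ℕₚ.m≤n⇒m<n∨m≡n fits
    ... | inj₂ Z≡ℓ with r ℓ ℕ.<? k ℕ.+ suc ℓ
    ...   | yes r<  = contradiction (inPar-wt agree (λ i 1≤i i<ℓ →
        mono 1≤i (ℕₚ.n<1+n i) (subst (suc i ≤_) (≡.sym Z≡ℓ) i<ℓ)) big
                        (subst (_≤ k ℕ.+ suc ℓ) (≡.sym (subst (λ Z → ρ Z ≡ suc (r Z)) Z≡ℓ end)) r<)) ¬par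
    ...   | no r≮   = kschur-negativeLast (ℕₚ.≤-trans 1≤z z≤ℓ)
        (subst (ℤ._< + 0) (≡.sym (agree ℓ (ℕₚ.≤-trans 1≤z z≤ℓ) ℕₚ.≤-refl))
                        (wt-<0 k ρ ℓ (subst (k ℕ.+ suc ℓ ℕ.<_) (≡.sym (subst (λ Z → ρ Z ≡ suc (r Z)) Z≡ℓ end))
                            (s≤s (ℕₚ.≮⇒≥ r≮))))) j
    notPar-vanishes {ρ} {h} {ν} mono big tail end fits last agree stuck ¬par j | inj₁ Z<ℓ with r
        (suc (h ℕ.+ z)) ℕ.≟ suc (r (h ℕ.+ z))
    ... | yes flat = trans (kschur-wt {r = ρ} agree j) (stuck Z<ℓ flat j)
    ... | no ¬flat = contradiction (inPar-wt agree adj big (subst (_≤ k ℕ.+ suc ℓ) (≡.sym (tail Z<ℓ)) last)) ¬par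
      where
      Z : ℕ
      Z = h ℕ.+ z
      adj : ∀ i → 1 ≤ i → i ℕ.< ℓ → ρ i ℕ.< ρ (suc i)
      adj i 1≤i i<ℓ with ℕₚ.<-cmp i Z
      ... | tri< i<Z _ _ = mono 1≤i (ℕₚ.n<1+n i) i<Z
      ... | tri≈ _ ≡.refl _ = ≡.subst₂ ℕ._<_ (≡.sym end) (≡.sym (tail (ℕₚ.n<1+n Z)))
              (ℕₚ.≤∧≢⇒< (r-mono 1≤i (ℕₚ.n<1+n Z) Z<ℓ) (¬flat ∘ ≡.sym))
      ... | tri> _ _ Z<i = ≡.subst₂ ℕ._<_ (≡.sym (tail Z<i)) (≡.sym (tail (ℕₚ.<-trans Z<i (ℕₚ.n<1+n i))))
          (r-mono 1≤i (ℕₚ.n<1+n i) i<ℓ)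

  -- The cases in the definition of the cover

  module Main (k ℓ : ℕ) (lam : ℕ → ℤ) (z : ℕ) (1≤ℓ : 1 ≤ ℓ) (par : InPar k ℓ lam) (1≤z : 1 ≤ z) (z≤ℓ : z ≤ ℓ) where
    open InPar par
    open Cover k ℓ lam z using (μ; Ψ; path; c; condH)

    r : ℕ → ℕ
    r = rows k lam

    lam≡wt : AgreeUpTo ℓ lam (wt k r)
    lam≡wt i 1≤i i≤ℓ = ≡.sym (wt-rows {k} {lam} {i} (bounded i 1≤i i≤ℓ))

    r-mono : ∀ {i j} → 1 ≤ i → i ℕ.< j → j ≤ ℓ → r i ℕ.< r j
    r-mono = increasing (λ i 1≤i i<ℓ → wt-≤⇒< k r i
      (≡.subst₂ ℤ._≤_ (lam≡wt (suc i) (s≤s z≤n) i<ℓ) (lam≡wt i 1≤i (ℕₚ.<⇒≤ i<ℓ)) (decreasing i 1≤i i<ℓ)))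

    r-big : ∀ {i} → 1 ≤ i → i ≤ ℓ → i ℕ.< r i
    r-big {i} 1≤i i≤ℓ = wt-≤k⇒< k r i (subst (ℤ._≤ + k) (lam≡wt i 1≤i i≤ℓ) (bounded i 1≤i i≤ℓ))

    r-last : r ℓ ≤ k ℕ.+ suc ℓ
    r-last = wt-≥0⇒≤ k r ℓ (subst (+ 0 ℤ.≤_) (lam≡wt ℓ 1≤ℓ ℕₚ.≤-refl) (nonneg ℓ 1≤ℓ ℕₚ.≤-refl))

    open Lowered k ℓ r z r-mono r-big 1≤z z≤ℓ

    μ≡wt : AgreeUpTo ℓ μ (wt k m)
    μ≡wt i 1≤i i≤ℓ with i ℕ.≟ z
    ... | yes ≡.refl = ≡.trans (cong₂ ℤ._-_ (lam≡wt i 1≤i i≤ℓ) ind-z) (≡.sym (wt-raise k r m z m-at))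
      where
      ind-z : ind z z z ≡ + 1
      ind-z rewrite Equivalence.to T-≡ (≤⇒≤ᵇ (ℕₚ.≤-refl {z})) = ≡.refl
    ... | no i≢z = ≡.trans (cong₂ ℤ._-_ (lam≡wt i 1≤i i≤ℓ) ind-off)
            (≡.trans (ℤₚ.+-identityʳ _) (cong (λ x → + (k ℕ.+ suc i) ℤ.- + x) (≡.sym (m-off i≢z))))
      where
      ind-off : ind z z i ≡ + 0
      ind-off with z ≤ᵇ i in zi | i ≤ᵇ z in iz
      ... | false | _     = ≡.refl
      ... | true  | false = ≡.refl
      ... | true  | true  = contradiction (ℕₚ.≤-antisym (≤ᵇ⇒≤ i z (Equivalence.from T-≡ iz))
          (≤ᵇ⇒≤ z i (Equivalence.from T-≡ zi))) i≢z

    flat-of : suc z ≤ ℓ → lam z ℤ.≤ lam (suc z) → r (suc z) ≡ suc (r z)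
    flat-of z<ℓ le = wt-run⇒ {k} {r} 1 z (≡.trans (≡.sym (lam≡wt (suc z) (s≤s z≤n) z<ℓ))
      (≡.trans (ℤₚ.≤-antisym (decreasing z 1≤z z<ℓ) le) (lam≡wt z 1≤z z≤ℓ)))

    constOn⇒Run : ∀ {a n b} → 1 ≤ a → n ℕ.+ a ≤ b → b ≤ ℓ → T (constOn μ a b) → Run a n
    constOn⇒Run {a} {n} {b} 1≤a n+a≤b b≤ℓ const d d≤n = wt-run⇒ {k} {m} d a
      (≡.trans (≡.sym (μ≡wt (d ℕ.+ a) (ℕₚ.≤-trans 1≤a (ℕₚ.m≤n+m a d)) (ℕₚ.≤-trans d+a≤b b≤ℓ)))
        (≡.trans (constOn⇒≡ {μ} {a} {b} const (d ℕ.+ a) (ℕₚ.m≤n+m a d) d+a≤b)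
          (μ≡wt a 1≤a (ℕₚ.≤-trans (ℕₚ.m≤n+m a d) (ℕₚ.≤-trans d+a≤b b≤ℓ)))))
      where
      d+a≤b : d ℕ.+ a ≤ b
      d+a≤b = ℕₚ.≤-trans (ℕₚ.+-monoˡ-≤ a d≤n) n+a≤b

    Run⇒constOn : ∀ {a n b} → 1 ≤ a → b ≤ n ℕ.+ a → b ≤ ℓ → Run a n → T (constOn μ a b)
    Run⇒constOn {a} {n} {b} 1≤a b≤n+a b≤ℓ run = ≡⇒constOn {μ} {a} {b} λ i a≤i i≤b →
      let d+a≡i = ℕₚ.m∸n+n≡m a≤i in
      ≡.trans (μ≡wt i (ℕₚ.≤-trans 1≤a a≤i) (ℕₚ.≤-trans i≤b b≤ℓ))
        (≡.trans (subst (λ i → wt k m i ≡ wt k m a) d+a≡i (wt-run⇐ {k} {m} (i ∸ a) a (run (i ∸ a)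
            (ℕₚ.≤-trans (ℕₚ.∸-monoˡ-≤ a (ℕₚ.≤-trans i≤b b≤n+a)) (ℕₚ.≤-reflexive (ℕₚ.m+n∸n≡m n a))))))
          (≡.sym (μ≡wt a 1≤a (ℕₚ.≤-trans a≤i (ℕₚ.≤-trans i≤b b≤ℓ)))))

    open Bounce Ψ (Δk⇒row {k} {ℓ} {m} {μ} μ≡wt) (row⇒Δk {k} {ℓ} {m} {μ} μ≡wt)

    module _ {t xs} (path≡ : path ≡ z ∷ xs) (p : UpPath t xs z) where
      xs<z : All (ℕ._< z) xs
      xs<z = UpPath-below ℕₚ.≤-refl p

      All≥1 : ∀ {xs q} → UpPath t xs q → All (1 ≤_) xs
      All≥1 (top _)          = []
      All≥1 (step 1≤x _ _ p) = 1≤x ∷ All≥1 p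

      c≡ : c ≡ suc (length xs)
      c≡ = cong length path≡

      inners : List ℕ
      inners = filterᵇ (λ x → not (x == z)) path

      innerConst : ℕ → Bool
      innerConst h = all (λ x → constOn μ x (x ℕ.+ h)) inners

      -- The intervals from z+1 and y+1 have h+1 positions and give runs of length h; those from the
      -- path entries have h+2 positions and give runs of length h+1.
      condH⇒ : ∀ {y h} → suc y ℕ.< z → suc h ℕ.+ z ≤ ℓ → T (condH y (suc h)) → Admissible y xs (suc h)
      condH⇒ {y} {h} 1+y<z fits′ cond with Equivalence.to T-∧ cond
      ... | const-z , cond′ with Equivalence.to (T-∧ {innerConst (suc h)}) cond′
      ...   | consts , const-y = record
        { fits = fits′
        ; ends = λ { h′ ≡.refl → constOn⇒Run (s≤s z≤n) (ℕₚ.≤-reflexive (+-suc-comm h z)) z+h≤ℓ const-z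
                               , constOn⇒Run (s≤s z≤n) (ℕₚ.≤-reflexive (+-suc-comm h y))
                                   (below (ℕₚ.<⇒≤ (ℕₚ.<-trans (ℕₚ.n<1+n y) 1+y<z))) const-y }
        ; inner = All.tabulate λ {x} x∈ → constOn⇒Run (All.lookup (All≥1 p) x∈)
            (ℕₚ.≤-reflexive (ℕₚ.+-comm (suc h) x))
            (below (ℕₚ.<⇒≤ (All.lookup xs<z x∈)))
            (All.lookup (Allₚ.all⁺ (λ x → constOn μ x (x ℕ.+ suc h)) inners consts) (∈-filter⁺ (T? ∘ λ x →
                not (x == z))
              (subst (x ∈_) (≡.sym path≡) (there x∈)) (not-T (λ e → ℕₚ.<⇒≢ (All.lookup xs<z x∈) (ℕₚ.≡ᵇ⇒≡ x z e)))))
        }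
        where
        z+h≤ℓ : z ℕ.+ suc h ≤ ℓ
        z+h≤ℓ = subst (_≤ ℓ) (ℕₚ.+-comm (suc h) z) fits′
        below : ∀ {x} → x ≤ z → x ℕ.+ suc h ≤ ℓ
        below x≤z = ℕₚ.≤-trans (ℕₚ.+-monoˡ-≤ (suc h) x≤z) z+h≤ℓ

      ⇒condH : ∀ {y h} → suc y ℕ.< z → Admissible y xs (suc h) → T (condH y (suc h))
      ⇒condH {y} {h} 1+y<z G = Equivalence.from T-∧
        ( Run⇒constOn (s≤s z≤n) (ℕₚ.≤-reflexive (+-suc-comm z h)) z+h≤ℓ (proj₁ (ends h ≡.refl))
        , Equivalence.from (T-∧ {innerConst (suc h)})
          ( Allₚ.all⁻ (λ x → constOn μ x (x ℕ.+ suc h)) (All.tabulate inner-const)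
          , Run⇒constOn (s≤s z≤n) (ℕₚ.≤-reflexive (+-suc-comm y h))
              (below (ℕₚ.<⇒≤ (ℕₚ.<-trans (ℕₚ.n<1+n y) 1+y<z))) (proj₂ (ends h ≡.refl))))
        where
        open Admissible G
        z+h≤ℓ : z ℕ.+ suc h ≤ ℓ
        z+h≤ℓ = subst (_≤ ℓ) (ℕₚ.+-comm (suc h) z) fits
        below : ∀ {x} → x ≤ z → x ℕ.+ suc h ≤ ℓ
        below x≤z = ℕₚ.≤-trans (ℕₚ.+-monoˡ-≤ (suc h) x≤z) z+h≤ℓ
        inner-const : ∀ {x} → x ∈ inners → T (constOn μ x (x ℕ.+ suc h))
        inner-const {x} x∈ with ∈-filter⁻ (T? ∘ λ x → not (x == z)) {xs = path} x∈
        ... | x∈path , x≢z with subst (x ∈_) path≡ x∈path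
        ...   | here ≡.refl = contradiction (ℕₚ.≡⇒≡ᵇ z z ≡.refl) (T-not x≢z)
        ...   | there x∈xs = Run⇒constOn (All.lookup (All≥1 p) x∈xs) (ℕₚ.≤-reflexive (ℕₚ.+-comm x (suc h)))
                  (below (ℕₚ.<⇒≤ (All.lookup xs<z x∈xs))) (All.lookup inner x∈xs)

      Straightens : ℕ × ℕ → Set b
      Straightens (h , y) = (∀ j → kschur k ℓ μ j ≈ tshift (h ℕ.* c) (kschur k ℓ (cover lam z y h)) j)
        × (¬ InPar k ℓ (cover lam z y h) → ∀ j → kschur k ℓ (cover lam z y h) j ≈ 0#)

      straightens-zero : (suc z ≤ ℓ → r (suc z) ≡ suc (r z) → Vanishes k ℓ r z r-mono r-big 1≤z z≤ℓ m) →
          Straightens (0 , 0)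
      straightens-zero stuck =
        (λ j → Hcoef-same j) ,
        (λ ¬par → notPar-vanishes k ℓ r z r-mono r-big 1≤z z≤ℓ {m} {0} m-mono m-big (λ z<i →
            m-off (ℕₚ.>⇒≢ z<i)) m-at z≤ℓ r-last agree stuck ¬par)
        where
        agree : AgreeUpTo ℓ (cover lam z 0 0) (wt k m)
        agree i 1≤i i≤ℓ = ≡.trans (cover-zero lam z 0 i) (μ≡wt i 1≤i i≤ℓ)
        Hcoef-same : ∀ j → kschur k ℓ μ j ≈ kschur k ℓ (cover lam z 0 0) j
        Hcoef-same j = trans (kschur-wt {r = m} μ≡wt j) (sym (kschur-wt {r = m} agree j))

      straightens : ∀ {hy} → CoverCase k ℓ lam z hy → Straightens hy
      straightens (lastRow z≡ℓ) = straightens-zero (λ z<ℓ _ → contradiction z≡ℓ (ℕₚ.<⇒≢ z<ℓ))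
      straightens (corner lt) = straightens-zero (λ z<ℓ flat → contradiction lt
        (ℤₚ.≤⇒≯ (ℤₚ.≤-reflexive (≡.trans (lam≡wt z 1≤z z≤ℓ) (≡.trans (≡.sym (wt-level k r z flat))
            (≡.sym (lam≡wt (suc z) (s≤s z≤n) z<ℓ)))))))
      straightens (noUp _ _ e) = straightens-zero (λ z<ℓ flat →
        noUp-vanishes k ℓ r z r-mono r-big 1≤z z≤ℓ Ψ (Δk⇒row {k} {ℓ} {m} {μ} μ≡wt) (row⇒Δk {k} {ℓ} {m} {μ} μ≡wt) p
          (subst (λ c → upIter ℓ Ψ c (suc z) ≡ nothing) c≡ e) z<ℓ flat)
      straightens (found {w} z≢ℓ le e)
        with upIter-just ℕₚ.≤-refl p (subst (λ c → upIter ℓ Ψ c (suc z) ≡ just w) c≡ e)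
      straightens (found {suc y} z≢ℓ le e) | 1≤w , 1+y<z , my = power , notPar
        where
        h : ℕ
        h = maxSat (ℓ ∸ z) (condH y)
        h≤ : h ≤ ℓ ∸ z
        h≤ = maxSat-≤ (ℓ ∸ z) (condH y)
        fits≤ : ∀ {h} → h ≤ ℓ ∸ z → h ℕ.+ z ≤ ℓ
        fits≤ h≤ = ℕₚ.≤-trans (ℕₚ.+-monoˡ-≤ z h≤) (ℕₚ.≤-reflexive (ℕₚ.m∸n+n≡m z≤ℓ))
        y<t : y ℕ.< t
        y<t = ℕₚ.≤-pred (subst (suc y ℕ.<_) my (m-big (s≤s z≤n) (ℕₚ.≤-trans (ℕₚ.<⇒≤ 1+y<z) z≤ℓ)))
        admissible : Admissible y xs h
        admissible = go h h≤ (λ _ → maxSat-holds (ℓ ∸ z) (condH y))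
          where
          go : ∀ h → h ≤ ℓ ∸ z → (∀ h′ → h ≡ suc h′ → T (condH y (suc h′))) → Admissible y xs h
          -- `maxSat` returns 0 by default without testing it; at 0 every run condition is void.
          go zero    h≤ _    = record { fits = z≤ℓ ; ends = λ _ () ; inner = All.universal Run-zero xs }
          go (suc h) h≤ cond = condH⇒ 1+y<z (fits≤ h≤) (cond h ≡.refl)
        ¬admissible : ¬ Admissible y xs (suc h)
        ¬admissible G = maxSat-maximal (ℓ ∸ z) (condH y) (ℕₚ.n<1+n h)
          (ℕₚ.≤-trans (ℕₚ.≤-reflexive (≡.sym (ℕₚ.m+n∸n≡m (suc h) z))) (ℕₚ.∸-monoˡ-≤ z (Admissible.fits G)))
              (⇒condH 1+y<z G)
        advanced : Stage y t h × AgreeUpTo ℓ (cover lam z y h) (wt k (stageRows y t h))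
          × (∀ j → H ℓ m (wt k m) j ≈ t^ (h ℕ.* suc (length xs)) (H ℓ (stageRows y t h) (wt k (stageRows y t h))) j)
        advanced = advance k ℓ r z r-mono r-big 1≤z z≤ℓ y<t p 1+y<z my lam μ≡wt (λ z<ℓ → flat-of z<ℓ le) h
            admissible
        S : Stage y t h
        S = proj₁ advanced
        agree : AgreeUpTo ℓ (cover lam z y h) (wt k (stageRows y t h))
        agree = proj₁ (proj₂ advanced)
        power : ∀ j → kschur k ℓ μ j ≈ tshift (h ℕ.* c) (kschur k ℓ (cover lam z y h)) j
        power j = begin
          kschur k ℓ μ j
            ≈⟨ trans (kschur-wt {r = m} μ≡wt j) (proj₂ (proj₂ advanced) j) ⟩
          t^ (h ℕ.* suc (length xs)) (H ℓ (stageRows y t h) (wt k (stageRows y t h))) j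
            ≈⟨ t^-cong (h ℕ.* suc (length xs)) (λ j → sym (kschur-wt {r = stageRows y t h} agree j)) j ⟩
          t^ (h ℕ.* suc (length xs)) (kschur k ℓ (cover lam z y h)) j
            ≈⟨ t^-tshift (h ℕ.* suc (length xs)) (kschur k ℓ (cover lam z y h)) j ⟩
          tshift (h ℕ.* suc (length xs)) (kschur k ℓ (cover lam z y h)) j
            ≈⟨ reflexive (cong (λ c → tshift (h ℕ.* c) (kschur k ℓ (cover lam z y h)) j) (≡.sym c≡)) ⟩
          tshift (h ℕ.* c) (kschur k ℓ (cover lam z y h)) j ∎
        notPar : ¬ InPar k ℓ (cover lam z y h) → ∀ j → kschur k ℓ (cover lam z y h) j ≈ 0#
        notPar = notPar-vanishes k ℓ r z r-mono r-big 1≤z z≤ℓ {stageRows y t h} {h} (Stage.mono S)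
            (Stage.big S) (Stage.tail S) (Stage.end S)
          (Admissible.fits admissible) r-last agree
          (stuck-vanishes k ℓ r z r-mono r-big 1≤z z≤ℓ y<t p 1+y<z my S admissible ¬admissible)

    straightening : (∀ j → kschur k ℓ μ j ≈ tshift (Cover.h k ℓ lam z ℕ.* c) (kschur k ℓ (Cover.cvr k ℓ lam z)) j)
      × (¬ InPar k ℓ (Cover.cvr k ℓ lam z) → ∀ j → kschur k ℓ μ j ≈ 0# × kschur k ℓ (Cover.cvr k ℓ lam z) j ≈ 0#)
    straightening with uppathF-spec z z 1≤z ℕₚ.≤-refl ℕₚ.≤-refl
    ... | t , xs , path≡ , p = power , λ ¬par j → trans (power j) (shifted-zero (Cover.h k ℓ lam z ℕ.* c)
        (zeros ¬par) j) , zeros ¬par j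
      where
      power = proj₁ (straightens path≡ p (coverCase k ℓ lam z))
      zeros = proj₂ (straightens path≡ p (coverCase k ℓ lam z))
      shifted-zero : ∀ n {f} → (∀ j → f j ≈ 0#) → ∀ j → tshift n f j ≈ 0#
      shifted-zero n e j with n ≤ᵇ j
      ... | true  = e _
      ... | false = refl

open import Data.Nat using (_*_)

theorem7p12 : {a b : Level} (R : CommutativeRing a b) (hs : ℕ → CommutativeRing.Carrier R)
    (k ℓ : ℕ) (lam : ℕ → ℤ) (z : ℕ) →
    1 ≤ k → 1 ≤ ℓ → InPar k ℓ lam → 1 ≤ z → z ≤ ℓ →
    ((m : ℕ) → CommutativeRing._≈_ R
    (SymFun.kschur R hs k ℓ (Cover.μ k ℓ lam z) m)
    (SymFun.tshift R hs (Cover.h k ℓ lam z * Cover.c k ℓ lam z)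
    (SymFun.kschur R hs k ℓ (Cover.cvr k ℓ lam z)) m))
    × (¬ InPar k ℓ (Cover.cvr k ℓ lam z) →
    (m : ℕ) → CommutativeRing._≈_ R (SymFun.kschur R hs k ℓ (Cover.μ k ℓ lam z) m) (CommutativeRing.0# R)
    × CommutativeRing._≈_ R (SymFun.kschur R hs k ℓ (Cover.cvr k ℓ lam z) m) (CommutativeRing.0# R))
theorem7p12 R hs k ℓ lam z _ 1≤ℓ par 1≤z z≤ℓ = CatalanFunctions.Main.straightening R hs k ℓ lam z 1≤ℓ par 1≤z z≤ℓ
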